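{- Let $k > r \geq 2$ be integers. Let $j=j_{k,r}$, $\ell=\ell_{k,r}$, and $m=\min\{j,\ell\}$. Then: \begin{enumerate} \item[I.] $w_{2}(k;r) = rk$ if $j=0$. \item[II.] $w_{2}(k;r) = rk-r+1$ if either (i) $j=1$; or (ii) $r$ is prime and $\ell=0$. \item[III.] If $r$ is composite and $j \geq 2$, then $w_2(k;r) \geq rk-j(r-2)$, with equality provided either (i) $j=2$ and $k \geq 2r-3$; or (ii) $j \geq 3$ and $k \geq (\pi(r))^{3}(r-2)$. \item[IV.] If $r$ is prime, $j\geq 2$, and $\ell \geq 1$, then $w_2(k;r) \geq rk-m(r-2)$, with equality provided either (i) $\ell =1$, (ii) $m=2$ and $k \geq 2r-3$, or (iii) $m \geq 3$ and $k \geq (\pi(r))^{3}(r-2)$. \end{enumerate}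
   Context: For positive integers $r, k_0,\dots,k_{r-1}$, the van der Waerden number $w(k_0,k_1,\dots,k_{r-1};r)$ is the least positive integer $n$ such that every coloring $\chi:\{1,2,\dots,n\}\to\{0,1,\dots,r-1\}$ admits, for some $i$ with $0\le i\le r-1$, a $k_i$-term arithmetic progression $\{x,x+d,\dots,x+(k_i-1)d\}$ (with $d\ge 1$) all of whose elements have color $i$. For $k,r\ge 2$, $w_2(k;r)$ denotes $w(k,2,2,\dots,2;r)$, i.e. $k_0=k$ and $k_1=\dots=k_{r-1}=2$. Let $p_1<p_2<\cdots$ be the primes; $\pi(r)$ is the number of primes not exceeding $r$, and $\#r=p_1p_2\cdots p_{\pi(r)}$ is the product of all primes not exceeding $r$. For $k,r\ge 2$, $j_{k,r}=\min\{j\ge 0:\gcd(k-j,\#r)=1\}$ and $\ell_{k,r}=\min\{\ell\ge 0:\gcd(k-\ell,\#r)=r\}$. -}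

module Defs where

open import Data.Nat using (ℕ; zero; suc; _+_; _*_; _∸_; _≤_; _<_)
open import Data.Nat.GCD using (gcd)
open import Data.Nat.Primality using (Prime; prime?)
open import Data.Fin using (Fin)
open import Data.Product using (∃; _×_)
open import Relation.Nullary using (¬_; yes; no)
open import Relation.Binary.PropositionalEquality using (_≡_)

Least : (ℕ → Set) → ℕ → Set
Least P n = P n × (∀ m → m < n → ¬ P m)

-- The coloring property for n: every r-coloring of {1,...,n} has, for some
-- colour i, a ks i - term AP (x, x+d, ..., x+(ks i - 1)d), d ≥ 1, inside
-- {1,...,n}, monochromatic of colour i.  Colorings are functions ℕ → Fin r
-- of which only the values on {1,...,n} matter.
VdWProperty : (r : ℕ) → (Fin r → ℕ) → ℕ → Set
VdWProperty r ks n =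
  (χ : ℕ → Fin r) → ∃ λ (i : Fin r) → ∃ λ x → ∃ λ d →
    1 ≤ x × 1 ≤ d × x + (ks i ∸ 1) * d ≤ n ×
    (∀ t → t < ks i → χ (x + t * d) ≡ i)

IsVdW : (r : ℕ) → (Fin r → ℕ) → ℕ → Set
IsVdW r ks n = Least (VdWProperty r ks) n

VdWAtLeast : (r : ℕ) → (Fin r → ℕ) → ℕ → Set
VdWAtLeast r ks n = ∀ m → m < n → ¬ VdWProperty r ks m

k22 : ℕ → {r : ℕ} → Fin r → ℕ
k22 k Fin.zero    = k
k22 k (Fin.suc _) = 2

IsW₂ : ℕ → ℕ → ℕ → Set
IsW₂ k r n = IsVdW r (k22 k) n

W₂AtLeast : ℕ → ℕ → ℕ → Set
W₂AtLeast k r n = VdWAtLeast r (k22 k) n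

primorial : ℕ → ℕ
primorial zero = 1
primorial (suc n) with prime? (suc n)
... | yes _ = suc n * primorial n
... | no  _ = primorial n

primeCount : ℕ → ℕ
primeCount zero = 0
primeCount (suc n) with prime? (suc n)
... | yes _ = suc (primeCount n)
... | no  _ = primeCount n

IsJ : ℕ → ℕ → ℕ → Set
IsJ k r = Least (λ j → gcd (k ∸ j) (primorial r) ≡ 1)

IsL : ℕ → ℕ → ℕ → Set
IsL k r = Least (λ l → gcd (k ∸ l) (primorial r) ≡ r)

-- A colouring of {1,…,n} avoiding the progressions is a set of at most r − 1 points (the uses of the colours i ≥ 1)
-- that meets every k-term progression.  Lower bounds: take points with constant step q, a number coprime to all
-- relevant differences d, so that every progression runs through all classes modulo q.  Upper bounds: the gaps between
-- consecutive points are at most k, so if n is large some inner gap is k − t with t < m; by minimality of j and ℓ it is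
-- divisible by a prime p < r.  But as long as m (r − 2) ≤ k, a window of p k integers around this gap contains exactly
-- p points, one in each class modulo p, a contradiction.
--
-- It remains to see that j ≤ π(r)³, a bound for Jacobsthal's function.  This is proved for all r by the linear sieve,
-- run as an exact induction over Buchstab's identity S(d, p) = S(d, p − 1) − S(d p, p − 1).  With V = Π (1 − 1/p), N the
-- length of the interval and s = V log₂(N/d) 32/27, the normalised count y = s S(d, z) d / (N V) is kept between two
-- polygons in s, which satisfy discrete forms of the delay equations (s f(s))′ = F(s − 1), (s F(s))′ = f(s − 1); the
-- scale makes one sieving step lower s by at most 1, provided that 32 V(p − 1) log₂ p ≤ 27.  The lower polygon is
-- positive from s = 83/40 on.  The required estimates of V are computed for primes up to 10⁶ and extended beyond by
-- Mertens-type arguments from the prime factorisation of N!, and small r are handled by iterating Buchstab's identity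
-- numerically.

module Submission where

open import Defs
open import Data.Nat
open import Data.Nat.Properties
open import Data.Nat.Divisibility
open import Data.Nat.DivMod using ([m+kn]%n≡m%n; m%n<n; m/n*n≤m; m<n⇒m%n≡m; m≡m%n+[m/n]*n)
open import Data.Nat.Primality using (Composite; Prime; _Rough_; euclidsLemma; prime?; prime[2]; prime⇒irreducible; prime⇒nonTrivial; prime⇒nonZero; prime⇒¬composite; rough∧square>⇒prime)
open import Data.Nat.Tactic.RingSolver using (solve-∀)
open import Data.Bool using (Bool; T; _∧_; _∨_; false; if_then_else_; true)
open import Data.Product using (_,_; _×_; proj₁; proj₂; ∃)
open import Data.Sum using (_⊎_; inj₁; inj₂)
open import Data.Empty using (⊥; ⊥-elim)
open import Function using (_∘_)
open import Relation.Nullary using (Dec; does; no; yes; ¬_)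
open import Relation.Nullary.Decidable using (_×-dec_; from-no; from-yes; map′; ¬?)
open import Relation.Binary using (tri<; tri>; tri≈)
open import Relation.Binary.PropositionalEquality

-- The exponent 3 dictates the method. With N = π(r)³ the parameter s is only about 2.1 when r is a
-- few hundred, so the sieve must work almost down to s = 2, the limit of the linear sieve; cruder
-- sieves would give a larger power. The scale 27 comes from Mertens' theorem: 32 V log₂ p tends to
-- 32 exp(-γ) / ln 2 ≈ 25.92, and the excess pays for rounding. There is no sum of remainder terms:
-- Buchstab's identity is exact, and rounding errors enter only with the counts after 2 and 3, where
-- they are of order d / N, exponentially small in s. The polygons keep a distance of order 1 / s²
-- from their common asymptote y = s, which satisfies both delay conditions with equality, so they
-- have room for such errors. All fractions are multiplied out: a / b stands for the abscissa, y /
-- (b N) for the ordinate, and one unit of s is divided into 40 cells.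

-- Polygons bounding the sieve, and a single sieving step.

module SieveProfile where

  totientProduct : ℕ → ℕ
  totientProduct zero = 1
  totientProduct (suc n) with prime? (suc n)
  ... | yes _ = n * totientProduct n
  ... | no  _ = totientProduct n

  primorial-prime : ∀ {n} → Prime (suc n) → primorial (suc n) ≡ suc n * primorial n
  primorial-prime {n} p with prime? (suc n)
  ... | yes _ = refl
  ... | no ¬p = ⊥-elim (¬p p)

  primorial-nonprime : ∀ {n} → ¬ Prime (suc n) → primorial (suc n) ≡ primorial n
  primorial-nonprime {n} ¬p with prime? (suc n)
  ... | yes p = ⊥-elim (¬p p)
  ... | no _ = refl

  totient-prime : ∀ {n} → Prime (suc n) → totientProduct (suc n) ≡ n * totientProduct n
  totient-prime {n} p with prime? (suc n)
  ... | yes _ = refl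
  ... | no ¬p = ⊥-elim (¬p p)

  totient-nonprime : ∀ {n} → ¬ Prime (suc n) → totientProduct (suc n) ≡ totientProduct n
  totient-nonprime {n} ¬p with prime? (suc n)
  ... | yes p = ⊥-elim (¬p p)
  ... | no _ = refl

  primorial>0 : ∀ n → 0 < primorial n
  primorial>0 zero = s≤s z≤n
  primorial>0 (suc n) with prime? (suc n)
  ... | yes _ = *-mono-≤ (s≤s (z≤n {n})) (primorial>0 n)
  ... | no  _ = primorial>0 n

  totient>0 : ∀ n → 0 < totientProduct n
  totient>0 zero = s≤s z≤n
  totient>0 (suc n) with prime? (suc n)
  ... | yes p = *-mono-≤ (s≤s⁻¹ (nonTrivial⇒n>1 (suc n) {{prime⇒nonTrivial p}})) (totient>0 n)
  ... | no  _ = totient>0 n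

  *-cancelˡ-≤′ : ∀ c {a b} → 0 < c → c * a ≤ c * b → a ≤ b
  *-cancelˡ-≤′ c@(suc _) _ le = *-cancelˡ-≤ c le

  split-≤ : ∀ {a b} → a ≤ b → ∃ λ δ → b ≡ a + δ
  split-≤ {a} {b} le = b ∸ a , sym (m+[n∸m]≡n le)

  module _ where
    open ≤-Reasoning

    -- The lower polygon is concave: the line of the cell left of the vertex `k` is steeper and not
    -- higher at `k`, hence lies below the other line for all abscissae up to `k`.
    pass-low : ∀ u v w u′ v′ w′ k {a b N y} → 0 < u → a ≤ k * b → u′ * w ≤ u * w′ →
      u * w′ * k + u′ * v ≤ u * v′ + u′ * w * k →
      w * (a * N) ≤ u * y + v * (b * N) → w′ * (a * N) ≤ u′ * y + v′ * (b * N)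
    pass-low u v w u′ v′ w′ k {a} {b} {N} {y} u>0 a≤kb mono join low with split-≤ mono
    ... | δ , eq = *-cancelˡ-≤′ u u>0 (+-cancelʳ-≤ (u′ * v * (b * N)) _ _ (begin
        u * (w′ * (a * N)) + u′ * v * (b * N)
          ≡⟨ cong (_+ u′ * v * (b * N)) (trans (sym (*-assoc u w′ (a * N))) (cong (_* (a * N)) eq)) ⟩
        (u′ * w + δ) * (a * N) + u′ * v * (b * N)
          ≡⟨ e₁ u′ w δ a N v b ⟩
        u′ * (w * (a * N)) + (δ * a + u′ * v * b) * N
          ≤⟨ +-mono-≤ (*-monoʳ-≤ u′ low) (*-monoˡ-≤ N (+-monoˡ-≤ (u′ * v * b) (*-monoʳ-≤ δ a≤kb))) ⟩
        u′ * (u * y + v * (b * N)) + (δ * (k * b) + u′ * v * b) * N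
          ≡⟨ e₂ u′ u y v b N δ k ⟩
        u′ * (u * y + v * (b * N)) + (δ * k + u′ * v) * (b * N)
          ≤⟨ +-monoʳ-≤ (u′ * (u * y + v * (b * N))) (*-monoˡ-≤ (b * N) join′) ⟩
        u′ * (u * y + v * (b * N)) + u * v′ * (b * N)
          ≡⟨ e₃ u′ u y v b N v′ ⟩
        u * (u′ * y + v′ * (b * N)) + u′ * v * (b * N) ∎))
      where
      join′ : δ * k + u′ * v ≤ u * v′
      join′ = +-cancelˡ-≤ (u′ * w * k) _ _ (begin
        u′ * w * k + (δ * k + u′ * v) ≡⟨ e₀ (u′ * w) k δ (u′ * v) ⟩
        (u′ * w + δ) * k + u′ * v ≡⟨ cong (λ x → x * k + u′ * v) (sym eq) ⟩
        u * w′ * k + u′ * v ≤⟨ join ⟩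
        u * v′ + u′ * w * k ≡⟨ +-comm (u * v′) _ ⟩
        u′ * w * k + u * v′ ∎)
        where
        e₀ : ∀ x k δ t → x * k + (δ * k + t) ≡ (x + δ) * k + t
        e₀ = solve-∀
      e₁ : ∀ u′ w δ a N v b → (u′ * w + δ) * (a * N) + u′ * v * (b * N) ≡ u′ * (w * (a * N)) + (δ * a + u′ * v * b) * N
      e₁ = solve-∀
      e₂ : ∀ u′ u y v b N δ k → u′ * (u * y + v * (b * N)) + (δ * (k * b) + u′ * v * b) * N ≡ u′ * (u * y + v * (b * N)) + (δ * k + u′ * v) * (b * N)
      e₂ = solve-∀
      e₃ : ∀ u′ u y v b N v′ → u′ * (u * y + v * (b * N)) + u * v′ * (b * N) ≡ u * (u′ * y + v′ * (b * N)) + u′ * v * (b * N)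
      e₃ = solve-∀

    -- Same argument for the convex upper polygon: left of `k` the flatter line lies above.
    pass-up : ∀ u v w u′ v′ w′ k {a b N y} → 0 < u → a ≤ k * b → u * w′ ≤ u′ * w →
      u′ * v + u′ * w * k ≤ u * v′ + u * w′ * k →
      u * y ≤ v * (b * N) + w * (a * N) → u′ * y ≤ v′ * (b * N) + w′ * (a * N)
    pass-up u v w u′ v′ w′ k {a} {b} {N} {y} u>0 a≤kb mono join up with split-≤ mono
    ... | δ , eq = *-cancelˡ-≤′ u u>0 (begin
        u * (u′ * y) ≡⟨ e₁ u u′ y ⟩
        u′ * (u * y) ≤⟨ *-monoʳ-≤ u′ up ⟩
        u′ * (v * (b * N) + w * (a * N)) ≡⟨ e₂ u′ v b N w a ⟩
        u′ * v * (b * N) + u′ * w * (a * N) ≡⟨ cong (λ x → u′ * v * (b * N) + x * (a * N)) eq ⟩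
        u′ * v * (b * N) + (u * w′ + δ) * (a * N) ≡⟨ e₃ (u′ * v) b N (u * w′) δ a ⟩
        (δ * a + u′ * v * b) * N + u * w′ * (a * N)
          ≤⟨ +-monoˡ-≤ (u * w′ * (a * N)) (*-monoˡ-≤ N (+-monoˡ-≤ (u′ * v * b) (*-monoʳ-≤ δ a≤kb))) ⟩
        (δ * (k * b) + u′ * v * b) * N + u * w′ * (a * N) ≡⟨ e₄ δ k b (u′ * v) N (u * w′ * (a * N)) ⟩
        (δ * k + u′ * v) * (b * N) + u * w′ * (a * N) ≤⟨ +-monoˡ-≤ (u * w′ * (a * N)) (*-monoˡ-≤ (b * N) join′) ⟩
        u * v′ * (b * N) + u * w′ * (a * N) ≡⟨ e₅ u v′ b N w′ a ⟩
        u * (v′ * (b * N) + w′ * (a * N)) ∎)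
      where
      join′ : δ * k + u′ * v ≤ u * v′
      join′ = +-cancelʳ-≤ (u * w′ * k) _ _ (begin
        δ * k + u′ * v + u * w′ * k ≡⟨ e₀ (u * w′) k δ (u′ * v) ⟩
        u′ * v + (u * w′ + δ) * k ≡⟨ cong (λ x → u′ * v + x * k) (sym eq) ⟩
        u′ * v + u′ * w * k ≤⟨ join ⟩
        u * v′ + u * w′ * k ∎)
        where
        e₀ : ∀ x k δ t → δ * k + t + x * k ≡ t + (x + δ) * k
        e₀ = solve-∀
      e₁ : ∀ u u′ y → u * (u′ * y) ≡ u′ * (u * y)
      e₁ = solve-∀
      e₂ : ∀ u′ v b N w a → u′ * (v * (b * N) + w * (a * N)) ≡ u′ * v * (b * N) + u′ * w * (a * N)
      e₂ = solve-∀
      e₃ : ∀ x b N t δ a → x * (b * N) + (t + δ) * (a * N) ≡ (δ * a + x * b) * N + t * (a * N)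
      e₃ = solve-∀
      e₄ : ∀ δ k b x N t → (δ * (k * b) + x * b) * N + t ≡ (δ * k + x) * (b * N) + t
      e₄ = solve-∀
      e₅ : ∀ u v′ b N w′ a → u * v′ * (b * N) + u * w′ * (a * N) ≡ u * (v′ * (b * N) + w′ * (a * N))
      e₅ = solve-∀

    -- Beyond abscissa k a line with nonnegative intercept stays below the chord from the origin to its point at k.
    ratio-up : ∀ u v w k p q {a b N y} → 0 < u → 0 < k → k * b ≤ a →
      (v + w * k) * q ≤ p * (u * k) →
      u * y ≤ v * (b * N) + w * (a * N) → q * y ≤ p * (a * N)
    ratio-up u v w k p q {a} {b} {N} {y} u>0 k>0 kb≤a chord up =
      *-cancelˡ-≤′ (u * k) (*-mono-≤ u>0 k>0) (begin
        u * k * (q * y) ≡⟨ e₁ u k q y ⟩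
        q * k * (u * y) ≤⟨ *-monoʳ-≤ (q * k) up ⟩
        q * k * (v * (b * N) + w * (a * N)) ≡⟨ e₂ q k v b N w a ⟩
        q * (v * (k * b * N) + w * k * (a * N))
          ≤⟨ *-monoʳ-≤ q (+-monoˡ-≤ (w * k * (a * N)) (*-monoʳ-≤ v (*-monoˡ-≤ N kb≤a))) ⟩
        q * (v * (a * N) + w * k * (a * N)) ≡⟨ e₃ q v w k (a * N) ⟩
        (v + w * k) * q * (a * N) ≤⟨ *-monoˡ-≤ (a * N) chord ⟩
        p * (u * k) * (a * N) ≡⟨ e₄ p (u * k) (a * N) ⟩
        u * k * (p * (a * N)) ∎)
      where
      e₁ : ∀ u k q y → u * k * (q * y) ≡ q * k * (u * y)
      e₁ = solve-∀
      e₂ : ∀ q k v b N w a → q * k * (v * (b * N) + w * (a * N)) ≡ q * (v * (k * b * N) + w * k * (a * N))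
      e₂ = solve-∀
      e₃ : ∀ q v w k x → q * (v * x + w * k * x) ≡ (v + w * k) * q * x
      e₃ = solve-∀
      e₄ : ∀ p c x → p * c * x ≡ c * (p * x)
      e₄ = solve-∀

    ratio-low : ∀ u v w k p q {a b N y} → 0 < u → 0 < k → k * b ≤ a →
      p * (u * k) + q * v ≤ q * (w * k) →
      w * (a * N) ≤ u * y + v * (b * N) → p * (a * N) ≤ q * y
    ratio-low u v w k p q {a} {b} {N} {y} u>0 k>0 kb≤a chord low =
      *-cancelˡ-≤′ (u * k) (*-mono-≤ u>0 k>0) (+-cancelʳ-≤ (q * v * (a * N)) _ _ (begin
        u * k * (p * (a * N)) + q * v * (a * N) ≡⟨ e₁ u k p (a * N) (q * v) ⟩
        (p * (u * k) + q * v) * (a * N) ≤⟨ *-monoˡ-≤ (a * N) chord ⟩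
        q * (w * k) * (a * N) ≡⟨ e₂ q w k (a * N) ⟩
        q * k * (w * (a * N)) ≤⟨ *-monoʳ-≤ (q * k) low ⟩
        q * k * (u * y + v * (b * N)) ≡⟨ e₃ q k u y v b N ⟩
        u * k * (q * y) + q * v * (k * b * N) ≤⟨ +-monoʳ-≤ (u * k * (q * y)) (*-monoʳ-≤ (q * v) (*-monoˡ-≤ N kb≤a)) ⟩
        u * k * (q * y) + q * v * (a * N) ∎))
      where
      e₁ : ∀ u k p x t → u * k * (p * x) + t * x ≡ (p * (u * k) + t) * x
      e₁ = solve-∀
      e₂ : ∀ q w k x → q * (w * k) * x ≡ q * k * (w * x)
      e₂ = solve-∀
      e₃ : ∀ q k u y v b N → q * k * (u * y + v * (b * N)) ≡ u * k * (q * y) + q * v * (k * b * N)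
      e₃ = solve-∀

  -- The lower line k is y = (wL s - vL) / uL and the upper line k is y = (vU + wU s) / uU.
  record Profile : Set where
    field
      uL vL wL uU vU wU : ℕ → ℕ
      uL>0 : ∀ k → 0 < uL k
      uU>0 : ∀ k → 0 < uU k
      slopeL : ∀ k → 83 ≤ k → uL k * wL (suc k) ≤ uL (suc k) * wL k
      joinL  : ∀ k → 83 ≤ k → uL (suc k) * wL k * suc k + uL k * vL (suc k) ≤ uL (suc k) * vL k + uL k * wL (suc k) * suc k
      slopeU : ∀ k → uU (suc k) * wU k ≤ uU k * wU (suc k)
      joinU  : ∀ k → uU k * vU (suc k) + uU k * wU (suc k) * suc k ≤ uU (suc k) * vU k + uU (suc k) * wU k * suc k
      -- 123 = 83 + 40: before it the abscissa of the subtracted term may fall below 83, where no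
      -- lower bound is available, so nothing can be subtracted.
      flatU  : ∀ k → k < 123 → wU k ≡ 0
      -- The discrete delay equation: beyond `k` the upper polygon has its largest ratio of ordinate
      -- to abscissa at `k`, and the lower slope one unit (40 cells) later has to dominate it.
      delayL : ∀ k → 43 ≤ k → (vU k + wU k * k) * uL (40 + k) ≤ wL (40 + k) * (uU k * k)
      delayU : ∀ k → 83 ≤ k → wU (40 + k) * (uL k * k) + uU (40 + k) * vL k ≤ uU (40 + k) * (wL k * k)
      positiveL : ∀ k → 83 ≤ k → vL k < wL k * k

  module ProfileProperties (ℙ : Profile) where
    open Profile ℙ

    private
      ratio-trans : ∀ {a b c d e f} → 0 < d → c * b ≤ a * d → e * d ≤ c * f → e * b ≤ a * f
      ratio-trans {a} {b} {c} {d} {e} {f} d>0 x y = *-cancelˡ-≤′ d d>0 (begin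
        d * (e * b) ≡⟨ e₁ d e b ⟩
        e * d * b ≤⟨ *-monoˡ-≤ b y ⟩
        c * f * b ≡⟨ e₂ c f b ⟩
        c * b * f ≤⟨ *-monoˡ-≤ f x ⟩
        a * d * f ≡⟨ e₃ a d f ⟩
        d * (a * f) ∎)
        where
        open ≤-Reasoning
        e₁ : ∀ d e b → d * (e * b) ≡ e * d * b
        e₁ = solve-∀
        e₂ : ∀ c f b → c * f * b ≡ c * b * f
        e₂ = solve-∀
        e₃ : ∀ a d f → a * d * f ≡ d * (a * f)
        e₃ = solve-∀

    slopeL-mono′ : ∀ k t → 83 ≤ k → wL (t + k) * uL k ≤ wL k * uL (t + k)
    slopeL-mono′ k zero _ = ≤-refl
    slopeL-mono′ k (suc t) 83≤k = ratio-trans {wL k} {uL k} {wL (t + k)} {uL (t + k)} {wL (suc t + k)} {uL (suc t + k)} (uL>0 (t + k)) (slopeL-mono′ k t 83≤k)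
      (subst₂ _≤_ (*-comm (uL (t + k)) _) (*-comm (uL (suc t + k)) _) (slopeL (t + k) (≤-trans 83≤k (m≤n+m k t))))

    slopeU-mono′ : ∀ k t → wU k * uU (t + k) ≤ wU (t + k) * uU k
    slopeU-mono′ k zero = ≤-refl
    slopeU-mono′ k (suc t) = ratio-trans {wU (suc t + k)} {uU (suc t + k)} {wU (t + k)} {uU (t + k)} {wU k} {uU k} (uU>0 (t + k))
      (subst₂ _≤_ (*-comm (uU (suc t + k)) _) (*-comm (uU (t + k)) _) (slopeU (t + k))) (slopeU-mono′ k t)

    slopeL-mono : ∀ {k m} → 83 ≤ k → k ≤ m → wL m * uL k ≤ wL k * uL m
    slopeL-mono {k} {m} 83≤k k≤m = subst (λ m → wL m * uL k ≤ wL k * uL m) (m∸n+n≡m k≤m) (slopeL-mono′ k (m ∸ k) 83≤k)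

    slopeU-mono : ∀ {k m} → k ≤ m → wU k * uU m ≤ wU m * uU k
    slopeU-mono {k} {m} k≤m = subst (λ m → wU k * uU m ≤ wU m * uU k) (m∸n+n≡m k≤m) (slopeU-mono′ k (m ∸ k))

    rescale : ∀ {p q p′ q′ x y} → 0 < q′ → p′ * q ≤ p * q′ → q′ * y ≤ p′ * x → q * y ≤ p * x
    rescale {p} {q} {p′} {q′} {x} {y} q′>0 mono le = *-cancelˡ-≤′ q′ q′>0 (begin
      q′ * (q * y) ≡⟨ e₁ q′ q y ⟩
      q * (q′ * y) ≤⟨ *-monoʳ-≤ q le ⟩
      q * (p′ * x) ≡⟨ e₂ q p′ x ⟩
      p′ * q * x ≤⟨ *-monoˡ-≤ x mono ⟩
      p * q′ * x ≡⟨ e₃ p q′ x ⟩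
      q′ * (p * x) ∎)
      where
      open ≤-Reasoning
      e₁ : ∀ a b y → a * (b * y) ≡ b * (a * y)
      e₁ = solve-∀
      e₂ : ∀ q p x → q * (p * x) ≡ p * q * x
      e₂ = solve-∀
      e₃ : ∀ p q x → p * q * x ≡ q * (p * x)
      e₃ = solve-∀

    rescale′ : ∀ {p q p′ q′ x y} → 0 < q′ → p * q′ ≤ p′ * q → p′ * x ≤ q′ * y → p * x ≤ q * y
    rescale′ {p} {q} {p′} {q′} {x} {y} q′>0 mono le = *-cancelˡ-≤′ q′ q′>0 (begin
      q′ * (p * x) ≡⟨ e₁ q′ p x ⟩
      p * q′ * x ≤⟨ *-monoˡ-≤ x mono ⟩
      p′ * q * x ≡⟨ e₂ p′ q x ⟩
      q * (p′ * x) ≤⟨ *-monoʳ-≤ q le ⟩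
      q * (q′ * y) ≡⟨ e₃ q q′ y ⟩
      q′ * (q * y) ∎)
      where
      open ≤-Reasoning
      e₁ : ∀ a b y → a * (b * y) ≡ b * a * y
      e₁ = solve-∀
      e₂ : ∀ q p x → q * p * x ≡ p * (q * x)
      e₂ = solve-∀
      e₃ : ∀ p q x → p * (q * x) ≡ q * (p * x)
      e₃ = solve-∀

    LowLine UpLine : ℕ → (a b N y : ℕ) → Set
    LowLine k a b N y = wL k * (a * N) ≤ uL k * y + vL k * (b * N)
    UpLine k a b N y = uU k * y ≤ vU k * (b * N) + wU k * (a * N)

    -- Only the right end of the cell is recorded: a sieving step lowers the abscissa but keeps the
    -- line, and `low-cell` and `up-cell` then find the true cell. Below abscissa 83 nothing is
    -- claimed from below.
    Low Up : (a b N y : ℕ) → Set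
    Low a b N y = a < 83 * b ⊎ ∃ λ k → 83 ≤ k × a < suc k * b × LowLine k a b N y
    Up a b N y = ∃ λ k → a < suc k * b × UpLine k a b N y

    low-cell : ∀ {a b N y} k → 83 * b ≤ a → 83 ≤ k → a < suc k * b → LowLine k a b N y →
      ∃ λ k → 83 ≤ k × k * b ≤ a × a < suc k * b × LowLine k a b N y
    low-cell zero _ () _ _
    low-cell {a} {b} (suc k) big 83≤k a< low with ≤-<-connex (suc k * b) a
    ... | inj₁ le = suc k , 83≤k , le , a< , low
    ... | inj₂ a<kb with m≤n⇒m<n∨m≡n 83≤k
    ...   | inj₁ (s≤s 83≤k′) = low-cell k big 83≤k′ a<kb
              (pass-low (uL (suc k)) (vL (suc k)) (wL (suc k)) (uL k) (vL k) (wL k) (suc k) (uL>0 (suc k)) (<⇒≤ a<kb)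
                (slopeL k 83≤k′) (joinL k 83≤k′) low)
    ...   | inj₂ refl = ⊥-elim (<⇒≱ a<kb big)

    up-cell : ∀ {a b N y} k → a < suc k * b → UpLine k a b N y →
      ∃ λ k → k * b ≤ a × a < suc k * b × UpLine k a b N y
    up-cell zero a< up = zero , z≤n , a< , up
    up-cell {a} {b} (suc k) a< up with ≤-<-connex (suc k * b) a
    ... | inj₁ le = suc k , le , a< , up
    ... | inj₂ a<kb = up-cell k a<kb
            (pass-up (uU (suc k)) (vU (suc k)) (wU (suc k)) (uU k) (vU k) (wU k) (suc k) (uU>0 (suc k)) (<⇒≤ a<kb)
                (slopeU k) (joinU k) up)

    cell-shift : ∀ {a a′ b k k′} → k * b ≤ a → a ≤ a′ + 40 * b → a′ < suc k′ * b → k ≤ 40 + k′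
    cell-shift {a} {a′} {b} {k} {k′} lo shift hi = s≤s⁻¹ (*-cancelʳ-< b k (suc (40 + k′)) (begin-strict
      k * b ≤⟨ lo ⟩
      a ≤⟨ shift ⟩
      a′ + 40 * b <⟨ +-monoˡ-< (40 * b) hi ⟩
      suc k′ * b + 40 * b ≡⟨ e k′ b ⟩
      suc (40 + k′) * b ∎))
      where
      open ≤-Reasoning
      e : ∀ k b → suc k * b + 40 * b ≡ suc (40 + k) * b
      e = solve-∀

    grow : ∀ {a b} z k → a < suc k * b → z * a < suc k * (suc z * b)
    grow {a} {b} z k hi = begin-strict
      z * a ≤⟨ *-monoˡ-≤ a (n≤1+n z) ⟩
      suc z * a <⟨ *-monoʳ-< (suc z) hi ⟩
      suc z * (suc k * b) ≡⟨ e₀ (suc z) (suc k) b ⟩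
      suc k * (suc z * b) ∎
      where
      open ≤-Reasoning
      e₀ : ∀ z k b → z * (k * b) ≡ k * (z * b)
      e₀ = solve-∀

    -- `prop` says that for a fixed sieving range the abscissae of d and d p are proportional to the
    -- logarithms `l` and `l′`.
    delayed : ∀ {a a′ l l′} x N → l * a′ ≡ l′ * a → l * (x * (a′ * N)) ≡ l′ * (x * (a * N))
    delayed {a} {a′} {l} {l′} x N prop = begin
      l * (x * (a′ * N)) ≡⟨ e l x a′ N ⟩
      l * a′ * (x * N) ≡⟨ cong (_* (x * N)) prop ⟩
      l′ * a * (x * N) ≡⟨ e l′ x a N ⟨
      l′ * (x * (a * N)) ∎
      where
      open ≡-Reasoning
      e : ∀ l x a N → l * (x * (a * N)) ≡ l * a * (x * N)
      e = solve-∀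

    -- In the next two lemmas a, y belong to d before sieving by p = suc z, a′, y′ to d p, and y₁ to d after.
    combine-low : ∀ u v w {a a′ b N y y′ y₁ l l′ z} → 0 < l′ → l * a′ ≡ l′ * a →
      l′ * (suc z * y) ≡ l′ * y₁ + l * y′ → w * (a * N) ≤ u * y + v * (b * N) → u * y′ ≤ w * (a′ * N) →
      w * (z * a * N) ≤ u * y₁ + v * (suc z * b * N)
    combine-low u v w {a} {a′} {b} {N} {y} {y′} {y₁} {l} {l′} {z} l′>0 prop buchstab low q =
      *-cancelˡ-≤′ l′ l′>0 (+-cancelʳ-≤ (l′ * (w * (a * N))) _ _ (begin
        l′ * (w * (z * a * N)) + l′ * (w * (a * N)) ≡⟨ e₁ l′ w z a N ⟩
        l′ * (suc z * (w * (a * N))) ≤⟨ *-monoʳ-≤ l′ (*-monoʳ-≤ (suc z) low) ⟩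
        l′ * (suc z * (u * y + v * (b * N))) ≡⟨ e₂ l′ z u y v b N ⟩
        u * (l′ * (suc z * y)) + l′ * (v * (suc z * b * N))
          ≡⟨ cong (λ t → u * t + l′ * (v * (suc z * b * N))) buchstab ⟩
        u * (l′ * y₁ + l * y′) + l′ * (v * (suc z * b * N)) ≡⟨ e₃ u l′ y₁ l y′ (v * (suc z * b * N)) ⟩
        l′ * (u * y₁ + v * (suc z * b * N)) + l * (u * y′)
          ≤⟨ +-monoʳ-≤ (l′ * (u * y₁ + v * (suc z * b * N))) (*-monoʳ-≤ l q) ⟩
        l′ * (u * y₁ + v * (suc z * b * N)) + l * (w * (a′ * N))
          ≡⟨ cong (l′ * (u * y₁ + v * (suc z * b * N)) +_) (delayed {a} {a′} {l} {l′} w N prop) ⟩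
        l′ * (u * y₁ + v * (suc z * b * N)) + l′ * (w * (a * N)) ∎))
      where
      open ≤-Reasoning
      e₁ : ∀ l w z a N → l * (w * (z * a * N)) + l * (w * (a * N)) ≡ l * (suc z * (w * (a * N)))
      e₁ = solve-∀
      e₂ : ∀ l z u y v b N → l * (suc z * (u * y + v * (b * N))) ≡ u * (l * (suc z * y)) + l * (v * (suc z * b * N))
      e₂ = solve-∀
      e₃ : ∀ u l y₁ l₀ y′ t → u * (l * y₁ + l₀ * y′) + l * t ≡ l * (u * y₁ + t) + l₀ * (u * y′)
      e₃ = solve-∀

    combine-up : ∀ u v w {a a′ b N y y′ y₁ l l′ z} → 0 < l′ → l * a′ ≡ l′ * a →
      l′ * (suc z * y) ≡ l′ * y₁ + l * y′ → u * y ≤ v * (b * N) + w * (a * N) → w * (a′ * N) ≤ u * y′ →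
      u * y₁ ≤ v * (suc z * b * N) + w * (z * a * N)
    combine-up u v w {a} {a′} {b} {N} {y} {y′} {y₁} {l} {l′} {z} l′>0 prop buchstab up q =
      *-cancelˡ-≤′ l′ l′>0 (+-cancelʳ-≤ (l′ * (w * (a * N))) _ _ (begin
        l′ * (u * y₁) + l′ * (w * (a * N)) ≡⟨ cong (l′ * (u * y₁) +_) (delayed {a} {a′} {l} {l′} w N prop) ⟨
        l′ * (u * y₁) + l * (w * (a′ * N)) ≤⟨ +-monoʳ-≤ (l′ * (u * y₁)) (*-monoʳ-≤ l q) ⟩
        l′ * (u * y₁) + l * (u * y′) ≡⟨ e₃ u l′ y₁ l y′ ⟩
        u * (l′ * y₁ + l * y′) ≡⟨ cong (u *_) buchstab ⟨
        u * (l′ * (suc z * y)) ≡⟨ e₆ u l′ z y ⟩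
        l′ * (suc z * (u * y)) ≤⟨ *-monoʳ-≤ l′ (*-monoʳ-≤ (suc z) up) ⟩
        l′ * (suc z * (v * (b * N) + w * (a * N))) ≡⟨ e₂ l′ z v b N w a ⟩
        l′ * (v * (suc z * b * N) + w * (z * a * N)) + l′ * (w * (a * N)) ∎))
      where
      open ≤-Reasoning
      e₂ : ∀ l z v b N w a → l * (suc z * (v * (b * N) + w * (a * N))) ≡ l * (v * (suc z * b * N) + w * (z * a * N)) + l * (w * (a * N))
      e₂ = solve-∀
      e₃ : ∀ u l y₁ l₀ y′ → l * (u * y₁) + l₀ * (u * y′) ≡ u * (l * y₁ + l₀ * y′)
      e₃ = solve-∀
      e₆ : ∀ u l z y → u * (l * (suc z * y)) ≡ l * (suc z * (u * y))
      e₆ = solve-∀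

    -- A constant bound survives because sieving does not increase the count, which is what
    -- `y₁ ≤ suc z * y` expresses.
    combine-flat : ∀ u v w {a b N y y₁ z} → w ≡ 0 → y₁ ≤ suc z * y → u * y ≤ v * (b * N) + w * (a * N) →
      u * y₁ ≤ v * (suc z * b * N) + w * (z * a * N)
    combine-flat u v w {a} {b} {N} {y} {y₁} {z} refl y₁≤ up = begin
      u * y₁ ≤⟨ *-monoʳ-≤ u y₁≤ ⟩
      u * (suc z * y) ≡⟨ e₁ u z y ⟩
      suc z * (u * y) ≤⟨ *-monoʳ-≤ (suc z) up ⟩
      suc z * (v * (b * N) + 0) ≡⟨ e₂ z v b N ⟩
      v * (suc z * b * N) + 0 ∎
      where
      open ≤-Reasoning
      e₁ : ∀ u z y → u * (suc z * y) ≡ suc z * (u * y)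
      e₁ = solve-∀
      e₂ : ∀ z v b N → suc z * (v * (b * N) + 0) ≡ v * (suc z * b * N) + 0
      e₂ = solve-∀

    -- The slope in use has to dominate the ratio y′ / a′ of the subtracted term. That term lies in
    -- a cell `k′` with `k ≤ 40 + k′`; `delayL` gives the claim for the slope at `40 + k′`, and the
    -- slope at `k` is no smaller.
    low-ratio : ∀ {a a′ b N y′} k → 83 ≤ k → k * b ≤ a → a ≤ a′ + 40 * b → Up a′ b N y′ → uL k * y′ ≤ wL k * (a′ * N)
    low-ratio {a} {a′} {b} {N} {y′} k 83≤k lo shift (k₁ , a′<₁ , up₁) = conclude (up-cell {a′} {b} {N} {y′} k₁ a′<₁ up₁)
      where
      conclude : (∃ λ k → k * b ≤ a′ × a′ < suc k * b × UpLine k a′ b N y′) → uL k * y′ ≤ wL k * (a′ * N)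
      conclude (k′ , lo′ , hi′ , upk) =
        rescale {wL k} {uL k} {wL (40 + k′)} {uL (40 + k′)} (uL>0 (40 + k′)) (slopeL-mono 83≤k shifted)
              (ratio-up (uU k′) (vU k′) (wU k′) k′ (wL (40 + k′)) (uL (40 + k′)) {b = b}
                (uU>0 k′) (≤-trans (s≤s z≤n) 43≤k′) lo′ (delayL k′ 43≤k′) upk)
        where
        shifted : k ≤ 40 + k′
        shifted = cell-shift {a} {a′} {b} lo shift hi′
        43≤k′ : 43 ≤ k′
        43≤k′ = +-cancelˡ-≤ 40 43 k′ (≤-trans 83≤k shifted)

    up-ratio : ∀ {a a′ b N y′} k → 123 ≤ k → k * b ≤ a → a ≤ a′ + 40 * b → Low a′ b N y′ → wU k * (a′ * N) ≤ uU k * y′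
    up-ratio {a} {a′} {b} {N} {y′} k 123≤k lo shift = go
      where
      big′ : 83 * b ≤ a′
      big′ = +-cancelʳ-≤ (40 * b) _ _ (≤-trans (≤-reflexive (sym (*-distribʳ-+ b 83 40)))
        (≤-trans (*-monoˡ-≤ b 123≤k) (≤-trans lo shift)))
      conclude : (∃ λ k → 83 ≤ k × k * b ≤ a′ × a′ < suc k * b × LowLine k a′ b N y′) → wU k * (a′ * N) ≤ uU k * y′
      conclude (k′ , 83≤k′ , lo′ , hi′ , lowk) =
              rescale′ {wU k} {uU k} {wU (40 + k′)} {uU (40 + k′)} (uU>0 (40 + k′))
                (slopeU-mono (cell-shift {a} {a′} {b} lo shift hi′))
                (ratio-low (uL k′) (vL k′) (wL k′) k′ (wU (40 + k′)) (uU (40 + k′)) {b = b}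
                  (uL>0 k′) (≤-trans (s≤s z≤n) 83≤k′) lo′ (delayU k′ 83≤k′) lowk)
      go : Low a′ b N y′ → wU k * (a′ * N) ≤ uU k * y′
      go (inj₁ small) = ⊥-elim (<⇒≱ small big′)
      go (inj₂ (k₀ , 83≤k₀ , a<₀ , low₀)) = conclude (low-cell {a′} {b} {N} {y′} k₀ big′ 83≤k₀ a<₀ low₀)

    low-step : ∀ {a a′ b N y y′ y₁ l l′ z} → 0 < l′ → l * a′ ≡ l′ * a → a ≤ a′ + 40 * b →
      l′ * (suc z * y) ≡ l′ * y₁ + l * y′ →
      83 * b ≤ a → Low a b N y → Up a′ b N y′ → Low (z * a) (suc z * b) N y₁
    low-step {a} {a′} {b} {N} {y} {y′} {y₁} {l} {l′} {z} l′>0 prop shift buchstab big (inj₁ small) up =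
      ⊥-elim (<⇒≱ small big)
    low-step {a} {a′} {b} {N} {y} {y′} {y₁} {l} {l′} {z} l′>0 prop shift buchstab big (inj₂ (k₀ , 83≤k₀ , a<₀ , low₀)) up =
      conclude (low-cell {a} {b} {N} {y} k₀ big 83≤k₀ a<₀ low₀)
      where
      conclude : (∃ λ k → 83 ≤ k × k * b ≤ a × a < suc k * b × LowLine k a b N y) → Low (z * a) (suc z * b) N y₁
      conclude (k , 83≤k , lo , hi , low) = inj₂ (k , 83≤k , grow {a} {b} z k hi ,
        combine-low (uL k) (vL k) (wL k) {a} {a′} {b} {N} {y} {y′} {y₁} {l} {l′} {z} l′>0 prop buchstab low
          (low-ratio {a} {a′} {b} {N} {y′} k 83≤k lo shift up))

    up-step : ∀ {a a′ b N y y′ y₁ l l′ z} → 0 < l′ → l * a′ ≡ l′ * a → a ≤ a′ + 40 * b →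
      l′ * (suc z * y) ≡ l′ * y₁ + l * y′ →
      ∀ k → 123 ≤ k → k * b ≤ a → a < suc k * b → UpLine k a b N y → Low a′ b N y′ → Up (z * a) (suc z * b) N y₁
    up-step {a} {a′} {b} {N} {y} {y′} {y₁} {l} {l′} {z} l′>0 prop shift buchstab k 123≤k lo hi up low =
      k , grow {a} {b} z k hi ,
      combine-up (uU k) (vU k) (wU k) {a} {a′} {b} {N} {y} {y′} {y₁} {l} {l′} {z} l′>0 prop buchstab up
        (up-ratio {a} {a′} {b} {N} {y′} k 123≤k lo shift low)

    up-flat : ∀ {a b N y y₁ z} k → k < 123 → a < suc k * b → y₁ ≤ suc z * y → UpLine k a b N y → Up (z * a) (suc z * b) N y₁
    up-flat {a} {b} {N} {y} {y₁} {z} k k<123 hi y₁≤ up = k , grow {a} {b} z k hi ,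
      combine-flat (uU k) (vU k) (wU k) {a} {b} {N} {y} {y₁} {z} (flatU k k<123) y₁≤ up

    low-positive : ∀ {a b N y} → 0 < b → 0 < N → 83 * b ≤ a → Low a b N y → 0 < y
    low-positive _ _ big (inj₁ small) = ⊥-elim (<⇒≱ small big)
    low-positive {a} {b} {N} {zero} b>0 N>0 big (inj₂ (k₀ , 83≤k₀ , a<₀ , low₀)) with low-cell k₀ big 83≤k₀ a<₀ low₀
    ... | k , 83≤k , lo , hi , low = ⊥-elim (<⇒≱ strictly low)
      where
      open ≤-Reasoning
      bN>0 : 0 < b * N
      bN>0 = *-mono-≤ b>0 N>0
      strictly : uL k * 0 + vL k * (b * N) < wL k * (a * N)
      strictly = begin-strict
        uL k * 0 + vL k * (b * N) ≡⟨ cong (_+ vL k * (b * N)) (*-zeroʳ (uL k)) ⟩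
        vL k * (b * N) <⟨ *-monoˡ-< (b * N) {{>-nonZero bN>0}} (positiveL k 83≤k) ⟩
        wL k * k * (b * N) ≡⟨ e (wL k) k b N ⟩
        wL k * (k * b * N) ≤⟨ *-monoʳ-≤ (wL k) (*-monoˡ-≤ N lo) ⟩
        wL k * (a * N) ∎
        where
        e : ∀ w k b N → w * k * (b * N) ≡ w * (k * b * N)
        e = solve-∀
    low-positive {y = suc y} _ _ _ _ = s≤s z≤n

-- The explicit polygons: a table up to cell 270 and a rational tail.

module ProfileTable where

  open import Data.List using (List; []; _∷_)
  open import Data.Unit using (tt)
  open SieveProfile

  unT : ∀ {b} → b ≡ true → T b
  unT refl = tt

  ∧-split : ∀ {a b} → (a ∧ b) ≡ true → a ≡ true × b ≡ true
  ∧-split {true} {true} _ = refl , refl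

  ≤ᵇ-sound : ∀ m n → (m ≤ᵇ n) ≡ true → m ≤ n
  ≤ᵇ-sound m n eq = ≤ᵇ⇒≤ m n (unT eq)

  allBelow : (ℕ → Bool) → ℕ → Bool
  allBelow f zero = true
  allBelow f (suc n) = f n ∧ allBelow f n

  allBelow-sound : ∀ f n → allBelow f n ≡ true → ∀ k → k < n → f k ≡ true
  allBelow-sound f (suc n) eq k (s≤s k≤n) with m≤n⇒m<n∨m≡n k≤n
  ... | inj₁ k<n = allBelow-sound f n (proj₂ (∧-split {f n} eq)) k k<n
  ... | inj₂ refl = proj₁ (∧-split {f n} eq)

  nth : ℕ → List ℕ → ℕ
  nth _ [] = 0
  nth zero (x ∷ _) = x
  nth (suc n) (_ ∷ xs) = nth n xs

  module Checker (uL vL wL uU vU wU : ℕ → ℕ) where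

    private
      c₁ c₂ c₃ c₄ c₅ c₆ c₇ c₈ c₉ c₀ : ℕ → Bool
      c₁ k = 1 ≤ᵇ uL k
      c₂ k = 1 ≤ᵇ uU k
      c₃ k = uL k * wL (suc k) ≤ᵇ uL (suc k) * wL k
      c₄ k = uL (suc k) * wL k * suc k + uL k * vL (suc k) ≤ᵇ uL (suc k) * vL k + uL k * wL (suc k) * suc k
      c₅ k = wU (40 + k) * (uL k * k) + uU (40 + k) * vL k ≤ᵇ uU (40 + k) * (wL k * k)
      c₆ k = suc (vL k) ≤ᵇ wL k * k
      c₇ k = uU (suc k) * wU k ≤ᵇ uU k * wU (suc k)
      c₈ k = uU k * vU (suc k) + uU k * wU (suc k) * suc k ≤ᵇ uU (suc k) * vU k + uU (suc k) * wU k * suc k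
      c₉ k = (vU k + wU k * k) * uL (40 + k) ≤ᵇ wL (40 + k) * (uU k * k)
      c₀ k = c₃ k ∧ (c₄ k ∧ (c₅ k ∧ c₆ k))

    check : ℕ → Bool
    check k = c₁ k ∧ (c₂ k ∧ (c₇ k ∧ (c₈ k ∧ (((k <ᵇ 43) ∨ c₉ k) ∧ ((k <ᵇ 83) ∨ c₀ k)))))

    module Sound (n : ℕ) (checked : allBelow check n ≡ true) (k : ℕ) (k<n : k < n) where
      private
        guard : ∀ n {b} → n ≤ k → ((k <ᵇ n) ∨ b) ≡ true → b ≡ true
        guard n {b} n≤k eq with k <ᵇ n in lt
        ... | false = eq
        ... | true = ⊥-elim (<⇒≱ (<ᵇ⇒< k n (unT lt)) n≤k)

        s₀ = ∧-split {c₁ k} (allBelow-sound check n checked k k<n)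
        s₁ = ∧-split {c₂ k} (proj₂ s₀)
        s₂ = ∧-split {c₇ k} (proj₂ s₁)
        s₃ = ∧-split {c₈ k} (proj₂ s₂)
        s₄ = ∧-split {(k <ᵇ 43) ∨ c₉ k} (proj₂ s₃)

        s₅ : 83 ≤ k → c₃ k ≡ true × (c₄ k ∧ (c₅ k ∧ c₆ k)) ≡ true
        s₅ h = ∧-split {c₃ k} (guard 83 h (proj₂ s₄))
        s₆ : 83 ≤ k → c₄ k ≡ true × (c₅ k ∧ c₆ k) ≡ true
        s₆ h = ∧-split {c₄ k} (proj₂ (s₅ h))
        s₇ : 83 ≤ k → c₅ k ≡ true × c₆ k ≡ true
        s₇ h = ∧-split {c₅ k} (proj₂ (s₆ h))

      uL>0 : 0 < uL k
      uL>0 = ≤ᵇ-sound 1 _ (proj₁ s₀)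
      uU>0 : 0 < uU k
      uU>0 = ≤ᵇ-sound 1 _ (proj₁ s₁)
      slopeL : 83 ≤ k → uL k * wL (suc k) ≤ uL (suc k) * wL k
      slopeL h = ≤ᵇ-sound _ _ (proj₁ (s₅ h))
      joinL : 83 ≤ k → uL (suc k) * wL k * suc k + uL k * vL (suc k) ≤ uL (suc k) * vL k + uL k * wL (suc k) * suc k
      joinL h = ≤ᵇ-sound _ _ (proj₁ (s₆ h))
      delayU : 83 ≤ k → wU (40 + k) * (uL k * k) + uU (40 + k) * vL k ≤ uU (40 + k) * (wL k * k)
      delayU h = ≤ᵇ-sound _ _ (proj₁ (s₇ h))
      positiveL : 83 ≤ k → vL k < wL k * k
      positiveL h = ≤ᵇ-sound _ _ (proj₂ (s₇ h))
      slopeU : uU (suc k) * wU k ≤ uU k * wU (suc k)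
      slopeU = ≤ᵇ-sound _ _ (proj₁ s₂)
      joinU : uU k * vU (suc k) + uU k * wU (suc k) * suc k ≤ uU (suc k) * vU k + uU (suc k) * wU k * suc k
      joinU = ≤ᵇ-sound _ _ (proj₁ s₃)
      delayL : 43 ≤ k → (vU k + wU k * k) * uL (40 + k) ≤ wL (40 + k) * (uU k * k)
      delayL h = ≤ᵇ-sound _ _ (guard 43 h (proj₁ s₄))

  -- Slopes, in units of 10⁻⁶, of the lower polygon on the cells [k, k + 1], k ≥ 83, of length 1/40: the smallest
  -- allowed by the delay inequality with the upper polygon one unit (40 cells) to the left.
  lowerSlopes : List ℕ
  lowerSlopes =
      3458280 ∷ 3379682 ∷ 3304578 ∷ 3232740 ∷ 3163958 ∷ 3098042 ∷ 3034817 ∷ 2974120 ∷ 2915804 ∷ 2859731 ∷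
      2805774 ∷ 2753815 ∷ 2703746 ∷ 2655465 ∷ 2608878 ∷ 2563897 ∷ 2520441 ∷ 2478434 ∷ 2437804 ∷ 2398484 ∷
      2360413 ∷ 2323532 ∷ 2287785 ∷ 2253122 ∷ 2219493 ∷ 2186853 ∷ 2155160 ∷ 2124372 ∷ 2094451 ∷ 2065362 ∷
      2037069 ∷ 2009541 ∷ 1982747 ∷ 1956658 ∷ 1931247 ∷ 1906488 ∷ 1882355 ∷ 1858825 ∷ 1835877 ∷ 1813488 ∷
      1791639 ∷ 1770310 ∷ 1749483 ∷ 1729140 ∷ 1709265 ∷ 1689841 ∷ 1670854 ∷ 1652289 ∷ 1634132 ∷ 1616370 ∷
      1598990 ∷ 1581979 ∷ 1565327 ∷ 1549021 ∷ 1533052 ∷ 1517409 ∷ 1502081 ∷ 1487060 ∷ 1472337 ∷ 1457902 ∷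
      1443748 ∷ 1429866 ∷ 1416248 ∷ 1402887 ∷ 1389776 ∷ 1376908 ∷ 1364276 ∷ 1351873 ∷ 1339694 ∷ 1327733 ∷
      1315983 ∷ 1304439 ∷ 1293096 ∷ 1281949 ∷ 1270992 ∷ 1260221 ∷ 1249631 ∷ 1239217 ∷ 1228976 ∷ 1218902 ∷
      1208992 ∷ 1199242 ∷ 1189978 ∷ 1181172 ∷ 1172800 ∷ 1164839 ∷ 1157266 ∷ 1150061 ∷ 1143205 ∷ 1136679 ∷
      1130467 ∷ 1124552 ∷ 1118919 ∷ 1113554 ∷ 1108444 ∷ 1103575 ∷ 1098935 ∷ 1094514 ∷ 1090300 ∷ 1086283 ∷
      1082454 ∷ 1078803 ∷ 1075323 ∷ 1072004 ∷ 1068839 ∷ 1065821 ∷ 1062943 ∷ 1060198 ∷ 1057580 ∷ 1055083 ∷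
      1052701 ∷ 1050429 ∷ 1048262 ∷ 1046195 ∷ 1044223 ∷ 1042342 ∷ 1040548 ∷ 1038837 ∷ 1037205 ∷ 1035648 ∷
      1034163 ∷ 1032746 ∷ 1031396 ∷ 1030108 ∷ 1028879 ∷ 1027708 ∷ 1026591 ∷ 1025526 ∷ 1024510 ∷ 1023542 ∷
      1022619 ∷ 1021739 ∷ 1020900 ∷ 1020101 ∷ 1019339 ∷ 1018613 ∷ 1017921 ∷ 1017262 ∷ 1016633 ∷ 1016035 ∷
      1015464 ∷ 1014921 ∷ 1014403 ∷ 1013910 ∷ 1013440 ∷ 1012992 ∷ 1012566 ∷ 1012159 ∷ 1011772 ∷ 1011404 ∷
      1011052 ∷ 1010718 ∷ 1010399 ∷ 1010095 ∷ 1009805 ∷ 1009528 ∷ 1009265 ∷ 1009014 ∷ 1008774 ∷ 1008545 ∷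
      1008327 ∷ 1008118 ∷ 1007918 ∷ 1007728 ∷ 1007545 ∷ 1007371 ∷ 1007204 ∷ 1007044 ∷ 1006890 ∷ 1006743 ∷
      1006602 ∷ 1006466 ∷ 1006336 ∷ 1006211 ∷ 1006090 ∷ 1005975 ∷ 1005863 ∷ 1005756 ∷ 1005652 ∷ 1005553 ∷
      1005456 ∷ 1005364 ∷ 1005274 ∷ 1005187 ∷ 1005104 ∷ 1005023 ∷ 1004944 ∷ []

  -- The largest slopes allowed on the cells k ≥ 123; before, the upper polygon is constant.
  upperSlopes : List ℕ
  upperSlopes =
      0 ∷ 41170 ∷ 80446 ∷ 117936 ∷ 153738 ∷ 187945 ∷ 220643 ∷ 251912 ∷ 281826 ∷ 310456 ∷ 337868 ∷ 364122 ∷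
      389277 ∷ 413386 ∷ 436500 ∷ 458667 ∷ 479932 ∷ 500337 ∷ 519922 ∷ 538725 ∷ 556781 ∷ 574124 ∷ 590785 ∷
      606794 ∷ 622180 ∷ 636970 ∷ 651189 ∷ 664862 ∷ 678011 ∷ 690657 ∷ 702823 ∷ 714527 ∷ 725788 ∷ 736624 ∷
      747051 ∷ 757087 ∷ 766746 ∷ 776042 ∷ 784991 ∷ 793605 ∷ 801896 ∷ 809878 ∷ 817562 ∷ 824958 ∷ 832077 ∷
      838930 ∷ 845527 ∷ 851875 ∷ 857985 ∷ 863865 ∷ 869523 ∷ 874967 ∷ 880204 ∷ 885242 ∷ 890087 ∷ 894746 ∷
      899226 ∷ 903532 ∷ 907670 ∷ 911647 ∷ 915467 ∷ 919135 ∷ 922658 ∷ 926038 ∷ 929282 ∷ 932394 ∷ 935377 ∷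
      938236 ∷ 940976 ∷ 943599 ∷ 946109 ∷ 948511 ∷ 950808 ∷ 953002 ∷ 955097 ∷ 957096 ∷ 959003 ∷ 960819 ∷
      962548 ∷ 964193 ∷ 965755 ∷ 967239 ∷ 968645 ∷ 969978 ∷ 971243 ∷ 972442 ∷ 973581 ∷ 974661 ∷ 975687 ∷
      976661 ∷ 977586 ∷ 978465 ∷ 979299 ∷ 980093 ∷ 980847 ∷ 981564 ∷ 982245 ∷ 982893 ∷ 983510 ∷ 984097 ∷
      984655 ∷ 985187 ∷ 985693 ∷ 986175 ∷ 986634 ∷ 987071 ∷ 987488 ∷ 987885 ∷ 988263 ∷ 988624 ∷ 988969 ∷
      989297 ∷ 989611 ∷ 989910 ∷ 990196 ∷ 990468 ∷ 990729 ∷ 990978 ∷ 991216 ∷ 991444 ∷ 991662 ∷ 991870 ∷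
      992069 ∷ 992260 ∷ 992443 ∷ 992618 ∷ 992786 ∷ 992947 ∷ 993102 ∷ 993250 ∷ 993392 ∷ 993529 ∷ 993660 ∷
      993786 ∷ 993907 ∷ 994024 ∷ 994136 ∷ 994244 ∷ 994348 ∷ 994449 ∷ 994546 ∷ 994639 ∷ 994729 ∷ 994816 ∷
      994900 ∷ 994982 ∷ 995060 ∷ []

  -- The intercepts are chosen so that consecutive lines meet at the vertex `suc k`; those of
  -- `upperIntercepts` at `k`.
  lowerIntercepts : ℕ → ℕ → List ℕ → List ℕ
  lowerIntercepts k v [] = []
  lowerIntercepts k v (w ∷ []) = v ∷ []
  lowerIntercepts k v (w ∷ w′ ∷ ws) = v ∷ lowerIntercepts (suc k) (v ∸ (w ∸ w′) * suc k) (w′ ∷ ws)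

  upperIntercepts : ℕ → ℕ → ℕ → List ℕ → List ℕ
  upperIntercepts k v w [] = []
  upperIntercepts k v w (w′ ∷ ws) = (v ∸ (w′ ∸ w) * k) ∷ upperIntercepts (suc k) (v ∸ (w′ ∸ w) * k) w′ ws

  -- The common denominator of a tail line: for ε(k) = E / ((k - 1) k) the difference ε(k) - ε(k +
  -- 1) is 2 E / ((k - 1) k (k + 1)), the deviation of the slope from 1.
  tailScale : ℕ → ℕ
  tailScale k = (k ∸ 1) * k * suc k

  opaque
    -- Large enough for the start of the sieve (`tailDeficit-large`), small enough for the table to
    -- stay within the tail at the vertex 270, as `joinL` and `joinU` demand.
    tailDeficit : ℕ
    tailDeficit = 48260

  opaque
    lowerV lowerW upperV upperW : ℕ → ℕ
    -- 287037239 = 83 · 3458280 - 1, so the polygon is barely positive at its left end.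
    lowerV k = nth (k ∸ 83) (lowerIntercepts 83 287037239 lowerSlopes)
    lowerW k = nth (k ∸ 83) lowerSlopes
    -- 148.706 / 40 ≈ 3.72 lies a little above 2 exp(γ) ≈ 3.56, the constant value of s F(s) for s ≤
    -- 3 in the classical linear sieve. The first lower slope is 148.706 / 43, rounded up.
    upperV k = if k <ᵇ 123 then 148706000 else nth (k ∸ 123) (upperIntercepts 123 148706000 0 upperSlopes)
    upperW k = if k <ᵇ 123 then 0 else nth (k ∸ 123) upperSlopes

  -- Beyond k = 270 the vertices are (k, k ∓ ε) with ε = 48260 / ((k − 1) k).
  opaque
    uL vL wL uU vU wU : ℕ → ℕ
    uL k = if k <ᵇ 270 then 1000000 else tailScale k
    vL k = if k <ᵇ 270 then lowerV k else tailDeficit * (3 * k + 1)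
    wL k = if k <ᵇ 270 then lowerW k else tailScale k + 2 * tailDeficit
    uU k = if k <ᵇ 270 then 1000000 else tailScale k
    vU k = if k <ᵇ 270 then upperV k else tailDeficit * (3 * k + 1)
    wU k = if k <ᵇ 270 then upperW k else tailScale k ∸ 2 * tailDeficit

  open Checker uL vL wL uU vU wU

  opaque
    unfolding uL tailDeficit lowerV

    table-checked : allBelow check 270 ≡ true
    table-checked = refl

    flat-checked : allBelow (λ k → wU k ≡ᵇ 0) 123 ≡ true
    flat-checked = refl

  <ᵇ-false : ∀ {k n} → n ≤ k → (k <ᵇ n) ≡ false
  <ᵇ-false {k} {n} n≤k with k <ᵇ n in lt
  ... | false = refl
  ... | true = ⊥-elim (<⇒≱ (<ᵇ⇒< k n (unT lt)) n≤k)

  <ᵇ-true : ∀ {k n} → k < n → (k <ᵇ n) ≡ true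
  <ᵇ-true {k} {n} k<n with k <ᵇ n | <⇒<ᵇ k<n
  ... | true | _ = refl

  if-false : ∀ {b} {x y : ℕ} → b ≡ false → (if b then x else y) ≡ y
  if-false refl = refl

  if-true : ∀ {b} {x y : ℕ} → b ≡ true → (if b then x else y) ≡ x
  if-true refl = refl

  opaque
    unfolding uL
    uL-tail : ∀ {k} → 270 ≤ k → uL k ≡ tailScale k
    uL-tail 270≤k = if-false (<ᵇ-false 270≤k)
    vL-tail : ∀ {k} → 270 ≤ k → vL k ≡ tailDeficit * (3 * k + 1)
    vL-tail 270≤k = if-false (<ᵇ-false 270≤k)
    wL-tail : ∀ {k} → 270 ≤ k → wL k ≡ tailScale k + 2 * tailDeficit
    wL-tail 270≤k = if-false (<ᵇ-false 270≤k)
    uU-tail : ∀ {k} → 270 ≤ k → uU k ≡ tailScale k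
    uU-tail 270≤k = if-false (<ᵇ-false 270≤k)
    vU-tail : ∀ {k} → 270 ≤ k → vU k ≡ tailDeficit * (3 * k + 1)
    vU-tail 270≤k = if-false (<ᵇ-false 270≤k)
    wU-tail : ∀ {k} → 270 ≤ k → wU k ≡ tailScale k ∸ 2 * tailDeficit
    wU-tail 270≤k = if-false (<ᵇ-false 270≤k)

  module TailIdentities (E : ℕ) where
    scale : ℕ → ℕ
    scale h = h * suc h * suc (suc h)

    open ≤-Reasoning

    scale≤scale : ∀ h → scale h ≤ scale (suc h)
    scale≤scale h = *-mono-≤ (*-mono-≤ (n≤1+n h) (n≤1+n (suc h))) (n≤1+n (suc (suc h)))

    slopeL : ∀ h → scale h * (scale (suc h) + 2 * E) ≤ scale (suc h) * (scale h + 2 * E)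
    slopeL h = begin
      scale h * (scale (suc h) + 2 * E) ≡⟨ e (scale h) (scale (suc h)) (2 * E) ⟩
      scale (suc h) * scale h + scale h * (2 * E) ≤⟨ +-monoʳ-≤ (scale (suc h) * scale h) (*-monoˡ-≤ (2 * E) (scale≤scale h)) ⟩
      scale (suc h) * scale h + scale (suc h) * (2 * E) ≡⟨ *-distribˡ-+ (scale (suc h)) (scale h) (2 * E) ⟨
      scale (suc h) * (scale h + 2 * E) ∎
      where
      e : ∀ c c′ E → c * (c′ + E) ≡ c′ * c + c * E
      e = solve-∀

    slopeU : ∀ h → scale (suc h) * (scale h ∸ 2 * E) ≤ scale h * (scale (suc h) ∸ 2 * E)
    slopeU h = begin
      scale (suc h) * (scale h ∸ 2 * E) ≡⟨ *-distribˡ-∸ (scale (suc h)) (scale h) (2 * E) ⟩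
      scale (suc h) * scale h ∸ scale (suc h) * (2 * E)
        ≤⟨ ∸-mono (≤-reflexive (*-comm (scale (suc h)) (scale h))) (*-monoˡ-≤ (2 * E) (scale≤scale h)) ⟩
      scale h * scale (suc h) ∸ scale h * (2 * E) ≡⟨ *-distribˡ-∸ (scale h) (scale (suc h)) (2 * E) ⟨
      scale h * (scale (suc h) ∸ 2 * E) ∎

    -- Consecutive lines meet at the vertex k + 1 = h + 2.
    meet : ∀ h → scale h * (E * (3 * (2 + h) + 1)) + 2 * E * scale (suc h) * (2 + h)
               ≡ scale (suc h) * (E * (3 * (1 + h) + 1)) + 2 * E * scale h * (2 + h)
    meet h = e h E
      where
      e : ∀ h E → h * (1 + h) * (2 + h) * (E * (3 * (2 + h) + 1)) + 2 * E * ((1 + h) * (2 + h) * (3 + h)) * (2 + h)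
        ≡ (1 + h) * (2 + h) * (3 + h) * (E * (3 * (1 + h) + 1)) + 2 * E * (h * (1 + h) * (2 + h)) * (2 + h)
      e = solve-∀

    joinL : ∀ h → scale (suc h) * (scale h + 2 * E) * (2 + h) + scale h * (E * (3 * (2 + h) + 1))
                ≤ scale (suc h) * (E * (3 * (1 + h) + 1)) + scale h * (scale (suc h) + 2 * E) * (2 + h)
    joinL h = ≤-reflexive (begin-equality
      scale (suc h) * (scale h + 2 * E) * (2 + h) + scale h * (E * (3 * (2 + h) + 1))
        ≡⟨ e₁ (scale h) (scale (suc h)) E (2 + h) (scale h * (E * (3 * (2 + h) + 1))) ⟩
      scale (suc h) * scale h * (2 + h) + (scale h * (E * (3 * (2 + h) + 1)) + 2 * E * scale (suc h) * (2 + h))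
        ≡⟨ cong (scale (suc h) * scale h * (2 + h) +_) (meet h) ⟩
      scale (suc h) * scale h * (2 + h) + (scale (suc h) * (E * (3 * (1 + h) + 1)) + 2 * E * scale h * (2 + h))
        ≡⟨ e₂ (scale h) (scale (suc h)) E (2 + h) (scale (suc h) * (E * (3 * (1 + h) + 1))) ⟩
      scale (suc h) * (E * (3 * (1 + h) + 1)) + scale h * (scale (suc h) + 2 * E) * (2 + h) ∎)
      where
      e₁ : ∀ c c′ E k x → c′ * (c + 2 * E) * k + x ≡ c′ * c * k + (x + 2 * E * c′ * k)
      e₁ = solve-∀
      e₂ : ∀ c c′ E k x → c′ * c * k + (x + 2 * E * c * k) ≡ x + c * (c′ + 2 * E) * k
      e₂ = solve-∀

    joinU : ∀ h → 2 * E ≤ scale h → scale h * (E * (3 * (2 + h) + 1)) + scale h * (scale (suc h) ∸ 2 * E) * (2 + h)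
                ≤ scale (suc h) * (E * (3 * (1 + h) + 1)) + scale (suc h) * (scale h ∸ 2 * E) * (2 + h)
    joinU h le = +-cancelʳ-≤ (2 * E * scale h * k + 2 * E * scale (suc h) * k) _ _ (≤-reflexive (begin-equality
      x + scale h * w′ * k + (2 * E * scale h * k + 2 * E * scale (suc h) * k)
        ≡⟨ e₁ (scale h) (scale (suc h)) w′ (2 * E) k x ⟩
      x + 2 * E * scale (suc h) * k + scale h * (w′ + 2 * E) * k
        ≡⟨ cong₂ (λ s t → s + scale h * t * k) (meet h) (m∸n+n≡m (≤-trans le (scale≤scale h))) ⟩
      x′ + 2 * E * scale h * k + scale h * scale (suc h) * k ≡⟨ cong (x′ + 2 * E * scale h * k +_) (cong (_* k) (*-comm (scale h) _)) ⟩
      x′ + 2 * E * scale h * k + scale (suc h) * scale h * k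
        ≡⟨ cong (λ t → x′ + 2 * E * scale h * k + scale (suc h) * t * k) (m∸n+n≡m le) ⟨
      x′ + 2 * E * scale h * k + scale (suc h) * (w + 2 * E) * k ≡⟨ e₂ (scale h) (scale (suc h)) w (2 * E) k x′ ⟩
      x′ + scale (suc h) * w * k + (2 * E * scale h * k + 2 * E * scale (suc h) * k) ∎))
      where
      k = 2 + h
      x = scale h * (E * (3 * (2 + h) + 1))
      x′ = scale (suc h) * (E * (3 * (1 + h) + 1))
      w = scale h ∸ 2 * E
      w′ = scale (suc h) ∸ 2 * E
      e₁ : ∀ c c′ w E k x → x + c * w * k + (E * c * k + E * c′ * k) ≡ x + E * c′ * k + c * (w + E) * k
      e₁ = solve-∀
      e₂ : ∀ c c′ w E k x → x + E * c * k + c′ * (w + E) * k ≡ x + c′ * w * k + (E * c * k + E * c′ * k)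
      e₂ = solve-∀

    -- With C the scale one unit further on, both delay inequalities amount to (k + 1) C ≤ 2 c k.
    delayL : ∀ k c C → 2 * E ≤ c → suc k * C ≤ 2 * c * k →
      (E * (3 * k + 1) + (c ∸ 2 * E) * k) * C ≤ (C + 2 * E) * (c * k)
    delayL k c C le h = begin
      (E * (3 * k + 1) + (c ∸ 2 * E) * k) * C ≡⟨ e₁ E k (c ∸ 2 * E) C ⟩
      E * (suc k * C) + ((c ∸ 2 * E) + 2 * E) * k * C ≡⟨ cong (λ t → E * (suc k * C) + t * k * C) (m∸n+n≡m le) ⟩
      E * (suc k * C) + c * k * C ≤⟨ +-monoˡ-≤ (c * k * C) (*-monoʳ-≤ E h) ⟩
      E * (2 * c * k) + c * k * C ≡⟨ e₂ E c k C ⟩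
      (C + 2 * E) * (c * k) ∎
      where
      e₁ : ∀ E k w C → (E * (3 * k + 1) + w * k) * C ≡ E * (suc k * C) + (w + 2 * E) * k * C
      e₁ = solve-∀
      e₂ : ∀ E c k C → E * (2 * c * k) + c * k * C ≡ (C + 2 * E) * (c * k)
      e₂ = solve-∀

    delayU : ∀ k c C → 2 * E ≤ C → suc k * C ≤ 2 * c * k →
      (C ∸ 2 * E) * (c * k) + C * (E * (3 * k + 1)) ≤ C * ((c + 2 * E) * k)
    delayU k c C le h = +-cancelʳ-≤ (2 * E * (c * k)) _ _ (begin
      (C ∸ 2 * E) * (c * k) + C * (E * (3 * k + 1)) + 2 * E * (c * k) ≡⟨ e₁ (C ∸ 2 * E) c k C E ⟩
      ((C ∸ 2 * E) + 2 * E) * (c * k) + 2 * E * C * k + E * (suc k * C)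
        ≡⟨ cong (λ t → t * (c * k) + 2 * E * C * k + E * (suc k * C)) (m∸n+n≡m le) ⟩
      C * (c * k) + 2 * E * C * k + E * (suc k * C) ≤⟨ +-monoʳ-≤ (C * (c * k) + 2 * E * C * k) (*-monoʳ-≤ E h) ⟩
      C * (c * k) + 2 * E * C * k + E * (2 * c * k) ≡⟨ e₂ C c k E ⟩
      C * ((c + 2 * E) * k) + 2 * E * (c * k) ∎)
      where
      e₁ : ∀ w c k C E → w * (c * k) + C * (E * (3 * k + 1)) + 2 * E * (c * k) ≡ (w + 2 * E) * (c * k) + 2 * E * C * k + E * (suc k * C)
      e₁ = solve-∀
      e₂ : ∀ C c k E → C * (c * k) + 2 * E * C * k + E * (2 * c * k) ≡ C * ((c + 2 * E) * k) + 2 * E * (c * k)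
      e₂ = solve-∀

    -- Each of the three factors on the left is at most 7/6 times its counterpart once h ≥ 269, and
    -- (7/6)³ < 2.
    doubled : ∀ h → 269 ≤ h → suc (suc h) * scale (40 + h) ≤ 2 * scale h * suc h
    doubled h 269≤h = begin
      (2 + h) * ((40 + h) * (41 + h) * (42 + h)) ≤⟨ *-monoʳ-≤ (2 + h) (product) ⟩
      (2 + h) * (2 * (h * (1 + h) * (1 + h))) ≡⟨ e h ⟩
      2 * (h * (1 + h) * (2 + h)) * (1 + h) ∎
      where
      e : ∀ h → (2 + h) * (2 * (h * (1 + h) * (1 + h))) ≡ 2 * (h * (1 + h) * (2 + h)) * (1 + h)
      e = solve-∀
      269≤⇒ : ∀ n → {T (n ≤ᵇ 269)} → n ≤ h
      269≤⇒ n {le} = ≤-trans (≤ᵇ⇒≤ n 269 le) 269≤h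
      six : ∀ s t m → 6 * s ≡ 7 * t + m → m ≤ h → 6 * (s + h) ≤ 7 * (t + h)
      six s t m eq le = begin
        6 * (s + h) ≡⟨ trans (*-distribˡ-+ 6 s h) (cong (_+ 6 * h) eq) ⟩
        7 * t + m + 6 * h ≤⟨ +-monoˡ-≤ (6 * h) (+-monoʳ-≤ (7 * t) le) ⟩
        7 * t + h + 6 * h ≡⟨ e₇ t h ⟩
        7 * (t + h) ∎
        where
        e₇ : ∀ t h → 7 * t + h + 6 * h ≡ 7 * (t + h)
        e₇ = solve-∀
      product : (40 + h) * (41 + h) * (42 + h) ≤ 2 * (h * (1 + h) * (1 + h))
      product = cube (40 + h) (41 + h) (42 + h) h (1 + h) (1 + h)
        (six 40 0 240 refl (269≤⇒ 240)) (six 41 1 239 refl (269≤⇒ 239)) (six 42 1 245 refl (269≤⇒ 245))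
        where
        cube : ∀ x y z a b c → 6 * x ≤ 7 * a → 6 * y ≤ 7 * b → 6 * z ≤ 7 * c → x * y * z ≤ 2 * (a * b * c)
        cube x y z a b c p q r = *-cancelˡ-≤ 216 (begin
          216 * (x * y * z) ≡⟨ e₆ x y z ⟩
          6 * x * (6 * y) * (6 * z) ≤⟨ *-mono-≤ (*-mono-≤ p q) r ⟩
          7 * a * (7 * b) * (7 * c) ≡⟨ e₇ a b c ⟩
          343 * (a * b * c) ≤⟨ *-monoˡ-≤ (a * b * c) (≤ᵇ-sound 343 432 refl) ⟩
          432 * (a * b * c) ≡⟨ *-assoc 216 2 (a * b * c) ⟩
          216 * (2 * (a * b * c)) ∎)
          where
          e₆ : ∀ x y z → 216 * (x * y * z) ≡ 6 * x * (6 * y) * (6 * z)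
          e₆ = solve-∀
          e₇ : ∀ a b c → 7 * a * (7 * b) * (7 * c) ≡ 343 * (a * b * c)
          e₇ = solve-∀

  opaque
    unfolding tailDeficit
    large-tail : ∀ {k} → 270 ≤ k → 2 * tailDeficit ≤ tailScale k
    large-tail {k} h = ≤-trans (≤ᵇ-sound (2 * tailDeficit) (269 * 270 * 271) refl)
      (*-mono-≤ (*-mono-≤ (∸-monoˡ-≤ 1 h) h) (s≤s h))

    0<tailDeficit : 0 < tailDeficit
    0<tailDeficit = ≤ᵇ-sound 1 tailDeficit refl

  module TailProfile {k : ℕ} (270≤k : 270 ≤ k) where
    private
      270≤1+k = m≤n⇒m≤1+n 270≤k
      270≤40+k : 270 ≤ 40 + k
      270≤40+k = ≤-trans 270≤k (m≤n+m k 40)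
      open TailIdentities tailDeficit

      pred-form : ∀ (P : ℕ → Set) → (∀ h → P (suc h)) → P k
      pred-form P f = subst P (m+[n∸m]≡n {1} (≤-trans (s≤s z≤n) 270≤k)) (f (k ∸ 1))

      doubled′ : suc k * tailScale (40 + k) ≤ 2 * tailScale k * k
      doubled′ = pred-form (λ k → 270 ≤ k → suc k * tailScale (40 + k) ≤ 2 * tailScale k * k) (λ h le → doubled h (s≤s⁻¹ le)) 270≤k

    slopeL-tail : uL k * wL (suc k) ≤ uL (suc k) * wL k
    slopeL-tail rewrite uL-tail 270≤k | wL-tail 270≤1+k | uL-tail 270≤1+k | wL-tail 270≤k =
      pred-form (λ k → tailScale k * (tailScale (suc k) + 2 * tailDeficit) ≤ tailScale (suc k) * (tailScale k + 2 * tailDeficit)) slopeL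

    joinL-tail : uL (suc k) * wL k * suc k + uL k * vL (suc k) ≤ uL (suc k) * vL k + uL k * wL (suc k) * suc k
    joinL-tail rewrite uL-tail 270≤k | wL-tail 270≤1+k | uL-tail 270≤1+k | wL-tail 270≤k | vL-tail 270≤k | vL-tail 270≤1+k =
      pred-form (λ k → tailScale (suc k) * (tailScale k + 2 * tailDeficit) * suc k + tailScale k * (tailDeficit * (3 * suc k + 1))
        ≤ tailScale (suc k) * (tailDeficit * (3 * k + 1)) + tailScale k * (tailScale (suc k) + 2 * tailDeficit) * suc k) joinL

    slopeU-tail : uU (suc k) * wU k ≤ uU k * wU (suc k)
    slopeU-tail rewrite uU-tail 270≤k | wU-tail 270≤1+k | uU-tail 270≤1+k | wU-tail 270≤k =
      pred-form (λ k → tailScale (suc k) * (tailScale k ∸ 2 * tailDeficit) ≤ tailScale k * (tailScale (suc k) ∸ 2 * tailDeficit)) slopeU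

    joinU-tail : uU k * vU (suc k) + uU k * wU (suc k) * suc k ≤ uU (suc k) * vU k + uU (suc k) * wU k * suc k
    joinU-tail rewrite uU-tail 270≤k | wU-tail 270≤1+k | uU-tail 270≤1+k | wU-tail 270≤k | vU-tail 270≤k | vU-tail 270≤1+k =
      pred-form (λ k → 2 * tailDeficit ≤ tailScale k →
        tailScale k * (tailDeficit * (3 * suc k + 1)) + tailScale k * (tailScale (suc k) ∸ 2 * tailDeficit) * suc k
        ≤ tailScale (suc k) * (tailDeficit * (3 * k + 1)) + tailScale (suc k) * (tailScale k ∸ 2 * tailDeficit) * suc k) joinU
        (large-tail 270≤k)

    delayL-tail : (vU k + wU k * k) * uL (40 + k) ≤ wL (40 + k) * (uU k * k)
    delayL-tail rewrite vU-tail 270≤k | wU-tail 270≤k | uL-tail 270≤40+k | wL-tail 270≤40+k | uU-tail 270≤k =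
      delayL k (tailScale k) (tailScale (40 + k)) (large-tail 270≤k) doubled′

    delayU-tail : wU (40 + k) * (uL k * k) + uU (40 + k) * vL k ≤ uU (40 + k) * (wL k * k)
    delayU-tail rewrite wU-tail 270≤40+k | uU-tail 270≤40+k | uL-tail 270≤k | vL-tail 270≤k | wL-tail 270≤k =
      delayU k (tailScale k) (tailScale (40 + k)) (large-tail 270≤40+k) doubled′

    positiveL-tail : vL k < wL k * k
    positiveL-tail rewrite vL-tail 270≤k | wL-tail 270≤k = begin-strict
      tailDeficit * (3 * k + 1) <⟨ *-monoʳ-< tailDeficit {{>-nonZero 0<tailDeficit}} (+-monoʳ-< (3 * k) (≤-trans (s≤s (s≤s z≤n)) 270≤k)) ⟩
      tailDeficit * (3 * k + k) ≡⟨ e tailDeficit k ⟩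
      (2 * tailDeficit + 2 * tailDeficit) * k ≤⟨ *-monoˡ-≤ k (+-monoˡ-≤ (2 * tailDeficit) (large-tail 270≤k)) ⟩
      (tailScale k + 2 * tailDeficit) * k ∎
      where
      open ≤-Reasoning
      e : ∀ E k → E * (3 * k + k) ≡ (2 * E + 2 * E) * k
      e = solve-∀

    u>0-tail : 0 < tailScale k
    u>0-tail = ≤-trans (*-mono-≤ (s≤s (z≤n {1})) 0<tailDeficit) (large-tail 270≤k)

  flat : ∀ k → k < 123 → wU k ≡ 0
  flat k k<123 = ≡ᵇ⇒≡ (wU k) 0 (unT (allBelow-sound (λ k → wU k ≡ᵇ 0) 123 flat-checked k k<123))

  module _ where
    private
      module S = Sound 270 table-checked
      open TailProfile

      either : (P : ℕ → Set) → (∀ k → k < 270 → P k) → (∀ k → 270 ≤ k → P k) → ∀ k → P k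
      either P f g k with <-≤-connex k 270
      ... | inj₁ lt = f k lt
      ... | inj₂ ge = g k ge

    profile : Profile
    profile .Profile.uL = uL
    profile .Profile.vL = vL
    profile .Profile.wL = wL
    profile .Profile.uU = uU
    profile .Profile.vU = vU
    profile .Profile.wU = wU
    profile .Profile.uL>0 = either (λ k → 0 < uL k) S.uL>0 (λ k h → subst (0 <_) (sym (uL-tail h)) (u>0-tail h))
    profile .Profile.uU>0 = either (λ k → 0 < uU k) S.uU>0 (λ k h → subst (0 <_) (sym (uU-tail h)) (u>0-tail h))
    profile .Profile.slopeL = either (λ k → 83 ≤ k → uL k * wL (suc k) ≤ uL (suc k) * wL k) S.slopeL (λ k h _ → slopeL-tail h)
    profile .Profile.joinL = either (λ k → 83 ≤ k → uL (suc k) * wL k * suc k + uL k * vL (suc k) ≤ uL (suc k) * vL k + uL k * wL (suc k) * suc k) S.joinL (λ k h _ → joinL-tail h)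
    profile .Profile.slopeU = either (λ k → uU (suc k) * wU k ≤ uU k * wU (suc k)) S.slopeU (λ k h → slopeU-tail h)
    profile .Profile.joinU = either (λ k → uU k * vU (suc k) + uU k * wU (suc k) * suc k ≤ uU (suc k) * vU k + uU (suc k) * wU k * suc k) S.joinU (λ k h → joinU-tail h)
    profile .Profile.flatU = flat
    profile .Profile.delayL = either (λ k → 43 ≤ k → (vU k + wU k * k) * uL (40 + k) ≤ wL (40 + k) * (uU k * k)) S.delayL (λ k h _ → delayL-tail h)
    profile .Profile.delayU = either (λ k → 83 ≤ k → wU (40 + k) * (uL k * k) + uU (40 + k) * vL k ≤ uU (40 + k) * (wL k * k)) S.delayU (λ k h _ → delayU-tail h)
    profile .Profile.positiveL = either (λ k → 83 ≤ k → vL k < wL k * k) S.positiveL (λ k h _ → positiveL-tail h)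

-- Integer substitutes for logarithms: 32nd powers.

module Pow32 where

  *-^ : ∀ x y n → (x * y) ^ n ≡ x ^ n * y ^ n
  *-^ x y zero = refl
  *-^ x y (suc n) = trans (cong (x * y *_) (*-^ x y n)) (e x y (x ^ n) (y ^ n))
    where
    e : ∀ x y p q → x * y * (p * q) ≡ x * p * (y * q)
    e = solve-∀

  -- Logarithms are measured in units of 1/32 of a binary digit: l stands for 32 log₂ x when 2 ^ l = x ^ 32.
  opaque
    pow32 : ℕ → ℕ
    pow32 x = x ^ 32

    pow32-mono : ∀ {x y} → x ≤ y → pow32 x ≤ pow32 y
    pow32-mono = ^-monoˡ-≤ 32

    pow32-mono-< : ∀ {x y} → x < y → pow32 x < pow32 y
    pow32-mono-< = ^-monoˡ-< 32

    pow32-* : ∀ x y → pow32 (x * y) ≡ pow32 x * pow32 y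
    pow32-* x y = *-^ x y 32

    pow32-1 : pow32 1 ≡ 1
    pow32-1 = refl

    pow32-2^ : ∀ j → pow32 (2 ^ j) ≡ 2 ^ (j * 32)
    pow32-2^ j = ^-*-assoc 2 j 32

    pow32-^ : ∀ x → pow32 x ≡ x ^ 32
    pow32-^ _ = refl

    pow32-pow : ∀ x n → pow32 (x ^ n) ≡ pow32 x ^ n
    pow32-pow x n = trans (^-*-assoc x n 32) (trans (cong (x ^_) (*-comm n 32)) (sym (^-*-assoc x 32 n)))

    pow32>0 : ∀ {x} → 0 < x → 0 < pow32 x
    pow32>0 {x} 0<x = pow32-mono {1} 0<x

  pow32-cancel : ∀ {x y} → pow32 x ≤ pow32 y → x ≤ y
  pow32-cancel {x} {y} le with ≤-<-connex x y
  ... | inj₁ x≤y = x≤y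
  ... | inj₂ y<x = ⊥-elim (<⇒≱ (pow32-mono-< y<x) le)

-- Start of the sieve: the polygons against the counts after 2 and 3.

module SieveStart where

  open SieveProfile
  open ProfileTable
  open Pow32
  open ProfileProperties profile

  module _ where
    open ≤-Reasoning

    -- Both sides are affine in l and the claim is trivial at l = 0, so of a whole range of
    -- logarithms only the largest has to be checked.
    linear-mono : ∀ {l L A B C} → l ≤ L → L * A ≤ L * B + C → l * A ≤ l * B + C
    linear-mono {l} {L} {A} {B} {C} l≤L h with ≤-total A B
    ... | inj₁ A≤B = ≤-trans (*-monoʳ-≤ l A≤B) (m≤m+n _ _)
    ... | inj₂ B≤A with split-≤ B≤A
    ...   | δ , refl = begin
        l * (B + δ) ≡⟨ *-distribˡ-+ l B δ ⟩
        l * B + l * δ ≤⟨ +-monoʳ-≤ (l * B) (≤-trans (*-monoˡ-≤ δ l≤L) Lδ≤C) ⟩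
        l * B + C ∎
        where
        Lδ≤C : L * δ ≤ C
        Lδ≤C = +-cancelˡ-≤ (L * B) _ _ (≤-trans (≤-reflexive (sym (*-distribˡ-+ L B δ))) h)

    -- After 2 and 3 the products Π p and Π (p - 1) are 6 and 2, whence a = 80 l and b = 162. The
    -- hypothesis `q * d ≤ N` turns the counting error 12 d into 12 N / q.
    base-low : ∀ u v w {l L N d q S} → 0 < q → q * d ≤ N → N ≤ 3 * (S * d) + 12 * d → l ≤ L →
      L * (80 * w * q + 960 * u) ≤ L * (80 * u * q) + 162 * v * q →
      w * (80 * l * N) ≤ u * (240 * (S * d) * l) + v * (162 * N)
    base-low u v w {l} {L} {N} {d} {q} {S} q>0 qd≤N count l≤L h =
      *-cancelˡ-≤′ q q>0 (+-cancelʳ-≤ (960 * (l * u) * N) _ _ (begin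
        q * (w * (80 * l * N)) + 960 * (l * u) * N ≡⟨ e₁ q w l N u ⟩
        l * (80 * w * q + 960 * u) * N ≤⟨ *-monoˡ-≤ N (linear-mono l≤L h) ⟩
        (l * (80 * u * q) + 162 * v * q) * N ≡⟨ e₂ l u q v N ⟩
        80 * l * u * q * N + 162 * v * q * N ≤⟨ +-monoˡ-≤ (162 * v * q * N) (*-monoʳ-≤ (80 * l * u * q) count) ⟩
        80 * l * u * q * (3 * (S * d) + 12 * d) + 162 * v * q * N ≡⟨ e₃ l u q (S * d) d v N ⟩
        q * (u * (240 * (S * d) * l) + v * (162 * N)) + 960 * (l * u) * (q * d) ≤⟨ +-monoʳ-≤ (q * (u * (240 * (S * d) * l) + v * (162 * N))) (*-monoʳ-≤ (960 * (l * u)) qd≤N) ⟩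
        q * (u * (240 * (S * d) * l) + v * (162 * N)) + 960 * (l * u) * N ∎))
      where
      e₁ : ∀ q w l N u → q * (w * (80 * l * N)) + 960 * (l * u) * N ≡ l * (80 * w * q + 960 * u) * N
      e₁ = solve-∀
      e₂ : ∀ l u q v N → (l * (80 * u * q) + 162 * v * q) * N ≡ 80 * l * u * q * N + 162 * v * q * N
      e₂ = solve-∀
      e₃ : ∀ l u q x d v N → 80 * l * u * q * (3 * x + 12 * d) + 162 * v * q * N ≡ q * (u * (240 * x * l) + v * (162 * N)) + 960 * (l * u) * (q * d)
      e₃ = solve-∀

    -- The parameters `α`, `β` serve two counts: 80, 960 after sieving by 2 and 3, and 120, 480
    -- after sieving by 2 only.
    base-up : ∀ u v w α β {l L N d q S} → 0 < q → q * d ≤ N → 240 * (S * d) ≤ α * N + β * d → l ≤ L →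
      L * (α * u * q + β * u) ≤ L * (80 * w * q) + 162 * v * q →
      u * (240 * (S * d) * l) ≤ v * (162 * N) + w * (80 * l * N)
    base-up u v w α β {l} {L} {N} {d} {q} {S} q>0 qd≤N count l≤L h =
      *-cancelˡ-≤′ q q>0 (begin
        q * (u * (240 * (S * d) * l)) ≡⟨ e₁ q u (240 * (S * d)) l ⟩
        q * u * l * (240 * (S * d)) ≤⟨ *-monoʳ-≤ (q * u * l) count ⟩
        q * u * l * (α * N + β * d) ≡⟨ e₂ q u l α N β d ⟩
        α * u * l * q * N + β * u * l * (q * d) ≤⟨ +-monoʳ-≤ (α * u * l * q * N) (*-monoʳ-≤ (β * u * l) qd≤N) ⟩
        α * u * l * q * N + β * u * l * N ≡⟨ e₃ α u l q N β ⟩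
        l * (α * u * q + β * u) * N ≤⟨ *-monoˡ-≤ N (linear-mono l≤L h) ⟩
        (l * (80 * w * q) + 162 * v * q) * N ≡⟨ e₄ l w q v N ⟩
        q * (v * (162 * N) + w * (80 * l * N)) ∎)
      where
      e₁ : ∀ q u x l → q * (u * (x * l)) ≡ q * u * l * x
      e₁ = solve-∀
      e₂ : ∀ q u l α N β d → q * u * l * (α * N + β * d) ≡ α * u * l * q * N + β * u * l * (q * d)
      e₂ = solve-∀
      e₃ : ∀ α u l q N β → α * u * l * q * N + β * u * l * N ≡ l * (α * u * q + β * u) * N
      e₃ = solve-∀
      e₄ : ∀ l w q v N → (l * (80 * w * q) + 162 * v * q) * N ≡ q * (v * (162 * N) + w * (80 * l * N))
      e₄ = solve-∀

    cube≤2^ : ∀ i → (17 + i) * (17 + i) * (17 + i) ≤ 2 ^ (16 + i)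
    cube≤2^ zero = ≤ᵇ-sound (17 * 17 * 17) (2 ^ 16) refl
    cube≤2^ (suc i) = begin
      (17 + suc i) * (17 + suc i) * (17 + suc i) ≡⟨ cong (λ x → x * x * x) (+-suc 17 i) ⟩
      (5 + (13 + i)) * (5 + (13 + i)) * (5 + (13 + i)) ≤⟨ double (13 + i) ⟩
      2 * ((4 + (13 + i)) * (4 + (13 + i)) * (4 + (13 + i))) ≤⟨ *-monoʳ-≤ 2 (cube≤2^ i) ⟩
      2 * 2 ^ (16 + i) ≡⟨ cong (2 ^_) (sym (+-suc 16 i)) ⟩
      2 ^ (16 + suc i) ∎
      where
      double : ∀ i → (5 + i) * (5 + i) * (5 + i) ≤ 2 * ((4 + i) * (4 + i) * (4 + i))
      double i = cubed (5 + i) (4 + i) (begin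
        4 * (5 + i) ≡⟨ *-distribˡ-+ 4 5 i ⟩
        5 * 4 + 4 * i ≤⟨ +-monoʳ-≤ (5 * 4) (*-monoˡ-≤ i (n≤1+n 4)) ⟩
        5 * 4 + 5 * i ≡⟨ *-distribˡ-+ 5 4 i ⟨
        5 * (4 + i) ∎)
        where
        cubed : ∀ x y → 4 * x ≤ 5 * y → x * x * x ≤ 2 * (y * y * y)
        cubed x y h = *-cancelˡ-≤ 64 (begin
          64 * (x * x * x) ≡⟨ e₁ x ⟩
          4 * x * (4 * x) * (4 * x) ≤⟨ *-mono-≤ (*-mono-≤ h h) h ⟩
          5 * y * (5 * y) * (5 * y) ≡⟨ e₂ y ⟩
          125 * (y * y * y) ≤⟨ *-monoˡ-≤ (y * y * y) (≤ᵇ-sound 125 128 refl) ⟩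
          128 * (y * y * y) ≡⟨ *-assoc 64 2 (y * y * y) ⟩
          64 * (2 * (y * y * y)) ∎)
          where
          e₁ : ∀ x → 64 * (x * x * x) ≡ 4 * x * (4 * x) * (4 * x)
          e₁ = solve-∀
          e₂ : ∀ y → 5 * y * (5 * y) * (5 * y) ≡ 125 * (y * y * y)
          e₂ = solve-∀

    -- The inequality that both polygons need at the start of the sieve, for k + 1 = 16 n and q = 2 ^ (n − 1).
    base-tail : ∀ E n k q → 1920 * 4096 ≤ 165 * E → suc k ≡ 16 * n → 158 ≤ k → n * n * n ≤ q →
      32 * n * (160 * E * q + 960 * tailScale k) ≤ 162 * (E * (3 * k + 1)) * q
    base-tail E n k@(suc h) q hE k+1 158≤k n³≤q = +-cancelʳ-≤ (158 * E * q) _ _ (begin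
      32 * n * (160 * E * q + 960 * (h * k * suc k)) + 158 * E * q
        ≡⟨ cong (λ x → x * (160 * E * q + 960 * (h * k * suc k)) + 158 * E * q) (trans (*-assoc 2 16 n) (cong (2 *_) (sym k+1))) ⟩
      2 * suc k * (160 * E * q + 960 * (h * k * suc k)) + 158 * E * q ≡⟨ e₁ k h E q ⟩
      (320 * suc k + 158) * (E * q) + k * (1920 * (h * suc k * suc k))
        ≤⟨ +-monoʳ-≤ ((320 * suc k + 158) * (E * q)) (*-monoʳ-≤ k (begin
          1920 * (h * suc k * suc k) ≤⟨ *-monoʳ-≤ 1920 (*-monoˡ-≤ (suc k) (*-monoˡ-≤ (suc k) (≤-trans (n≤1+n h) (n≤1+n k)))) ⟩
          1920 * (suc k * suc k * suc k) ≡⟨ cong (λ x → 1920 * (x * x * x)) k+1 ⟩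
          1920 * (16 * n * (16 * n) * (16 * n)) ≡⟨ cong (1920 *_) (e₂ n) ⟩
          1920 * (4096 * (n * n * n)) ≡⟨ *-assoc 1920 4096 (n * n * n) ⟨
          1920 * 4096 * (n * n * n) ≤⟨ *-mono-≤ hE n³≤q ⟩
          165 * E * q ∎)) ⟩
      (320 * suc k + 158) * (E * q) + k * (165 * E * q) ≡⟨ e₃ k E q ⟩
      (478 + 485 * k) * (E * q) ≤⟨ *-monoˡ-≤ (E * q) {478 + 485 * k} {486 * k + 320} (begin
          478 + 485 * k ≡⟨ e₅ k ⟩
          158 + 485 * k + 320 ≤⟨ +-monoˡ-≤ 320 (+-monoˡ-≤ (485 * k) 158≤k) ⟩
          486 * k + 320 ∎) ⟩
      (486 * k + 320) * (E * q) ≡⟨ e₄ k E q ⟩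
      162 * (E * (3 * k + 1)) * q + 158 * E * q ∎)
      where
      e₁ : ∀ k h E q → 2 * suc k * (160 * E * q + 960 * (h * k * suc k)) + 158 * E * q
         ≡ (320 * suc k + 158) * (E * q) + k * (1920 * (h * suc k * suc k))
      e₁ = solve-∀
      e₂ : ∀ n → 16 * n * (16 * n) * (16 * n) ≡ 4096 * (n * n * n)
      e₂ = solve-∀
      e₃ : ∀ k E q → (320 * suc k + 158) * (E * q) + k * (165 * E * q) ≡ (478 + 485 * k) * (E * q)
      e₃ = solve-∀
      e₄ : ∀ k E q → (486 * k + 320) * (E * q) ≡ 162 * (E * (3 * k + 1)) * q + 158 * E * q
      e₄ = solve-∀
      e₅ : ∀ k → 478 + 485 * k ≡ 158 + 485 * k + 320
      e₅ = solve-∀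

    tail-low : ∀ E L c q v → L * (160 * E * q + 960 * c) ≤ 162 * v * q →
      L * (80 * (c + 2 * E) * q + 960 * c) ≤ L * (80 * c * q) + 162 * v * q
    tail-low E L c q v h = begin
      L * (80 * (c + 2 * E) * q + 960 * c) ≡⟨ e E L c q ⟩
      L * (80 * c * q) + L * (160 * E * q + 960 * c) ≤⟨ +-monoʳ-≤ (L * (80 * c * q)) h ⟩
      L * (80 * c * q) + 162 * v * q ∎
      where
      e : ∀ E L c q → L * (80 * (c + 2 * E) * q + 960 * c) ≡ L * (80 * c * q) + L * (160 * E * q + 960 * c)
      e = solve-∀

    tail-up : ∀ E L c q v → 2 * E ≤ c → L * (160 * E * q + 960 * c) ≤ 162 * v * q →
      L * (80 * c * q + 960 * c) ≤ L * (80 * (c ∸ 2 * E) * q) + 162 * v * q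
    tail-up E L c q v le h = begin
      L * (80 * c * q + 960 * c) ≡⟨ cong (λ t → L * (80 * t * q + 960 * c)) (m∸n+n≡m le) ⟨
      L * (80 * ((c ∸ 2 * E) + 2 * E) * q + 960 * c) ≡⟨ e E L c q (c ∸ 2 * E) ⟩
      L * (80 * (c ∸ 2 * E) * q) + L * (160 * E * q + 960 * c) ≤⟨ +-monoʳ-≤ (L * (80 * (c ∸ 2 * E) * q)) h ⟩
      L * (80 * (c ∸ 2 * E) * q) + 162 * v * q ∎
      where
      e : ∀ E L c q w → L * (80 * (w + 2 * E) * q + 960 * c) ≡ L * (80 * w * q) + L * (160 * E * q + 960 * c)
      e = solve-∀

  lowerLeft lowerRight upperLeft upperSmall upperRight : ℕ → ℕ → ℕ
  lowerLeft j k = 32 * suc j * (80 * wL k * 2 ^ j + 960 * uL k)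
  lowerRight j k = 32 * suc j * (80 * uL k * 2 ^ j) + 162 * vL k * 2 ^ j
  upperLeft j k = 32 * suc j * (80 * uU k * 2 ^ j + 960 * uU k)
  upperSmall j k = 32 * suc j * (120 * uU k * 2 ^ j + 480 * uU k)
  upperRight j k = 32 * suc j * (80 * wU k * 2 ^ j) + 162 * vU k * 2 ^ j

  -- For 32 j ≤ l < 32 (j + 1) the abscissa 80 l / 162 is below 2560 (j + 1) / 162 < 16 (j + 1), the
  -- right end of this cell.
  cell-of : ℕ → ℕ
  cell-of j = 15 + j * 16

  -- Cells with `j < 5` end at abscissa 80 < 83, where no lower bound is claimed. For `j < 4` the
  -- ratio N / d is only known to exceed a small 2 ^ j, and the count after 2 alone, with its
  -- smaller error, is used.
  lowerCheck upperCheck : ℕ → Bool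
  lowerCheck j = (j <ᵇ 5) ∨ (lowerLeft j (cell-of j) ≤ᵇ lowerRight j (cell-of j))
  upperCheck j = (if j <ᵇ 4 then upperSmall j (cell-of j) else upperLeft j (cell-of j)) ≤ᵇ upperRight j (cell-of j)

  opaque
    unfolding uL tailDeficit lowerV

    tailDeficit-large : 1920 * 4096 ≤ 165 * tailDeficit
    tailDeficit-large = ≤ᵇ-sound (1920 * 4096) (165 * tailDeficit) refl

    base-checkedL : allBelow lowerCheck 16 ≡ true
    base-checkedL = refl

    base-checkedU : allBelow upperCheck 16 ≡ true
    base-checkedU = refl

  base-lower : ∀ j → 5 ≤ j → let k = 15 + j * 16; q = 2 ^ j; L = 32 * suc j in
    L * (80 * wL k * q + 960 * uL k) ≤ L * (80 * uL k * q) + 162 * vL k * q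
  base-lower j 5≤j with <-≤-connex j 16
  ... | inj₁ lt = ≤ᵇ-sound (lowerLeft j (cell-of j)) (lowerRight j (cell-of j))
        (trans (cong (_∨ (lowerLeft j (cell-of j) ≤ᵇ lowerRight j (cell-of j))) (sym (<ᵇ-false 5≤j))) (allBelow-sound lowerCheck 16 base-checkedL j lt))
  ... | inj₂ 16≤j = subst₂ _≤_
          (cong₂ (λ w u → 32 * suc j * (80 * w * 2 ^ j + 960 * u)) (sym (wL-tail {15 + j * 16} big)) (sym (uL-tail {15 + j * 16} big)))
          (cong₂ (λ u v → 32 * suc j * (80 * u * 2 ^ j) + 162 * v * 2 ^ j) (sym (uL-tail {15 + j * 16} big)) (sym (vL-tail {15 + j * 16} big)))
          (tail-low tailDeficit (32 * suc j) (tailScale (15 + j * 16)) (2 ^ j) (tailDeficit * (3 * (15 + j * 16) + 1)) main)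
    where
    big : 270 ≤ 15 + j * 16
    big = ≤-trans (≤ᵇ-sound 270 (15 + 16 * 16) refl) (+-monoʳ-≤ 15 (*-monoˡ-≤ 16 16≤j))
    main : _
    main = base-tail tailDeficit (suc j) (15 + j * 16) (2 ^ j) tailDeficit-large (*-comm (suc j) 16) (≤-trans (≤ᵇ-sound 158 270 refl) big)
             (subst (λ j → suc j * suc j * suc j ≤ 2 ^ j) (m+[n∸m]≡n 16≤j) (cube≤2^ (j ∸ 16)))

  base-upper : ∀ j → 4 ≤ j → let k = 15 + j * 16; q = 2 ^ j; L = 32 * suc j in
    L * (80 * uU k * q + 960 * uU k) ≤ L * (80 * wU k * q) + 162 * vU k * q
  base-upper j 4≤j with <-≤-connex j 16
  ... | inj₁ lt = ≤ᵇ-sound (upperLeft j (cell-of j)) (upperRight j (cell-of j))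
        (subst (λ x → (x ≤ᵇ upperRight j (cell-of j)) ≡ true) (if-false {j <ᵇ 4} {upperSmall j (cell-of j)} (<ᵇ-false 4≤j)) (allBelow-sound upperCheck 16 base-checkedU j lt))
  ... | inj₂ 16≤j = subst₂ _≤_
          (cong₂ (λ w u → 32 * suc j * (80 * w * 2 ^ j + 960 * u)) (sym (uU-tail {15 + j * 16} big)) (sym (uU-tail {15 + j * 16} big)))
          (cong₂ (λ u v → 32 * suc j * (80 * u * 2 ^ j) + 162 * v * 2 ^ j) (sym (wU-tail {15 + j * 16} big)) (sym (vU-tail {15 + j * 16} big)))
          (tail-up tailDeficit (32 * suc j) (tailScale (15 + j * 16)) (2 ^ j) (tailDeficit * (3 * (15 + j * 16) + 1)) (large-tail big) main)
    where
    big : 270 ≤ 15 + j * 16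
    big = ≤-trans (≤ᵇ-sound 270 (15 + 16 * 16) refl) (+-monoʳ-≤ 15 (*-monoˡ-≤ 16 16≤j))
    main : _
    main = base-tail tailDeficit (suc j) (15 + j * 16) (2 ^ j) tailDeficit-large (*-comm (suc j) 16) (≤-trans (≤ᵇ-sound 158 270 refl) big)
             (subst (λ j → suc j * suc j * suc j ≤ 2 ^ j) (m+[n∸m]≡n 16≤j) (cube≤2^ (j ∸ 16)))

  base-upper-small : ∀ j → j < 4 → let k = 15 + j * 16; q = 2 ^ j; L = 32 * suc j in
    L * (120 * uU k * q + 480 * uU k) ≤ L * (80 * wU k * q) + 162 * vU k * q
  base-upper-small j j<4 = ≤ᵇ-sound (upperSmall j (cell-of j)) (upperRight j (cell-of j))
        (subst (λ x → (x ≤ᵇ upperRight j (cell-of j)) ≡ true) (if-true {j <ᵇ 4} {y = upperLeft j (cell-of j)} (<ᵇ-true j<4)) (allBelow-sound upperCheck 16 base-checkedU j (≤-trans j<4 (≤ᵇ-sound 4 16 refl))))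

-- The linear sieve by induction on the sieving range.

module LinearSieve where

  open SieveProfile
  open ProfileTable
  open Pow32
  open SieveStart
  open ProfileProperties profile

  -- Intended reading: `S d z` is the number of multiples d y in an interval of length N such that y
  -- has no prime factor up to z.
  record Sifted (N : ℕ) : Set where
    field
      S : ℕ → ℕ → ℕ
      N>0 : 0 < N
      sift-prime : ∀ d z → 0 < d → Prime (suc z) → S d z ≡ S d (suc z) + S (d * suc z) z
      sift-other : ∀ d z → ¬ Prime (suc z) → S d (suc z) ≡ S d z
      upper₁ : ∀ d → 0 < d → S d 1 * d ≤ N + d
      lower₁ : ∀ d → 0 < d → N ≤ S d 1 * d + d

  module _ {N : ℕ} (sifted : Sifted N) where
    open Sifted sifted
    open ≤-Reasoning

    private
      split₂ : ∀ d → 0 < d → S d 1 ≡ S d 2 + S (d * 2) 1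
      split₂ d 0<d = sift-prime d 1 0<d (from-yes (prime? 2))

      split₃ : ∀ d → 0 < d → S d 2 ≡ S d 3 + S (d * 3) 2
      split₃ d 0<d = sift-prime d 2 0<d (from-yes (prime? 3))

    upper₂ : ∀ d → 0 < d → 2 * (S d 2 * d) ≤ N + 4 * d
    upper₂ d 0<d = +-cancelʳ-≤ N _ _ (begin
      2 * (S d 2 * d) + N ≤⟨ +-monoʳ-≤ (2 * (S d 2 * d)) (lower₁ (d * 2) (*-mono-≤ 0<d (s≤s (z≤n {1})))) ⟩
      2 * (S d 2 * d) + (S (d * 2) 1 * (d * 2) + d * 2) ≡⟨ e₁ (S d 2) (S (d * 2) 1) d ⟩
      2 * ((S d 2 + S (d * 2) 1) * d) + d * 2 ≡⟨ cong (λ x → 2 * (x * d) + d * 2) (split₂ d 0<d) ⟨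
      2 * (S d 1 * d) + d * 2 ≤⟨ +-monoˡ-≤ (d * 2) (*-monoʳ-≤ 2 (upper₁ d 0<d)) ⟩
      2 * (N + d) + d * 2 ≡⟨ e₂ N d ⟩
      N + 4 * d + N ∎)
      where
      e₁ : ∀ x y d → 2 * (x * d) + (y * (d * 2) + d * 2) ≡ 2 * ((x + y) * d) + d * 2
      e₁ = solve-∀
      e₂ : ∀ N d → 2 * (N + d) + d * 2 ≡ N + 4 * d + N
      e₂ = solve-∀

    lower₂ : ∀ d → 0 < d → N ≤ 2 * (S d 2 * d) + 4 * d
    lower₂ d 0<d = +-cancelʳ-≤ N _ _ (begin
      N + N ≤⟨ +-mono-≤ (lower₁ d 0<d) (lower₁ d 0<d) ⟩
      S d 1 * d + d + (S d 1 * d + d) ≡⟨ cong (λ x → x * d + d + (x * d + d)) (split₂ d 0<d) ⟩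
      (S d 2 + S (d * 2) 1) * d + d + ((S d 2 + S (d * 2) 1) * d + d) ≡⟨ e₁ (S d 2) (S (d * 2) 1) d ⟩
      2 * (S d 2 * d) + 2 * d + S (d * 2) 1 * (d * 2) ≤⟨ +-monoʳ-≤ (2 * (S d 2 * d) + 2 * d) (upper₁ (d * 2) (*-mono-≤ 0<d (s≤s (z≤n {1})))) ⟩
      2 * (S d 2 * d) + 2 * d + (N + d * 2) ≡⟨ e₂ (2 * (S d 2 * d)) N d ⟩
      2 * (S d 2 * d) + 4 * d + N ∎)
      where
      e₁ : ∀ x y d → (x + y) * d + d + ((x + y) * d + d) ≡ 2 * (x * d) + 2 * d + y * (d * 2)
      e₁ = solve-∀
      e₂ : ∀ x N d → x + 2 * d + (N + d * 2) ≡ x + 4 * d + N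
      e₂ = solve-∀

    upper₃ : ∀ d → 0 < d → 3 * (S d 3 * d) ≤ N + 12 * d
    upper₃ d 0<d = *-cancelˡ-≤ 2 (+-cancelʳ-≤ N _ _ (begin
      2 * (3 * (S d 3 * d)) + N ≤⟨ +-monoʳ-≤ (2 * (3 * (S d 3 * d))) (lower₂ (d * 3) (*-mono-≤ 0<d (s≤s (z≤n {2})))) ⟩
      2 * (3 * (S d 3 * d)) + (2 * (S (d * 3) 2 * (d * 3)) + 4 * (d * 3)) ≡⟨ e₁ (S d 3) (S (d * 3) 2) d ⟩
      3 * (2 * ((S d 3 + S (d * 3) 2) * d)) + 12 * d ≡⟨ cong (λ x → 3 * (2 * (x * d)) + 12 * d) (split₃ d 0<d) ⟨
      3 * (2 * (S d 2 * d)) + 12 * d ≤⟨ +-monoˡ-≤ (12 * d) (*-monoʳ-≤ 3 (upper₂ d 0<d)) ⟩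
      3 * (N + 4 * d) + 12 * d ≡⟨ e₂ N d ⟩
      2 * (N + 12 * d) + N ∎))
      where
      e₁ : ∀ x y d → 2 * (3 * (x * d)) + (2 * (y * (d * 3)) + 4 * (d * 3)) ≡ 3 * (2 * ((x + y) * d)) + 12 * d
      e₁ = solve-∀
      e₂ : ∀ N d → 3 * (N + 4 * d) + 12 * d ≡ 2 * (N + 12 * d) + N
      e₂ = solve-∀

    lower₃ : ∀ d → 0 < d → N ≤ 3 * (S d 3 * d) + 12 * d
    lower₃ d 0<d = *-cancelˡ-≤ 2 (+-cancelʳ-≤ N _ _ (begin
      2 * N + N ≡⟨ e₀ N ⟩
      3 * N ≤⟨ *-monoʳ-≤ 3 (lower₂ d 0<d) ⟩
      3 * (2 * (S d 2 * d) + 4 * d) ≡⟨ cong (λ x → 3 * (2 * (x * d) + 4 * d)) (split₃ d 0<d) ⟩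
      3 * (2 * ((S d 3 + S (d * 3) 2) * d) + 4 * d) ≡⟨ e₁ (S d 3) (S (d * 3) 2) d ⟩
      6 * (S d 3 * d) + 12 * d + 2 * (S (d * 3) 2 * (d * 3)) ≤⟨ +-monoʳ-≤ (6 * (S d 3 * d) + 12 * d) (upper₂ (d * 3) (*-mono-≤ 0<d (s≤s (z≤n {2})))) ⟩
      6 * (S d 3 * d) + 12 * d + (N + 4 * (d * 3)) ≡⟨ e₂ (S d 3 * d) N d ⟩
      2 * (3 * (S d 3 * d) + 12 * d) + N ∎))
      where
      e₀ : ∀ N → 2 * N + N ≡ 3 * N
      e₀ = solve-∀
      e₁ : ∀ x y d → 3 * (2 * ((x + y) * d) + 4 * d) ≡ 6 * (x * d) + 12 * d + 2 * (y * (d * 3))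
      e₁ = solve-∀
      e₂ : ∀ x N d → 6 * x + 12 * d + (N + 4 * (d * 3)) ≡ 2 * (3 * x + 12 * d) + N
      e₂ = solve-∀

    -- Here l is any integer below 32 log₂ (N / d), not the best one: passing from d to d p replaces
    -- l by l - w with w ≥ 32 log₂ p, and the hypothesis is inherited without loss. The abscissa is
    -- 40 s with s = V l / 27.
    Bounds : ℕ → Set
    Bounds z = ∀ d l → 0 < d → 2 ^ l * pow32 d ≤ pow32 N →
      Low (40 * totientProduct z * l) (27 * primorial z) N (40 * (S d z * d) * l * primorial z) ×
      Up (40 * totientProduct z * l) (27 * primorial z) N (40 * (S d z * d) * l * primorial z)

    bounds₃ : Bounds 3
    bounds₃ d l 0<d valid = low , up
      where
      j = l / 32
      k = 15 + j * 16
      q = 2 ^ j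
      q>0 : 0 < q
      q>0 = m^n>0 2 j
      qd≤N : q * d ≤ N
      qd≤N = pow32-cancel (begin
        pow32 (q * d) ≡⟨ pow32-* q d ⟩
        pow32 q * pow32 d ≡⟨ cong (_* pow32 d) (pow32-2^ j) ⟩
        2 ^ (j * 32) * pow32 d ≤⟨ *-monoˡ-≤ (pow32 d) (^-monoʳ-≤ 2 (m/n*n≤m l 32)) ⟩
        2 ^ l * pow32 d ≤⟨ valid ⟩
        pow32 N ∎)
      l<L : l < 32 * suc j
      l<L = begin-strict
        l ≡⟨ m≡m%n+[m/n]*n l 32 ⟩
        l % 32 + j * 32 <⟨ +-monoˡ-< (j * 32) (m%n<n l 32) ⟩
        32 + j * 32 ≡⟨ *-comm (suc j) 32 ⟩
        32 * suc j ∎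
      a-small : 40 * 2 * l < suc k * 162
      a-small = begin-strict
        80 * l <⟨ *-monoʳ-< 80 l<L ⟩
        80 * (32 * suc j) ≡⟨ *-assoc 80 32 (suc j) ⟨
        2560 * suc j ≤⟨ *-monoˡ-≤ (suc j) (≤ᵇ-sound 2560 2592 refl) ⟩
        2592 * suc j ≡⟨ *-comm 2592 (suc j) ⟩
        suc j * (16 * 162) ≡⟨ *-assoc (suc j) 16 162 ⟨
        suc j * 16 * 162 ∎
      e₁ : ∀ x l → 240 * x * l ≡ 40 * x * l * 6
      e₁ = solve-∀
      low : Low (40 * 2 * l) 162 N (40 * (S d 3 * d) * l * 6)
      low with <-≤-connex j 5
      ... | inj₁ j<5 = inj₁ (<-≤-trans a-small (*-monoˡ-≤ 162 (≤-trans (s≤s (+-monoʳ-≤ 15 (*-monoˡ-≤ 16 (s≤s⁻¹ j<5)))) (≤ᵇ-sound 80 83 refl))))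
      ... | inj₂ 5≤j = inj₂ (k , ≤-trans (≤ᵇ-sound 83 95 refl) (+-monoʳ-≤ 15 (*-monoˡ-≤ 16 5≤j)) , a-small ,
              subst (λ y → wL k * (80 * l * N) ≤ uL k * y + vL k * (162 * N)) (e₁ (S d 3 * d) l)
                (base-low (uL k) (vL k) (wL k) {l} {32 * suc j} {N} {d} {q} {S d 3} q>0 qd≤N (lower₃ d 0<d) (<⇒≤ l<L) (base-lower j 5≤j)))
      up : Up (40 * 2 * l) 162 N (40 * (S d 3 * d) * l * 6)
      up with <-≤-connex j 4
      ... | inj₂ 4≤j = k , a-small ,
              subst (λ y → uU k * y ≤ vU k * (162 * N) + wU k * (80 * l * N)) (e₁ (S d 3 * d) l)
                (base-up (uU k) (vU k) (wU k) 80 960 {l} {32 * suc j} {N} {d} {q} {S d 3} q>0 qd≤N count (<⇒≤ l<L) (base-upper j 4≤j))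
        where
        count : 240 * (S d 3 * d) ≤ 80 * N + 960 * d
        count = begin
          240 * (S d 3 * d) ≡⟨ *-assoc 80 3 (S d 3 * d) ⟩
          80 * (3 * (S d 3 * d)) ≤⟨ *-monoʳ-≤ 80 (upper₃ d 0<d) ⟩
          80 * (N + 12 * d) ≡⟨ e₂ N d ⟩
          80 * N + 960 * d ∎
          where
          e₂ : ∀ N d → 80 * (N + 12 * d) ≡ 80 * N + 960 * d
          e₂ = solve-∀
      ... | inj₁ j<4 = k , a-small ,
              subst (λ y → uU k * y ≤ vU k * (162 * N) + wU k * (80 * l * N)) (e₁ (S d 3 * d) l)
                (base-up (uU k) (vU k) (wU k) 120 480 {l} {32 * suc j} {N} {d} {q} {S d 3} q>0 qd≤N count (<⇒≤ l<L) (base-upper-small j j<4))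
        where
        count : 240 * (S d 3 * d) ≤ 120 * N + 480 * d
        count = begin
          240 * (S d 3 * d) ≤⟨ *-monoʳ-≤ 240 (*-monoˡ-≤ d (≤-trans (m≤m+n (S d 3) _) (≤-reflexive (sym (split₃ d 0<d))))) ⟩
          240 * (S d 2 * d) ≡⟨ *-assoc 120 2 (S d 2 * d) ⟩
          120 * (2 * (S d 2 * d)) ≤⟨ *-monoʳ-≤ 120 (upper₂ d 0<d) ⟩
          120 * (N + 4 * d) ≡⟨ e₂ N d ⟩
          120 * N + 480 * d ∎
          where
          e₂ : ∀ N d → 120 * (N + 4 * d) ≡ 120 * N + 480 * d
          e₂ = solve-∀

    module Step {z : ℕ} (p-prime : Prime (suc z)) (w : ℕ) (weight : pow32 (suc z) ≤ 2 ^ w)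
                (dense : totientProduct z * w ≤ 27 * primorial z) (ih : Bounds z)
                (d l : ℕ) (0<d : 0 < d) (valid : 2 ^ l * pow32 d ≤ pow32 N) where
      private
        F = totientProduct z
        P = primorial z
        a = 40 * F * l
        b = 27 * P
        y = 40 * (S d z * d) * l * P
        y₁ = 40 * (S d (suc z) * d) * l * (suc z * P)
        dp = d * suc z
        l′ = l ∸ w
        a′ = 40 * F * l′
        y′ = 40 * (S dp z * dp) * l′ * P

      b>0 : 0 < b
      b>0 = *-mono-≤ (s≤s (z≤n {26})) (primorial>0 z)

      shift₀ : 40 * F * w ≤ 40 * b
      shift₀ = ≤-trans (≤-reflexive (*-assoc 40 F w)) (*-monoʳ-≤ 40 dense)

      module Large (big : 83 * b ≤ a) where
        w<l : w < l
        w<l = *-cancelˡ-< (40 * F) w l (begin-strict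
          40 * F * w ≤⟨ shift₀ ⟩
          40 * b <⟨ *-monoˡ-< b {{>-nonZero b>0}} {40} {83} (≤ᵇ-sound 41 83 refl) ⟩
          83 * b ≤⟨ big ⟩
          40 * F * l ∎)

        l′>0 : 0 < l′
        l′>0 = m<n⇒0<n∸m w<l

        prop : l * a′ ≡ l′ * a
        prop = e l (40 * F) l′
          where
          e : ∀ l x l′ → l * (x * l′) ≡ l′ * (x * l)
          e = solve-∀

        shift : a ≤ a′ + 40 * b
        shift = begin
          40 * F * l ≡⟨ cong (40 * F *_) (m∸n+n≡m (<⇒≤ w<l)) ⟨
          40 * F * (l′ + w) ≡⟨ *-distribˡ-+ (40 * F) l′ w ⟩
          a′ + 40 * F * w ≤⟨ +-monoʳ-≤ a′ shift₀ ⟩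
          a′ + 40 * b ∎

        -- The normalised counts of d and d p carry different factors l and l′, so Buchstab's
        -- identity is cross-multiplied.
        buchstab : l′ * (suc z * y) ≡ l′ * y₁ + l * y′
        buchstab = trans (cong (λ s → l′ * (suc z * (40 * (s * d) * l * P))) (sift-prime d z 0<d p-prime))
                         (e l′ (suc z) (S d (suc z)) (S dp z) d l P)
          where
          e : ∀ l′ p s t d l P → l′ * (p * (40 * ((s + t) * d) * l * P)) ≡ l′ * (40 * (s * d) * l * (p * P)) + l * (40 * (t * (d * p)) * l′ * P)
          e = solve-∀

        0<dp : 0 < dp
        0<dp = *-mono-≤ 0<d (s≤s (z≤n {z}))

        valid′ : 2 ^ l′ * pow32 dp ≤ pow32 N
        valid′ = begin
          2 ^ l′ * pow32 (d * suc z) ≡⟨ cong (2 ^ l′ *_) (pow32-* d (suc z)) ⟩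
          2 ^ l′ * (pow32 d * pow32 (suc z)) ≤⟨ *-monoʳ-≤ (2 ^ l′) (*-monoʳ-≤ (pow32 d) weight) ⟩
          2 ^ l′ * (pow32 d * 2 ^ w) ≡⟨ e (2 ^ l′) (pow32 d) (2 ^ w) ⟩
          2 ^ l′ * 2 ^ w * pow32 d ≡⟨ cong (_* pow32 d) (^-distribˡ-+-* 2 l′ w) ⟨
          2 ^ (l′ + w) * pow32 d ≡⟨ cong (λ t → 2 ^ t * pow32 d) (m∸n+n≡m (<⇒≤ w<l)) ⟩
          2 ^ l * pow32 d ≤⟨ valid ⟩
          pow32 N ∎
          where
          e : ∀ x y z → x * (y * z) ≡ x * z * y
          e = solve-∀

      low₀ = proj₁ (ih d l 0<d valid)
      up₀ = proj₂ (ih d l 0<d valid)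

      big-from : 83 * (suc z * b) ≤ z * a → 83 * b ≤ a
      big-from h = *-cancelˡ-≤ (suc z) (begin
        suc z * (83 * b) ≡⟨ e (suc z) 83 b ⟩
        83 * (suc z * b) ≤⟨ h ⟩
        z * a ≤⟨ *-monoˡ-≤ a (n≤1+n z) ⟩
        suc z * a ∎)
        where
        e : ∀ x c b → x * (c * b) ≡ c * (x * b)
        e = solve-∀

      low₁ : Low (z * a) (suc z * b) N y₁
      low₁ with ≤-<-connex (83 * (suc z * b)) (z * a)
      ... | inj₂ small = inj₁ small
      ... | inj₁ h = low-step {a} {a′} {b} {N} {y} {y′} {y₁} {l} {l′} {z} l′>0 prop shift buchstab (big-from h) low₀
                       (proj₂ (ih dp l′ 0<dp valid′))
        where open Large (big-from h)

      up₁ : Up (z * a) (suc z * b) N y₁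
      up₁ = conclude (up-cell {a} {b} {N} {y} (proj₁ up₀) (proj₁ (proj₂ up₀)) (proj₂ (proj₂ up₀)))
        where
        y₁≤ : y₁ ≤ suc z * y
        y₁≤ = begin
          40 * (S d (suc z) * d) * l * (suc z * P)
            ≤⟨ *-monoˡ-≤ (suc z * P) (*-monoˡ-≤ l (*-monoʳ-≤ 40 (*-monoˡ-≤ d (≤-trans (m≤m+n (S d (suc z)) (S dp z)) (≤-reflexive (sym (sift-prime d z 0<d p-prime))))))) ⟩
          40 * (S d z * d) * l * (suc z * P) ≡⟨ e (40 * (S d z * d) * l) (suc z) P ⟩
          suc z * y ∎
          where
          e : ∀ x p P → x * (p * P) ≡ p * (x * P)
          e = solve-∀
        conclude : (∃ λ k → k * b ≤ a × a < suc k * b × UpLine k a b N y) → Up (z * a) (suc z * b) N y₁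
        conclude (k , lo , hi , line) with <-≤-connex k 123
        ... | inj₁ k<123 = up-flat {a} {b} {N} {y} {y₁} {z} k k<123 hi y₁≤ line
        ... | inj₂ 123≤k = up-step {a} {a′} {b} {N} {y} {y′} {y₁} {l} {l′} {z} l′>0 prop shift buchstab k 123≤k lo hi line
                             (proj₁ (ih dp l′ 0<dp valid′))
          where open Large (≤-trans (*-monoˡ-≤ b (≤-trans (≤ᵇ-sound 83 123 refl) 123≤k)) lo)

      result : Low (40 * totientProduct (suc z) * l) (27 * primorial (suc z)) N (40 * (S d (suc z) * d) * l * primorial (suc z)) ×
               Up (40 * totientProduct (suc z) * l) (27 * primorial (suc z)) N (40 * (S d (suc z) * d) * l * primorial (suc z))
      result rewrite totient-prime p-prime | primorial-prime p-prime =
        subst₂ (λ a b → Low a b N y₁ × Up a b N y₁) (e₁ z F l) (e₂ (suc z) P) (low₁ , up₁)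
        where
        e₁ : ∀ z F l → z * (40 * F * l) ≡ 40 * (z * F) * l
        e₁ = solve-∀
        e₂ : ∀ p P → p * (27 * P) ≡ 27 * (p * P)
        e₂ = solve-∀

    module _ (weight : ℕ → ℕ) (weighted : ∀ p → pow32 p ≤ 2 ^ weight p)
             (dense : ∀ z → 3 ≤ z → Prime (suc z) → totientProduct z * weight (suc z) ≤ 27 * primorial z) where

      bounds : ∀ t → Bounds (t + 3)
      bounds zero = bounds₃
      bounds (suc t) d l 0<d valid = step (prime? (suc (t + 3)))
        where
        step : Dec (Prime (suc (t + 3))) →
          Low (40 * totientProduct (suc (t + 3)) * l) (27 * primorial (suc (t + 3))) N (40 * (S d (suc (t + 3)) * d) * l * primorial (suc (t + 3))) ×
          Up (40 * totientProduct (suc (t + 3)) * l) (27 * primorial (suc (t + 3))) N (40 * (S d (suc (t + 3)) * d) * l * primorial (suc (t + 3)))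
        step (yes p) = Step.result p (weight (suc (t + 3))) (weighted (suc (t + 3))) (dense (t + 3) (m≤n+m 3 t) p) (bounds t) d l 0<d valid
        step (no ¬p) rewrite sift-other d (t + 3) ¬p | totient-nonprime ¬p | primorial-nonprime ¬p = bounds t d l 0<d valid

      unsifted : ∀ z l → 3 ≤ z → 2 ^ l ≤ pow32 N → 83 * (27 * primorial z) ≤ 40 * totientProduct z * l → 0 < S 1 z
      unsifted z l 3≤z valid big with S 1 z in eq
      ... | suc _ = s≤s z≤n
      ... | zero = ⊥-elim (<⇒≱ positive (≤-reflexive vanishes))
        where
        B : Bounds z
        B = subst Bounds (m∸n+n≡m 3≤z) (bounds (z ∸ 3))
        positive : 0 < 40 * (S 1 z * 1) * l * primorial z
        positive = low-positive {b = 27 * primorial z} (*-mono-≤ (s≤s (z≤n {26})) (primorial>0 z)) N>0 big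
          (proj₁ (B 1 l (s≤s z≤n) (≤-trans (≤-reflexive (trans (cong (2 ^ l *_) pow32-1) (*-identityʳ (2 ^ l)))) valid)))
        vanishes : 40 * (S 1 z * 1) * l * primorial z ≡ 0
        vanishes rewrite eq = refl

-- Divisibility by small primes, and the counting function of an interval.

module Rough where

  open import Data.Nat.Primality.Factorisation using (factorise; PrimeFactorisation)
  open import Data.Nat.ListAction using (product)
  open import Data.List using ([]; _∷_)
  open import Data.List.Relation.Unary.All using (_∷_)

  prime>1 : ∀ {p} → Prime p → 1 < p
  prime>1 {p} pp = nonTrivial⇒n>1 p {{prime⇒nonTrivial pp}}

  prime>0 : ∀ {p} → Prime p → 0 < p
  prime>0 pp = <-trans (s≤s z≤n) (prime>1 pp)

  prime∤1 : ∀ {p} → Prime p → ¬ p ∣ 1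
  prime∤1 pp p∣1 = <⇒≱ (prime>1 pp) (∣⇒≤ p∣1)

  -- Case analyses on this copy of prime? do not disturb the occurrences of prime? in primorial and the like.
  opaque
    decPrime : ∀ n → Dec (Prime n)
    decPrime = prime?

  Sieved : ℕ → ℕ → Set
  Sieved z x = ∀ p → Prime p → p ≤ z → ¬ p ∣ x

  prime-divisor : ∀ {n} → 1 < n → ∃ λ p → Prime p × p ∣ n
  prime-divisor {n} 1<n = go (factorise n {{>-nonZero (<-trans (s≤s z≤n) 1<n)}})
    where
    go : PrimeFactorisation n → ∃ λ p → Prime p × p ∣ n
    go record { factors = [] ; isFactorisation = refl } = ⊥-elim (<-irrefl refl 1<n)
    go record { factors = p ∷ ps ; isFactorisation = eq ; factorsPrime = pp ∷ _ } = p , pp , divides (product ps) (trans eq (*-comm p _))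

  sieved-1 : ∀ x → Sieved 1 x
  sieved-1 x p pp p≤1 = ⊥-elim (<⇒≱ (prime>1 pp) p≤1)

  sieved-suc : ∀ {z x} → Sieved z x → (Prime (suc z) → ¬ suc z ∣ x) → Sieved (suc z) x
  sieved-suc h new p pp p≤ with m≤n⇒m<n∨m≡n p≤
  ... | inj₁ (s≤s p≤z) = h p pp p≤z
  ... | inj₂ refl = new pp

  sieved-pred : ∀ {z x} → Sieved (suc z) x → Sieved z x
  sieved-pred h p pp p≤z = h p pp (m≤n⇒m≤1+n p≤z)

  sieved? : ∀ z x → Dec (Sieved z x)
  sieved? zero x = yes λ p pp p≤0 → ⊥-elim (<⇒≱ (prime>0 pp) p≤0)
  sieved? (suc z) x with sieved? z x
  ... | no ¬h = no (¬h ∘ sieved-pred)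
  ... | yes h with prime? (suc z)
  ...   | no ¬p = yes (sieved-suc h (⊥-elim ∘ ¬p))
  ...   | yes p with suc z ∣? x
  ...     | yes d = no λ h′ → h′ (suc z) p ≤-refl d
  ...     | no ¬d = yes (sieved-suc h (λ _ → ¬d))

  prime∣primorial⇒≤ : ∀ n {p} → Prime p → p ∣ primorial n → p ≤ n
  prime∣primorial⇒≤ zero pp d = ⊥-elim (prime∤1 pp d)
  prime∣primorial⇒≤ (suc n) pp d with prime? (suc n)
  ... | no _ = m≤n⇒m≤1+n (prime∣primorial⇒≤ n pp d)
  ... | yes _ with euclidsLemma (suc n) (primorial n) pp d
  ...   | inj₁ d′ = ∣⇒≤ d′
  ...   | inj₂ d′ = m≤n⇒m≤1+n (prime∣primorial⇒≤ n pp d′)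

  ≤⇒prime∣primorial : ∀ n {p} → Prime p → p ≤ n → p ∣ primorial n
  ≤⇒prime∣primorial zero pp p≤0 = ⊥-elim (<⇒≱ (prime>0 pp) p≤0)
  ≤⇒prime∣primorial (suc n) {p} pp p≤ with prime? (suc n) | m≤n⇒m<n∨m≡n p≤
  ... | yes _ | inj₁ (s≤s p≤n) = ∣n⇒∣m*n (suc n) (≤⇒prime∣primorial n pp p≤n)
  ... | yes _ | inj₂ refl = m∣m*n (primorial n)
  ... | no _ | inj₁ (s≤s p≤n) = ≤⇒prime∣primorial n pp p≤n
  ... | no ¬p | inj₂ refl = ⊥-elim (¬p pp)

  prime∣!⇒≤ : ∀ n {p} → Prime p → p ∣ n ! → p ≤ n
  prime∣!⇒≤ zero pp d = ⊥-elim (prime∤1 pp d)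
  prime∣!⇒≤ (suc n) pp d with euclidsLemma (suc n) (n !) pp d
  ... | inj₁ d′ = ∣⇒≤ d′
  ... | inj₂ d′ = m≤n⇒m≤1+n (prime∣!⇒≤ n pp d′)

  prime^∣-cancel : ∀ {p u} → Prime p → ¬ p ∣ u → ∀ f m → p ^ f ∣ m * u → p ^ f ∣ m
  prime^∣-cancel pp ∤u zero m d = 1∣ m
  prime^∣-cancel {p} {u} pp ∤u (suc f) m d with euclidsLemma m u pp (∣-trans (m∣m*n (p ^ f)) d)
  ... | inj₂ p∣u = ⊥-elim (∤u p∣u)
  ... | inj₁ (divides m′ refl) = subst (p ^ suc f ∣_) (*-comm p m′) (*-monoʳ-∣ p
          (prime^∣-cancel pp ∤u f m′ (*-cancelˡ-∣ p {{prime⇒nonZero pp}} (subst (p ^ suc f ∣_) (e m′ p u) d))))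
    where
    e : ∀ m p u → m * p * u ≡ p * (m * u)
    e = solve-∀

  coprime-product-∣ : ∀ {p F n} → Prime p → ¬ p ∣ F → ∀ e → F ∣ n → p ^ e ∣ n → F * p ^ e ∣ n
  coprime-product-∣ {p} {F} pp ∤F e (divides m refl) d = subst (F * p ^ e ∣_) (*-comm F m) (*-monoʳ-∣ F (prime^∣-cancel pp ∤F e m d))

  prime∤^ : ∀ {p q} → Prime p → Prime q → p ≢ q → ∀ e → ¬ p ∣ q ^ e
  prime∤^ pp qq p≢q zero d = prime∤1 pp d
  prime∤^ {p} {q} pp qq p≢q (suc e) d with euclidsLemma q (q ^ e) pp d
  ... | inj₂ d′ = prime∤^ pp qq p≢q e d′
  ... | inj₁ d′ with prime⇒irreducible qq d′
  ...   | inj₁ refl = ⊥-elim (<⇒≱ (prime>1 pp) ≤-refl)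
  ...   | inj₂ p≡q = p≢q p≡q

  -- f is fuel.
  exact-power : ∀ {p} → Prime p → ∀ f x → x ≤ f → 0 < x → ∃ λ e → ∃ λ y → x ≡ p ^ e * y × ¬ p ∣ y
  exact-power pp zero x x≤0 0<x = ⊥-elim (<⇒≱ 0<x x≤0)
  exact-power {p} pp (suc f) x x≤f 0<x with p ∣? x
  ... | no ∤x = 0 , x , sym (+-identityʳ x) , ∤x
  ... | yes (divides zero refl) = ⊥-elim (<-irrefl refl 0<x)
  ... | yes (divides y@(suc _) refl) with exact-power pp f y (s≤s⁻¹ (<-≤-trans (m<m*n y p (prime>1 pp)) x≤f)) (s≤s z≤n)
  ...   | e , w , eq , ∤w = suc e , w , trans (cong (_* p) eq) (ring (p ^ e) w p) , ∤w
    where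
    ring : ∀ a w p → a * w * p ≡ p * a * w
    ring = solve-∀

  count : ∀ {P : ℕ → Set} → (∀ x → Dec (P x)) → ℕ → ℕ
  count P? zero = 0
  count P? (suc n) with P? n
  ... | yes _ = suc (count P? n)
  ... | no _ = count P? n

  module _ {P Q : ℕ → Set} (P? : ∀ x → Dec (P x)) (Q? : ∀ x → Dec (Q x)) where

    count-ext : ∀ n → (∀ x → P x → Q x) → (∀ x → Q x → P x) → count P? n ≡ count Q? n
    count-ext zero f g = refl
    count-ext (suc n) f g with P? n | Q? n
    ... | yes _ | yes _ = cong suc (count-ext n f g)
    ... | no _ | no _ = count-ext n f g
    ... | yes p | no ¬q = ⊥-elim (¬q (f n p))
    ... | no ¬p | yes q = ⊥-elim (¬p (g n q))

    count-split : ∀ {R : ℕ → Set} (R? : ∀ x → Dec (R x)) → (∀ x → P x → Q x ⊎ R x) → (∀ x → Q x → P x) → (∀ x → R x → P x) →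
      (∀ x → Q x → ¬ R x) → ∀ n → count P? n ≡ count Q? n + count R? n
    count-split R? f g h k zero = refl
    count-split R? f g h k (suc n) with P? n | Q? n | R? n
    ... | yes p | yes q | yes r = ⊥-elim (k n q r)
    ... | yes p | yes q | no _ = cong suc (count-split R? f g h k n)
    ... | yes p | no _ | yes r = trans (cong suc (count-split R? f g h k n)) (sym (+-suc _ _))
    ... | yes p | no ¬q | no ¬r with f n p
    ...   | inj₁ q = ⊥-elim (¬q q)
    ...   | inj₂ r = ⊥-elim (¬r r)
    count-split R? f g h k (suc n) | no ¬p | yes q | _ = ⊥-elim (¬p (g n q))
    count-split R? f g h k (suc n) | no ¬p | no _ | yes r = ⊥-elim (¬p (h n r))
    count-split R? f g h k (suc n) | no ¬p | no _ | no _ = count-split R? f g h k n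

  count-none : ∀ {P : ℕ → Set} (P? : ∀ x → Dec (P x)) n → (∀ x → x < n → ¬ P x) → count P? n ≡ 0
  count-none P? zero h = refl
  count-none P? (suc n) h with P? n
  ... | yes p = ⊥-elim (h n ≤-refl p)
  ... | no _ = count-none P? n (λ x x<n → h x (m<n⇒m<1+n x<n))

  count-some : ∀ {P : ℕ → Set} (P? : ∀ x → Dec (P x)) n → 0 < count P? n → ∃ λ x → x < n × P x
  count-some P? (suc n) h with P? n
  ... | yes p = n , ≤-refl , p
  ... | no _ with count-some P? n h
  ...   | x , x<n , p = x , m<n⇒m<1+n x<n , p

  count-extend : ∀ {P : ℕ → Set} (P? : ∀ x → Dec (P x)) n m → n ≤ m → (∀ x → n ≤ x → ¬ P x) → count P? m ≡ count P? n
  count-extend P? n zero z≤n h = refl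
  count-extend P? n (suc m) n≤m h with m≤n⇒m<n∨m≡n n≤m
  ... | inj₂ refl = refl
  ... | inj₁ (s≤s n≤m′) with P? m
  ...   | yes p = ⊥-elim (h m n≤m′ p)
  ...   | no _ = count-extend P? n m n≤m′ h

  -- For a downward closed property the count is the threshold where the property stops; this counts
  -- multiples below a bound without division.
  count-prefix : ∀ {P : ℕ → Set} (P? : ∀ x → Dec (P x)) → (∀ {x y} → x ≤ y → P y → P x) →
    ∀ n → count P? n ≤ n × (∀ x → x < count P? n → P x) × (count P? n < n → ¬ P (count P? n))
  count-prefix P? closed zero = z≤n , (λ _ ()) , λ ()
  count-prefix {P} P? closed (suc n) with P? n | count-prefix P? closed n
  ... | no ¬p | le , below , above = m≤n⇒m≤1+n le , below , not
    where
    not : count P? n < suc n → ¬ P (count P? n)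
    not _ with m≤n⇒m<n∨m≡n le
    ... | inj₁ lt = above lt
    ... | inj₂ eq = subst (λ x → ¬ P x) (sym eq) ¬p
  ... | yes p | le , below , above with m≤n⇒m<n∨m≡n le
  ...   | inj₁ lt = ⊥-elim (above lt (closed le p))
  ...   | inj₂ eq = s≤s le , (λ x x<s → closed (s≤s⁻¹ (subst (λ c → x < suc c) eq x<s)) p) , λ lt → ⊥-elim (<-irrefl (cong suc eq) lt)

  -- Of each block of p consecutive numbers starting at n p only the first can satisfy `P`.
  count-multiples : ∀ {P Q : ℕ → Set} (P? : ∀ x → Dec (P x)) (Q? : ∀ x → Dec (Q x)) p → 0 < p →
    (∀ x → P x → p ∣ x) → (∀ y → P (p * y) → Q y) → (∀ y → Q y → P (p * y)) → ∀ n → count P? (n * p) ≡ count Q? n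
  count-multiples P? Q? p@(suc p′) 0<p only f g zero = refl
  count-multiples {P} P? Q? p@(suc p′) 0<p only f g (suc n) = trans (block p′ ≤-refl) last
    where
    ∤ : ∀ r → suc r < p → ¬ P (suc r + n * p)
    ∤ r r<p h = <⇒≱ r<p (∣⇒≤ (∣m+n∣m⇒∣n (subst (p ∣_) (+-comm (suc r) (n * p)) (only _ h)) (n∣m*n n)))
    block : ∀ r → r < p → count P? (suc r + n * p) ≡ count P? (suc (n * p))
    block zero _ = refl
    block (suc r) r<p with P? (suc r + n * p)
    ... | yes h = ⊥-elim (∤ r r<p h)
    ... | no _ = block r (<-trans (n<1+n r) r<p)
    last : count P? (suc (n * p)) ≡ count Q? (suc n)
    last with P? (n * p) | Q? n
    ... | yes _ | yes _ = cong suc (count-multiples P? Q? p 0<p only f g n)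
    ... | no _ | no _ = count-multiples P? Q? p 0<p only f g n
    ... | yes h | no ¬q = ⊥-elim (¬q (f n (subst P (*-comm n p) h)))
    ... | no ¬h | yes q = ⊥-elim (¬h (subst P (*-comm p n) (g n q)))

  module Interval (a N : ℕ) where

    In : ℕ → ℕ → ℕ → Set
    In d z y = (a ≤ d * y × d * y < a + N) × Sieved z y

    in? : ∀ d z y → Dec (In d z y)
    in? d z y = ((a ≤? d * y) ×-dec (d * y <? a + N)) ×-dec sieved? z y

    -- The sieve condition is imposed on the cofactor y of d, not on d y, so that d need not be coprime to the sieving primes.
    S : ℕ → ℕ → ℕ
    S d z = count (in? d z) (a + N)

    private
      below? : ∀ d b y → Dec (d * y < b)
      below? d b y = d * y <? b

      below : ∀ d b n → 0 < d → b ≤ n → let c = count (below? d b) n in b ≤ c * d × c * d < b + d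
      below d b n 0<d b≤n with count-prefix (below? d b) (λ x≤y → ≤-<-trans (*-monoʳ-≤ d x≤y)) n
      ... | c≤n , P , ¬P = lower , upper (count (below? d b) n) P
        where
        c = count (below? d b) n
        lower : b ≤ c * d
        lower with m≤n⇒m<n∨m≡n c≤n
        ... | inj₁ lt = ≤-trans (≮⇒≥ (¬P lt)) (≤-reflexive (*-comm d c))
        ... | inj₂ eq = ≤-trans b≤n (≤-trans (m≤m*n n d {{>-nonZero 0<d}}) (≤-reflexive (cong (_* d) (sym eq))))
        upper : ∀ c → (∀ x → x < c → d * x < b) → c * d < b + d
        upper zero _ = <-≤-trans 0<d (m≤n+m d b)
        upper (suc c) P = subst (_< b + d) (+-comm (c * d) d) (+-monoˡ-< d (subst (_< b) (*-comm d c) (P c ≤-refl)))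

      total : ∀ d → 0 < d → count (below? d (a + N)) (a + N) ≡ S d 1 + count (below? d a) (a + N)
      total d 0<d = count-split (below? d (a + N)) (in? d 1) (below? d a)
        classify (λ y h → proj₂ (proj₁ h)) (λ y h → <-≤-trans h (m≤m+n a N))
        (λ y h lt → <⇒≱ lt (proj₁ (proj₁ h))) (a + N)
        where
        classify : ∀ y → d * y < a + N → In d 1 y ⊎ d * y < a
        classify y <b with ≤-<-connex a (d * y)
        ... | inj₁ a≤ = inj₁ ((a≤ , <b) , sieved-1 y)
        ... | inj₂ <a = inj₂ <a

    open ≤-Reasoning

    S-upper : ∀ d → 0 < d → S d 1 * d ≤ N + d
    S-upper d 0<d = +-cancelʳ-≤ a _ _ (begin
      S d 1 * d + a ≤⟨ +-monoʳ-≤ (S d 1 * d) (proj₁ (below d a (a + N) 0<d (m≤m+n a N))) ⟩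
      S d 1 * d + count (below? d a) (a + N) * d ≡⟨ *-distribʳ-+ d (S d 1) _ ⟨
      (S d 1 + count (below? d a) (a + N)) * d ≡⟨ cong (_* d) (total d 0<d) ⟨
      count (below? d (a + N)) (a + N) * d ≤⟨ <⇒≤ (proj₂ (below d (a + N) (a + N) 0<d ≤-refl)) ⟩
      a + N + d ≡⟨ e a N d ⟩
      N + d + a ∎)
      where
      e : ∀ a N d → a + N + d ≡ N + d + a
      e = solve-∀

    S-lower : ∀ d → 0 < d → N < S d 1 * d + d
    S-lower d 0<d = +-cancelˡ-< a _ _ (begin-strict
      a + N ≤⟨ proj₁ (below d (a + N) (a + N) 0<d ≤-refl) ⟩
      count (below? d (a + N)) (a + N) * d ≡⟨ cong (_* d) (total d 0<d) ⟩
      (S d 1 + count (below? d a) (a + N)) * d ≡⟨ *-distribʳ-+ d (S d 1) _ ⟩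
      S d 1 * d + count (below? d a) (a + N) * d <⟨ +-monoʳ-< (S d 1 * d) (proj₂ (below d a (a + N) 0<d (m≤m+n a N))) ⟩
      S d 1 * d + (a + d) ≡⟨ e (S d 1 * d) a d ⟩
      a + (S d 1 * d + d) ∎)
      where
      e : ∀ x a d → x + (a + d) ≡ a + (x + d)
      e = solve-∀

    S-other : ∀ d z → ¬ Prime (suc z) → S d (suc z) ≡ S d z
    S-other d z ¬p = count-ext (in? d (suc z)) (in? d z) (a + N)
      (λ y (i , s) → i , sieved-pred s) (λ y (i , s) → i , sieved-suc s (⊥-elim ∘ ¬p))

    S-prime : ∀ d z → 0 < d → Prime (suc z) → S d z ≡ S d (suc z) + S (d * suc z) z
    S-prime d z 0<d pp = trans (count-split (in? d z) (in? d (suc z)) hit? cases (λ y (i , s) → i , sieved-pred s)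
        (λ y → proj₁) (λ y (i , s) (_ , d) → s p pp ≤-refl d) (a + N))
      -- `count-multiples` requires a range whose length is a multiple of p; extending it from a + N
      -- to (a + N) p adds nothing, as d y ≥ a + N there.
      (cong (S d (suc z) +_) (trans (sym (count-extend hit? (a + N) ((a + N) * p) (m≤m*n (a + N) p)
          λ y a+N≤y h → <⇒≱ (proj₂ (proj₁ (proj₁ h))) (≤-trans a+N≤y (m≤n*m y d {{>-nonZero 0<d}}))))
        (count-multiples hit? (in? (d * p) z) p (s≤s z≤n) (λ _ → proj₂) down up (a + N))))
      where
      p = suc z
      Hit : ℕ → Set
      Hit y = In d z y × p ∣ y
      hit? : ∀ y → Dec (Hit y)
      hit? y = in? d z y ×-dec (p ∣? y)
      cases : ∀ y → In d z y → In d (suc z) y ⊎ Hit y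
      cases y (i , s) with p ∣? y
      ... | yes d = inj₂ ((i , s) , d)
      ... | no ¬d = inj₁ (i , sieved-suc s (λ _ → ¬d))
      down : ∀ y → Hit (p * y) → In (d * p) z y
      down y (((l , u) , s) , _) = (subst (a ≤_) (sym (*-assoc d p y)) l , subst (_< a + N) (sym (*-assoc d p y)) u) ,
        λ q qq q≤z q∣y → s q qq q≤z (∣n⇒∣m*n p q∣y)
      up : ∀ y → In (d * p) z y → Hit (p * y)
      up y ((l , u) , s) = ((subst (a ≤_) (*-assoc d p y) l , subst (_< a + N) (*-assoc d p y) u) , sieved) , m∣m*n y
        where
        sieved : Sieved z (p * y)
        sieved q qq q≤z q∣py with euclidsLemma p y qq q∣py
        ... | inj₂ q∣y = s q qq q≤z q∣y
        ... | inj₁ q∣p with prime⇒irreducible pp q∣p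
        ...   | inj₁ refl = <⇒≱ (prime>1 qq) ≤-refl
        ...   | inj₂ refl = <⇒≱ ≤-refl q≤z

    survivor : ∀ z → 0 < S 1 z → ∃ λ y → a ≤ y × y < a + N × Sieved z y
    survivor z pos with count-some (in? 1 z) (a + N) pos
    ... | y , _ , (l , u) , s = y , subst (a ≤_) (*-identityˡ y) l , subst (_< a + N) (*-identityˡ y) u , s

-- Rounded logarithms in units of 1/32 of a binary digit.

module Logs where

  open SieveProfile using (*-cancelˡ-≤′; split-≤)
  open Pow32

  private
    greatest : ∀ n b → 1 ≤ n → ∃ λ l → 2 ^ l ≤ n × (n < 2 ^ suc l ⊎ l ≡ b)
    greatest n zero 1≤n = zero , 1≤n , inj₂ refl
    greatest n (suc b) 1≤n with greatest n b 1≤n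
    ... | l , le , inj₁ lt = l , le , inj₁ lt
    ... | l , le , inj₂ refl with ≤-<-connex (2 ^ suc l) n
    ...   | inj₁ le′ = suc l , le′ , inj₂ refl
    ...   | inj₂ lt = l , le , inj₁ lt

    n<2^n : ∀ n → n < 2 ^ n
    n<2^n zero = s≤s z≤n
    n<2^n (suc n) = +-mono-≤ (m^n>0 2 n) (≤-trans (n<2^n n) (m≤m+n _ 0))

    bracket : ∀ n b → 1 ≤ n → n < 2 ^ suc b → ∃ λ l → 2 ^ l ≤ n × n < 2 ^ suc l
    bracket n b 1≤n n< with greatest n b 1≤n
    ... | l , le , inj₁ lt = l , le , lt
    ... | l , le , inj₂ refl = l , le , n<

    crude : ∀ x j → j ≡ x * 32 → pow32 x < 2 ^ suc j
    crude x j eq = <-≤-trans (pow32-mono-< (n<2^n x)) (≤-trans (≤-reflexive (trans (pow32-2^ x) (cong (2 ^_) (sym eq)))) (^-monoʳ-≤ 2 (n≤1+n j)))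

    opaque
      crude-exists : ∀ x → ∃ λ j → pow32 x < 2 ^ suc j
      crude-exists x = x * 32 , crude x (x * 32) refl

    log-exists : ∀ x → ∃ λ l → 2 ^ l ≤ pow32 (suc x) × pow32 (suc x) < 2 ^ suc l
    log-exists x with crude-exists (suc x)
    ... | j , lt = bracket (pow32 (suc x)) j (pow32>0 (s≤s z≤n)) lt

  opaque
    -- The integer part of 32 log₂ x for x > 0.
    lg : ℕ → ℕ
    lg zero = 0
    lg (suc x) = proj₁ (log-exists x)

    2^lg≤ : ∀ {x} → 0 < x → 2 ^ lg x ≤ pow32 x
    2^lg≤ {suc x} _ = proj₁ (proj₂ (log-exists x))

    <2^lg : ∀ x → pow32 x < 2 ^ suc (lg x)
    <2^lg zero = subst (_< 2) (sym (pow32-^ 0)) (s≤s z≤n)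
    <2^lg (suc x) = proj₂ (proj₂ (log-exists x))

  weight : ℕ → ℕ
  weight x = suc (lg x)

  weighted : ∀ x → pow32 x ≤ 2 ^ weight x
  weighted x = <⇒≤ (<2^lg x)

  2^-cancel-≤ : ∀ {a b} → 2 ^ a ≤ 2 ^ b → a ≤ b
  2^-cancel-≤ {a} {b} le with ≤-<-connex a b
  ... | inj₁ a≤b = a≤b
  ... | inj₂ b<a = ⊥-elim (<⇒≱ (^-monoʳ-< 2 (s≤s (s≤s z≤n)) b<a) le)

  2^-cancel-< : ∀ {a b} → 2 ^ a < 2 ^ b → a < b
  2^-cancel-< {a} {b} lt with <-≤-connex a b
  ... | inj₁ a<b = a<b
  ... | inj₂ b≤a = ⊥-elim (<⇒≱ lt (^-monoʳ-≤ 2 b≤a))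

  ≤lg : ∀ {l x} → 2 ^ l ≤ pow32 x → l ≤ lg x
  ≤lg {l} {x} le = s≤s⁻¹ (2^-cancel-< {l} {suc (lg x)} (≤-<-trans le (<2^lg x)))

  lg≤ : ∀ {l x} → 0 < x → pow32 x < 2 ^ suc l → lg x ≤ l
  lg≤ {l} {x} 0<x lt = s≤s⁻¹ (2^-cancel-< {lg x} {suc l} (≤-<-trans (2^lg≤ 0<x) lt))

  lg-mono : ∀ {x y} → 0 < x → x ≤ y → lg x ≤ lg y
  lg-mono 0<x x≤y = ≤lg (≤-trans (2^lg≤ 0<x) (pow32-mono x≤y))

  private
    pow32-48 : pow32 48 ≤ 2 * pow32 47
    pow32-48 = subst₂ (λ a b → a ≤ 2 * b) (sym (pow32-^ 48)) (sym (pow32-^ 47)) (≤ᵇ⇒≤ (48 ^ 32) (2 * 47 ^ 32) _)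

  -- (1 + 1/x)³² is at most (48/47)³² ≤ 2 from x = 47 on, which is why 47 bounds the logarithms
  -- below.
  pow32-suc : ∀ {x} → 47 ≤ x → pow32 (suc x) ≤ 2 * pow32 x
  pow32-suc {x} 47≤x = *-cancelˡ-≤′ (pow32 47) (pow32>0 (s≤s (z≤n {46}))) (begin
    pow32 47 * pow32 (suc x) ≡⟨ pow32-* 47 (suc x) ⟨
    pow32 (47 * suc x) ≤⟨ pow32-mono (begin
      47 * suc x ≡⟨ *-suc 47 x ⟩
      47 + 47 * x ≤⟨ +-monoˡ-≤ (47 * x) 47≤x ⟩
      48 * x ∎) ⟩
    pow32 (48 * x) ≡⟨ pow32-* 48 x ⟩
    pow32 48 * pow32 x ≤⟨ *-monoˡ-≤ (pow32 x) pow32-48 ⟩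
    2 * pow32 47 * pow32 x ≡⟨ e (pow32 47) (pow32 x) ⟩
    pow32 47 * (2 * pow32 x) ∎)
    where
    open ≤-Reasoning
    e : ∀ a b → 2 * a * b ≡ a * (2 * b)
    e = solve-∀

  lg-suc : ∀ {x} → 47 ≤ x → lg (suc x) ≤ suc (lg x)
  lg-suc {x} 47≤x = lg≤ (s≤s z≤n) (≤-<-trans (pow32-suc 47≤x) (*-monoʳ-< 2 (<2^lg x)))

  -- x / lg x is increasing once lg x ≥ 47.
  lg-sublinear : ∀ {m Y D q} → 47 ≤ m → 0 < q → pow32 Y ≤ 2 ^ m * pow32 D → m ≤ lg q → lg q * Y ≤ m * (q * D)
  lg-sublinear {m} {Y} {D} {q} 47≤m 0<q hY m≤lg with split-≤ m≤lg
  ... | e , eq = pow32-cancel (begin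
    pow32 (lg q * Y) ≡⟨ pow32-* (lg q) Y ⟩
    pow32 (lg q) * pow32 Y ≤⟨ *-mono-≤ (≤-trans (≤-reflexive (cong pow32 eq)) (grows e)) hY ⟩
    2 ^ e * pow32 m * (2 ^ m * pow32 D) ≡⟨ ring (2 ^ e) (pow32 m) (2 ^ m) (pow32 D) ⟩
    pow32 m * (2 ^ m * 2 ^ e * pow32 D) ≡⟨ cong (λ t → pow32 m * (t * pow32 D)) (trans (sym (^-distribˡ-+-* 2 m e)) (cong (2 ^_) (sym eq))) ⟩
    pow32 m * (2 ^ lg q * pow32 D) ≤⟨ *-monoʳ-≤ (pow32 m) (*-monoˡ-≤ (pow32 D) (2^lg≤ 0<q)) ⟩
    pow32 m * (pow32 q * pow32 D) ≡⟨ cong (pow32 m *_) (pow32-* q D) ⟨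
    pow32 m * pow32 (q * D) ≡⟨ pow32-* m (q * D) ⟨
    pow32 (m * (q * D)) ∎)
    where
    open ≤-Reasoning
    ring : ∀ a b c d → a * b * (c * d) ≡ b * (c * a * d)
    ring = solve-∀
    -- Raising the logarithm by 1 doubles the 32nd power of q, while that of the logarithm itself at
    -- most doubles.
    grows : ∀ e → pow32 (m + e) ≤ 2 ^ e * pow32 m
    grows zero = ≤-reflexive (trans (cong pow32 (+-identityʳ m)) (sym (+-identityʳ (pow32 m))))
    grows (suc e) = begin
      pow32 (m + suc e) ≡⟨ cong pow32 (+-suc m e) ⟩
      pow32 (suc (m + e)) ≤⟨ pow32-suc (≤-trans 47≤m (m≤m+n m e)) ⟩
      2 * pow32 (m + e) ≤⟨ *-monoʳ-≤ 2 (grows e) ⟩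
      2 * (2 ^ e * pow32 m) ≡⟨ *-assoc 2 (2 ^ e) (pow32 m) ⟨
      2 ^ suc e * pow32 m ∎

-- Prime powers in factorials, bounds for n!, and Chebyshev's bound for the primorial.

module Factorials where

  open import Data.Nat.Induction using (<-rec)
  open import Data.Nat.Combinatorics using (k![n∸k]!∣n!)
  open SieveProfile using (*-cancelˡ-≤′; split-≤; primorial-prime; primorial-nonprime)
  open ProfileTable using (≤ᵇ-sound)
  open Rough
  open Pow32 using (*-^)

  !>0 : ∀ n → 0 < n !
  !>0 n = n≢0⇒n>0 (≢-nonZero⁻¹ (n !) {{n !≢0}})

  -- One round of Legendre's formula: the q multiples of p contribute p^q q!, and u collects the
  -- factors prime to p.
  legendre : ∀ {p} → Prime p → ∀ N → ∃ λ q → ∃ λ r → ∃ λ u → N ≡ r + q * p × r < p × N ! ≡ p ^ q * q ! * u × ¬ p ∣ u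
  legendre {p} pp zero = 0 , 0 , 1 , refl , prime>0 pp , refl , prime∤1 pp
  legendre {p} pp (suc N) with legendre pp N
  ... | q , r , u , eq , r<p , eq! , ∤u with m≤n⇒m<n∨m≡n r<p
  ...   | inj₁ 1+r<p = q , suc r , u * suc N , cong suc eq , 1+r<p , trans (cong (suc N *_) eq!) (ring (suc N) (p ^ q * q !) u) , ∤
    where
    ring : ∀ n x u → n * (x * u) ≡ x * (u * n)
    ring = solve-∀
    ∤ : ¬ p ∣ u * suc N
    ∤ d with euclidsLemma u (suc N) pp d
    ... | inj₁ d′ = ∤u d′
    ... | inj₂ d′ = <⇒≱ 1+r<p (∣⇒≤ (∣m+n∣m⇒∣n (subst (p ∣_) (trans (cong suc eq) (+-comm (suc r) (q * p))) d′) (n∣m*n q)))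
  ...   | inj₂ refl = suc q , 0 , u , cong suc eq , s≤s z≤n , trans (cong₂ _*_ (cong suc eq) eq!) (ring p q (p ^ q) (q !) u) , ∤u
    where
    ring : ∀ p q x y u → (p + q * p) * (x * y * u) ≡ p * x * (y + q * y) * u
    ring = solve-∀

  quotient-power∣! : ∀ p .{{_ : NonZero p}} q → p ^ q * q ! ∣ (q * p) !
  quotient-power∣! p zero = ∣-refl
  quotient-power∣! p@(suc p′) (suc q) = ∣-trans (subst (_∣ (suc q * p) * (q * p) !) (ring p (suc q) (p ^ q) (q !)) (*-monoʳ-∣ (suc q * p) (quotient-power∣! p q)))
      (*-monoʳ-∣ (suc q * p) (m≤n⇒m!∣n! (m≤n+m (q * p) p′)))
    where
    ring : ∀ p q x y → q * p * (x * y) ≡ p * x * (q * y)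
    ring = solve-∀

  -- The exponent of p in N! is q plus its exponent in q!, where q is the integer part of N / p;
  -- inductively, (p - 1) times it is below q (p - 1) + q = q p ≤ N.
  legendre-bound : ∀ {p} → Prime p → ∀ N e → 0 < N → p ^ e ∣ N ! → e * (p ∸ 1) < N
  legendre-bound {p} pp = <-rec _ go
    where
    open ≤-Reasoning
    go : ∀ N → (∀ {M} → M < N → ∀ e → 0 < M → p ^ e ∣ M ! → e * (p ∸ 1) < M) → ∀ e → 0 < N → p ^ e ∣ N ! → e * (p ∸ 1) < N
    go N ih e 0<N d with legendre pp N
    ... | q , r , u , eq , r<p , eq! , ∤u = conclude q eq d′ (≤-total e q)
      where
      d′ : p ^ e ∣ p ^ q * q !
      d′ = prime^∣-cancel pp ∤u e _ (subst (p ^ e ∣_) eq! d)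
      qp≤N : ∀ q → N ≡ r + q * p → q * p ≤ N
      qp≤N q eq = subst (q * p ≤_) (sym eq) (m≤n+m (q * p) r)
      q<qp : ∀ q → 0 < q → q * (p ∸ 1) < q * p
      q<qp q@(suc _) _ = *-monoʳ-< q (∸-monoʳ-< {p} (s≤s z≤n) (prime>0 pp))
      conclude : ∀ q → N ≡ r + q * p → p ^ e ∣ p ^ q * q ! → e ≤ q ⊎ q ≤ e → e * (p ∸ 1) < N
      conclude zero eq d (inj₁ e≤0) = subst (λ e → e * (p ∸ 1) < N) (sym (n≤0⇒n≡0 e≤0)) 0<N
      conclude q@(suc _) eq d (inj₁ e≤q) = ≤-<-trans (*-monoˡ-≤ (p ∸ 1) e≤q) (<-≤-trans (q<qp q (s≤s z≤n)) (qp≤N q eq))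
      conclude q eq d (inj₂ q≤e) with split-≤ q≤e
      ... | zero , refl = conclude′ q eq
        where
        conclude′ : ∀ q → N ≡ r + q * p → (q + 0) * (p ∸ 1) < N
        conclude′ zero eq = 0<N
        conclude′ q@(suc _) eq = subst (λ e → e * (p ∸ 1) < N) (sym (+-identityʳ q)) (<-≤-trans (q<qp q (s≤s z≤n)) (qp≤N q eq))
      ... | suc f , refl = conclude′ q eq p^f∣
        where
        p^f∣ : p ^ suc f ∣ q !
        p^f∣ = *-cancelˡ-∣ (p ^ q) {{m^n≢0 p q {{prime⇒nonZero pp}}}} (subst (_∣ p ^ q * q !) (^-distribˡ-+-* p q (suc f)) d)
        conclude′ : ∀ q → N ≡ r + q * p → p ^ suc f ∣ q ! → (q + suc f) * (p ∸ 1) < N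
        conclude′ zero eq d′ = ⊥-elim (prime∤1 pp (∣-trans (m∣m*n (p ^ f)) d′))
        conclude′ q@(suc q′) eq d′ = begin-strict
          (q + suc f) * (p ∸ 1) ≡⟨ *-distribʳ-+ (p ∸ 1) q (suc f) ⟩
          q * (p ∸ 1) + suc f * (p ∸ 1) <⟨ +-monoʳ-< (q * (p ∸ 1)) (ih {q} (<-≤-trans (m<m*n q p (prime>1 pp)) (qp≤N q eq)) (suc f) (s≤s z≤n) d′) ⟩
          q * (p ∸ 1) + q ≡⟨ trans (+-comm _ q) (sym (*-suc q (p ∸ 1))) ⟩
          q * suc (p ∸ 1) ≡⟨ cong (q *_) (m+[n∸m]≡n (prime>0 pp)) ⟩
          q * p ≤⟨ qp≤N q eq ⟩
          N ∎

  bernoulli′ : ∀ a x n → a ^ n * (a + n * x) ≤ (a + x) ^ n * a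
  bernoulli′ a x zero = ≤-reflexive (cong (λ t → t + 0) (+-identityʳ a))
  bernoulli′ a x (suc n) = begin
    a * a ^ n * (a + suc n * x) ≡⟨ e₁ a (a ^ n) n x ⟩
    a ^ n * (a * (a + suc n * x)) ≤⟨ *-monoʳ-≤ (a ^ n) (≤-trans (m≤m+n _ (n * x * x)) (≤-reflexive (e₂ a n x))) ⟩
    a ^ n * ((a + n * x) * (a + x)) ≡⟨ *-assoc (a ^ n) _ _ ⟨
    a ^ n * (a + n * x) * (a + x) ≤⟨ *-monoˡ-≤ (a + x) (bernoulli′ a x n) ⟩
    (a + x) ^ n * a * (a + x) ≡⟨ e₃ ((a + x) ^ n) a (a + x) ⟩
    (a + x) * (a + x) ^ n * a ∎
    where
    open ≤-Reasoning
    e₁ : ∀ a t n x → a * t * (a + suc n * x) ≡ t * (a * (a + suc n * x))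
    e₁ = solve-∀
    e₂ : ∀ a n x → a * (a + suc n * x) + n * x * x ≡ (a + n * x) * (a + x)
    e₂ = solve-∀
    e₃ : ∀ t a b → t * a * b ≡ b * t * a
    e₃ = solve-∀

  -- Bernoulli's inequality for (1 - 1/(a + 1))ⁿ, with the subtracted term moved to the right.
  bernoulli-neg : ∀ a n → suc a ^ n * suc a ≤ a ^ n * suc a + n * suc a ^ n
  bernoulli-neg a zero = m≤m+n _ _
  bernoulli-neg a (suc n) = +-cancelʳ-≤ (n * suc a ^ n * a) _ _ (begin
    suc a * suc a ^ n * suc a + n * suc a ^ n * a ≡⟨ e₁ a (suc a ^ n) n ⟩
    suc a ^ n * suc a * a + suc a * suc a ^ n + n * suc a ^ n * a ≤⟨ +-monoˡ-≤ (n * suc a ^ n * a) (+-monoˡ-≤ (suc a * suc a ^ n) (*-monoˡ-≤ a (bernoulli-neg a n))) ⟩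
    (a ^ n * suc a + n * suc a ^ n) * a + suc a * suc a ^ n + n * suc a ^ n * a ≤⟨ m≤m+n _ (n * suc a ^ n) ⟩
    (a ^ n * suc a + n * suc a ^ n) * a + suc a * suc a ^ n + n * suc a ^ n * a + n * suc a ^ n ≡⟨ e₂ a (a ^ n) (suc a ^ n) n ⟩
    a * a ^ n * suc a + suc n * (suc a * suc a ^ n) + n * suc a ^ n * a ∎)
    where
    open ≤-Reasoning
    e₁ : ∀ a t n → suc a * t * suc a + n * t * a ≡ t * suc a * a + suc a * t + n * t * a
    e₁ = solve-∀
    e₂ : ∀ a x t n → (x * suc a + n * t) * a + suc a * t + n * t * a + n * t ≡ a * x * suc a + suc n * (suc a * t) + n * t * a
    e₂ = solve-∀

  ^-double : ∀ x n → x ^ n * x ^ n ≡ (x * x) ^ n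
  ^-double x n = sym (*-^ x x n)

  -- Comparing neighbouring terms produces powers of n (n + 2) / (n + 1)² = 1 - 1/(n + 1)², written
  -- K / (K + 1), to which Bernoulli's inequality applies.
  module Euler (n : ℕ) (0<n : 0 < n) where
    open ≤-Reasoning
    private
      M = suc n
      K = n * suc M

      M²≡1+K : M * M ≡ suc K
      M²≡1+K = e n
        where
        e : ∀ n → suc n * suc n ≡ suc (n * suc (suc n))
        e = solve-∀

      lower : n * (M * M) ^ M ≤ K ^ M * M
      lower = *-cancelˡ-≤ M (+-cancelʳ-≤ (M * suc K ^ M) _ _ (begin
        M * (n * (M * M) ^ M) + M * suc K ^ M ≡⟨ cong (λ t → M * (n * t ^ M) + M * suc K ^ M) M²≡1+K ⟩
        M * (n * suc K ^ M) + M * suc K ^ M ≡⟨ e₁ n (suc K ^ M) ⟩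
        suc K ^ M * (M * M) ≡⟨ cong (suc K ^ M *_) M²≡1+K ⟩
        suc K ^ M * suc K ≤⟨ bernoulli-neg K M ⟩
        K ^ M * suc K + M * suc K ^ M ≡⟨ cong (λ t → K ^ M * t + M * suc K ^ M) M²≡1+K ⟨
        K ^ M * (M * M) + M * suc K ^ M ≡⟨ cong (_+ M * suc K ^ M) (e₂ (K ^ M) M) ⟩
        M * (K ^ M * M) + M * suc K ^ M ∎))
        where
        e₁ : ∀ n t → suc n * (n * t) + suc n * t ≡ t * (suc n * suc n)
        e₁ = solve-∀
        e₂ : ∀ x m → x * (m * m) ≡ m * (x * m)
        e₂ = solve-∀

      upper : K ^ M * suc M ≤ (M * M) ^ M * M
      upper = *-cancelˡ-≤′ K (*-mono-≤ 0<n (s≤s (z≤n {M}))) (begin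
        K * (K ^ M * suc M) ≡⟨ e₁ K (K ^ M) M ⟩
        K ^ M * (K * M + K) ≤⟨ *-monoʳ-≤ (K ^ M) (+-monoʳ-≤ (K * M) (≤-trans (n≤1+n K) (≤-reflexive (sym M²≡1+K)))) ⟩
        K ^ M * (K * M + M * M) ≡⟨ e₂ (K ^ M) K M ⟩
        K ^ M * (K + M * 1) * M ≤⟨ *-monoˡ-≤ M (bernoulli′ K 1 M) ⟩
        (K + 1) ^ M * K * M ≡⟨ cong (λ t → t ^ M * K * M) (trans (+-comm K 1) (sym M²≡1+K)) ⟩
        (M * M) ^ M * K * M ≡⟨ e₃ ((M * M) ^ M) K M ⟩
        K * ((M * M) ^ M * M) ∎)
        where
        e₁ : ∀ K x M → K * (x * suc M) ≡ x * (K * M + K)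
        e₁ = solve-∀
        e₂ : ∀ x K M → x * (K * M + M * M) ≡ x * (K + M * 1) * M
        e₂ = solve-∀
        e₃ : ∀ x K M → x * K * M ≡ K * (x * M)
        e₃ = solve-∀

    -- (1 + 1/n)ⁿ increases and (1 + 1/n)ⁿ⁺¹ decreases.
    increasing : M ^ n * M ^ M ≤ suc M ^ M * n ^ n
    increasing = *-cancelˡ-≤′ n 0<n (*-cancelˡ-≤ M (begin
      M * (n * (M ^ n * M ^ M)) ≡⟨ e₁ n M (M ^ n) ⟩
      n * (M ^ M * M ^ M) ≡⟨ cong (n *_) (^-double M M) ⟩
      n * (M * M) ^ M ≤⟨ lower ⟩
      K ^ M * M ≡⟨ cong (_* M) (*-^ n (suc M) M) ⟩
      n * n ^ n * suc M ^ M * M ≡⟨ e₃ n (n ^ n) (suc M ^ M) M ⟩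
      M * (n * (suc M ^ M * n ^ n)) ∎))
      where
      e₁ : ∀ n M t → M * (n * (t * (M * t))) ≡ n * (M * t * (M * t))
      e₁ = solve-∀
      e₃ : ∀ n x y M → n * x * y * M ≡ M * (n * (y * x))
      e₃ = solve-∀

    decreasing : suc M ^ suc M * n ^ M ≤ M ^ M * M ^ suc M
    decreasing = begin
      suc M * suc M ^ M * n ^ M ≡⟨ e₁ (suc M) (suc M ^ M) (n ^ M) ⟩
      n ^ M * suc M ^ M * suc M ≡⟨ cong (_* suc M) (*-^ n (suc M) M) ⟨
      K ^ M * suc M ≤⟨ upper ⟩
      (M * M) ^ M * M ≡⟨ cong (_* M) (^-double M M) ⟨
      M ^ M * M ^ M * M ≡⟨ e₂ (M ^ M) M ⟩
      M ^ M * (M * M ^ M) ∎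
      where
      e₁ : ∀ a b c → a * b * c ≡ c * b * a
      e₁ = solve-∀
      e₂ : ∀ x M → x * x * M ≡ x * (M * x)
      e₂ = solve-∀

  from : ∀ {P : ℕ → Set} a → P a → (∀ n → a ≤ n → P n → P (suc n)) → ∀ n → a ≤ n → P n
  from {P} a base step n a≤n = subst P (m∸n+n≡m a≤n) (go (n ∸ a))
    where
    go : ∀ t → P (t + a)
    go zero = base
    go (suc t) = step (t + a) (m≤n+m a t) (go t)

  module _ where
    open ≤-Reasoning

    opaque
      base-e : 8 * 300 ^ 300 ≤ 3 * 301 ^ 300 × 4 * 301 ^ 301 ≤ 11 * 300 ^ 301
      base-e = ≤ᵇ-sound _ _ refl , ≤ᵇ-sound _ _ refl

      -- Stirling's factor √(2πn) is absorbed by (3e/8)ⁿ only for n large enough; 300 is beyond that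
      -- point. The ratios 8/3 and 11/4 enclose e.
      base-! : 300 ! * 8 ^ 300 ≤ (3 * 300) ^ 300 × (4 * 300) ^ 300 ≤ 300 ! * 11 ^ 300
      base-! = ≤ᵇ-sound _ _ refl , ≤ᵇ-sound _ _ refl

    private
      >0 : ∀ {n} → 300 ≤ n → 0 < n
      >0 = ≤-trans (s≤s z≤n)

    e-lower : ∀ n → 300 ≤ n → 8 * n ^ n ≤ 3 * suc n ^ n
    e-lower = from {P} 300 (proj₁ base-e) step
      where
      P : ℕ → Set
      P n = 8 * n ^ n ≤ 3 * suc n ^ n
      step : ∀ n → 300 ≤ n → P n → P (suc n)
      step n 300≤n h = *-cancelˡ-≤′ (suc n ^ n) (m^n>0 (suc n) n) (begin
        suc n ^ n * (8 * suc n ^ suc n) ≡⟨ e₁ (suc n ^ n) 8 (suc n ^ suc n) ⟩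
        8 * (suc n ^ n * suc n ^ suc n) ≤⟨ *-monoʳ-≤ 8 (Euler.increasing n (>0 300≤n)) ⟩
        8 * (suc (suc n) ^ suc n * n ^ n) ≡⟨ e₁ 8 (suc (suc n) ^ suc n) (n ^ n) ⟩
        suc (suc n) ^ suc n * (8 * n ^ n) ≤⟨ *-monoʳ-≤ (suc (suc n) ^ suc n) h ⟩
        suc (suc n) ^ suc n * (3 * suc n ^ n) ≡⟨ e₂ (suc (suc n) ^ suc n) 3 (suc n ^ n) ⟩
        suc n ^ n * (3 * suc (suc n) ^ suc n) ∎)
        where
        e₁ : ∀ a b c → a * (b * c) ≡ b * (a * c)
        e₁ = solve-∀
        e₂ : ∀ a b c → a * (b * c) ≡ c * (b * a)
        e₂ = solve-∀

    e-upper : ∀ n → 300 ≤ n → 4 * suc n ^ suc n ≤ 11 * n ^ suc n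
    e-upper = from {P} 300 (proj₂ base-e) step
      where
      P : ℕ → Set
      P n = 4 * suc n ^ suc n ≤ 11 * n ^ suc n
      step : ∀ n → 300 ≤ n → P n → P (suc n)
      step n 300≤n h = *-cancelˡ-≤′ (n ^ suc n) (m^n>0 n {{>-nonZero (>0 300≤n)}} (suc n)) (begin
        n ^ suc n * (4 * suc (suc n) ^ suc (suc n)) ≡⟨ e₂ (n ^ suc n) 4 (suc (suc n) ^ suc (suc n)) ⟩
        4 * (suc (suc n) ^ suc (suc n) * n ^ suc n) ≤⟨ *-monoʳ-≤ 4 (Euler.decreasing n (>0 300≤n)) ⟩
        4 * (suc n ^ suc n * suc n ^ suc (suc n)) ≡⟨ e₁ 4 (suc n ^ suc n) (suc n ^ suc (suc n)) ⟩
        4 * suc n ^ suc n * suc n ^ suc (suc n) ≤⟨ *-monoˡ-≤ (suc n ^ suc (suc n)) h ⟩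
        11 * n ^ suc n * suc n ^ suc (suc n) ≡⟨ e₃ 11 (n ^ suc n) (suc n ^ suc (suc n)) ⟩
        n ^ suc n * (11 * suc n ^ suc (suc n)) ∎)
        where
        e₁ : ∀ a b c → a * (b * c) ≡ a * b * c
        e₁ = solve-∀
        e₂ : ∀ a b c → a * (b * c) ≡ b * (c * a)
        e₂ = solve-∀
        e₃ : ∀ a b c → a * b * c ≡ b * (a * c)
        e₃ = solve-∀

    !-upper : ∀ n → 300 ≤ n → n ! * 8 ^ n ≤ (3 * n) ^ n
    !-upper = from {P} 300 (proj₁ base-!) step
      where
      P : ℕ → Set
      P n = n ! * 8 ^ n ≤ (3 * n) ^ n
      step : ∀ n → 300 ≤ n → P n → P (suc n)
      step n 300≤n h = begin
        suc n * n ! * (8 * 8 ^ n) ≡⟨ e₁ (suc n) (n !) 8 (8 ^ n) ⟩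
        suc n * 8 * (n ! * 8 ^ n) ≤⟨ *-monoʳ-≤ (suc n * 8) h ⟩
        suc n * 8 * (3 * n) ^ n ≡⟨ cong (suc n * 8 *_) (*-^ 3 n n) ⟩
        suc n * 8 * (3 ^ n * n ^ n) ≡⟨ e₂ (suc n) 8 (3 ^ n) (n ^ n) ⟩
        suc n * 3 ^ n * (8 * n ^ n) ≤⟨ *-monoʳ-≤ (suc n * 3 ^ n) (e-lower n 300≤n) ⟩
        suc n * 3 ^ n * (3 * suc n ^ n) ≡⟨ e₃ (suc n) (3 ^ n) 3 (suc n ^ n) ⟩
        3 * suc n * (3 ^ n * suc n ^ n) ≡⟨ cong (3 * suc n *_) (*-^ 3 (suc n) n) ⟨
        (3 * suc n) ^ suc n ∎
        where
        e₁ : ∀ a b c d → a * b * (c * d) ≡ a * c * (b * d)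
        e₁ = solve-∀
        e₂ : ∀ a b c d → a * b * (c * d) ≡ a * c * (b * d)
        e₂ = solve-∀
        e₃ : ∀ a b c d → a * b * (c * d) ≡ c * a * (b * d)
        e₃ = solve-∀

    !-lower : ∀ n → 300 ≤ n → (4 * n) ^ n ≤ n ! * 11 ^ n
    !-lower = from {P} 300 (proj₂ base-!) step
      where
      P : ℕ → Set
      P n = (4 * n) ^ n ≤ n ! * 11 ^ n
      weaken : ∀ n → 300 ≤ n → 4 * suc n ^ n ≤ 11 * n ^ n
      weaken n 300≤n = *-cancelˡ-≤′ (suc n) (s≤s z≤n) (begin
        suc n * (4 * suc n ^ n) ≡⟨ e (suc n) 4 (suc n ^ n) ⟩
        4 * suc n ^ suc n ≤⟨ e-upper n 300≤n ⟩
        11 * n ^ suc n ≤⟨ *-monoʳ-≤ 11 (*-monoˡ-≤ (n ^ n) (n≤1+n n)) ⟩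
        11 * (suc n * n ^ n) ≡⟨ e (suc n) 11 (n ^ n) ⟨
        suc n * (11 * n ^ n) ∎)
        where
        e : ∀ a b c → a * (b * c) ≡ b * (a * c)
        e = solve-∀
      step : ∀ n → 300 ≤ n → P n → P (suc n)
      step n 300≤n h = begin
        4 * suc n * (4 * suc n) ^ n ≡⟨ cong (4 * suc n *_) (*-^ 4 (suc n) n) ⟩
        4 * suc n * (4 ^ n * suc n ^ n) ≡⟨ e₃ (suc n) (4 ^ n) 4 (suc n ^ n) ⟨
        suc n * 4 ^ n * (4 * suc n ^ n) ≤⟨ *-monoʳ-≤ (suc n * 4 ^ n) (weaken n 300≤n) ⟩
        suc n * 4 ^ n * (11 * n ^ n) ≡⟨ e₁ (suc n) (4 ^ n) 11 (n ^ n) ⟩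
        suc n * 11 * (4 ^ n * n ^ n) ≡⟨ cong (suc n * 11 *_) (*-^ 4 n n) ⟨
        suc n * 11 * (4 * n) ^ n ≤⟨ *-monoʳ-≤ (suc n * 11) h ⟩
        suc n * 11 * (n ! * 11 ^ n) ≡⟨ e₁ (suc n) 11 (n !) (11 ^ n) ⟩
        suc n * n ! * (11 * 11 ^ n) ∎
        where
        e₁ : ∀ a b c d → a * b * (c * d) ≡ a * c * (b * d)
        e₁ = solve-∀
        e₃ : ∀ a b c d → a * b * (c * d) ≡ c * a * (b * d)
        e₃ = solve-∀

    -- This bounds the binomial coefficient of 2 m + 1 over m by 4^m, half the sum of its row.
    central : ∀ m → (m + suc m) ! ≤ 4 ^ m * (m ! * suc m !)
    central zero = ≤-refl
    central (suc m) = begin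
      (suc m + suc (suc m)) ! ≡⟨ cong _! (cong suc (+-suc m (suc m))) ⟩
      suc (suc (m + suc m)) * (suc (m + suc m) * (m + suc m) !) ≡⟨ e₁ (m + suc m) m ((m + suc m) !) refl ⟩
      2 * (m + suc (suc (suc m))) * suc m * (m + suc m) ! ≤⟨ *-mono-≤ (*-monoˡ-≤ (suc m) (m≤m+n (2 * (m + suc (suc (suc m)))) 2)) (central m) ⟩
      (2 * (m + suc (suc (suc m))) + 2) * suc m * (4 ^ m * (m ! * suc m !)) ≡⟨ e₃ m (4 ^ m) (m !) (suc m !) ⟩
      4 * 4 ^ m * ((suc m * m !) * (suc (suc m) * suc m !)) ∎
      where
      e₁ : ∀ t m x → t ≡ m + suc m → suc (suc t) * (suc t * x) ≡ 2 * (m + suc (suc (suc m))) * suc m * x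
      e₁ t m x refl = e m x
        where
        e : ∀ m x → suc (suc (m + suc m)) * (suc (m + suc m) * x) ≡ 2 * (m + suc (suc (suc m))) * suc m * x
        e = solve-∀
      e₃ : ∀ m f x y → (2 * (m + suc (suc (suc m))) + 2) * suc m * (f * (x * y)) ≡ 4 * f * ((suc m * x) * (suc (suc m) * y))
      e₃ = solve-∀

  private
    -- The primes of (m + 1, 2 m + 1] divide (2 m + 1)! / (m! (m + 1)!).
    middle : ∀ m t → t ≤ m → ∃ λ Q → primorial (t + suc m) ≡ primorial (suc m) * Q × m ! * suc m ! * Q ∣ (m + suc m) !
    middle m zero _ = 1 , sym (*-identityʳ _) , subst (_∣ (m + suc m) !) (trans (cong (λ k → m ! * k !) (m+n∸m≡n m (suc m))) (sym (*-identityʳ _))) (k![n∸k]!∣n! {m + suc m} {m} (m≤m+n m (suc m)))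
    middle m (suc t) t<m with middle m t (<⇒≤ t<m) | decPrime (suc (t + suc m))
    ... | Q , eq , div | no ¬p = Q , trans (primorial-nonprime ¬p) eq , div
    ... | Q , eq , div | yes pp = Q * p , trans (primorial-prime pp) (trans (cong (p *_) eq) (e p (primorial (suc m)) Q)) ,
            subst (_∣ (m + suc m) !) (trans (cong (F * Q *_) (^-identityʳ p)) (*-assoc F Q p)) (coprime-product-∣ pp ∤FQ 1 div (subst (_∣ (m + suc m) !) (sym (^-identityʳ p)) p∣!))
      where
      p = suc (t + suc m)
      F = m ! * suc m !
      e : ∀ p a q → p * (a * q) ≡ a * (q * p)
      e = solve-∀
      1+m<p : suc m < p
      1+m<p = s≤s (m≤n+m (suc m) t)
      p∣! : p ∣ (m + suc m) !
      p∣! = ∣-trans (m∣m*n ((t + suc m) !)) (m≤n⇒m!∣n! (+-monoˡ-≤ (suc m) t<m))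
      ∤FQ : ¬ p ∣ F * Q
      ∤FQ d with euclidsLemma F Q pp d
      ... | inj₂ d′ = <⇒≱ ≤-refl (prime∣primorial⇒≤ (t + suc m) pp (subst (p ∣_) (sym eq) (∣n⇒∣m*n (primorial (suc m)) d′)))
      ... | inj₁ d′ with euclidsLemma (m !) (suc m !) pp d′
      ...   | inj₁ d″ = <⇒≱ (<-trans (n<1+n m) 1+m<p) (prime∣!⇒≤ m pp d″)
      ...   | inj₂ d″ = <⇒≱ 1+m<p (prime∣!⇒≤ (suc m) pp d″)

  -- Erdős's argument: for n = 2 m + 1 the primes above m + 1 divide a binomial coefficient of size
  -- at most 4^m, and the induction hypothesis handles the others; an even n > 2 adds no prime.
  primorial≤4^ : ∀ n → primorial n ≤ 4 ^ n
  primorial≤4^ = <-rec _ go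
    where
    open ≤-Reasoning
    halve : ∀ n → ∃ λ m → n ≡ m + m ⊎ n ≡ m + suc m
    halve zero = 0 , inj₁ refl
    halve (suc n) with halve n
    ... | m , inj₁ refl = m , inj₂ (sym (+-suc m m))
    ... | m , inj₂ refl = suc m , inj₁ refl
    2∣double : ∀ m → 2 ∣ m + m
    2∣double m = divides m (trans (cong (m +_) (sym (+-identityʳ m))) (*-comm 2 m))
    not-prime : ∀ m → ¬ Prime (suc (suc m) + suc (suc m))
    not-prime m pp with prime⇒irreducible pp (2∣double (suc (suc m)))
      where open import Data.Nat.Primality using (prime⇒irreducible)
    ... | inj₂ eq = <⇒≢ (≤ᵇ-sound 3 4 refl) (trans eq′ refl)
      where
      eq′ : 2 ≡ 4
      eq′ = ⊥-elim (<⇒≢ (s≤s (s≤s (≤-trans (s≤s z≤n) (m≤n+m (suc (suc m)) m)))) eq)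
    go : ∀ n → (∀ {k} → k < n → primorial k ≤ 4 ^ k) → primorial n ≤ 4 ^ n
    go n ih with halve n
    ... | zero , inj₁ refl = ≤-refl
    ... | suc zero , inj₁ refl = ≤ᵇ-sound 2 16 refl
    ... | suc (suc m) , inj₁ refl = ≤-trans (≤-reflexive (primorial-nonprime (not-prime m))) (≤-trans (ih ≤-refl) (^-monoʳ-≤ 4 (n≤1+n (suc m + suc (suc m)))))
    ... | zero , inj₂ refl = ≤ᵇ-sound 1 4 refl
    ... | suc m′ , inj₂ refl with middle (suc m′) (suc m′) ≤-refl
    ...   | Q , eq , div = begin
        primorial (m + suc m) ≡⟨ eq ⟩
        primorial (suc m) * Q ≤⟨ *-mono-≤ (ih (s≤s (m≤n+m (suc (suc m′)) m′))) Q≤ ⟩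
        4 ^ suc m * 4 ^ m ≡⟨ ^-distribˡ-+-* 4 (suc m) m ⟨
        4 ^ (suc m + m) ≡⟨ cong (4 ^_) (sym (+-suc m m)) ⟩
        4 ^ (m + suc m) ∎
      where
      m = suc m′
      F = m ! * suc m !
      Q≤ : Q ≤ 4 ^ m
      Q≤ = *-cancelˡ-≤′ F (*-mono-≤ (!>0 m) (!>0 (suc m))) (begin
        F * Q ≤⟨ ∣⇒≤ {{(m + suc m) !≢0}} div ⟩
        (m + suc m) ! ≤⟨ central m ⟩
        4 ^ m * F ≡⟨ *-comm (4 ^ m) F ⟩
        F * 4 ^ m ∎)

-- Mertens-type estimates for the sums of log p / (p - 1) and log p / p.

module Mertens where

  open SieveProfile
  open ProfileTable using (≤ᵇ-sound)
  open Pow32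
  open Rough
  open Logs
  open Factorials

  -- upperSum n / totientProduct n = Σ_{p ≤ n} weight p / (p − 1)
  upperSum : ℕ → ℕ
  upperSum zero = 0
  upperSum (suc n) with prime? (suc n)
  ... | yes _ = n * upperSum n + weight (suc n) * totientProduct n
  ... | no _ = upperSum n

  -- The prime 2 is left out of the sum: its exponent in N! is nearly N, far more than the N / 2
  -- that the sum would credit, and `two-part` exploits this separately.
  oddLg : ℕ → ℕ
  oddLg n = if n <ᵇ 3 then 0 else lg n

  -- lowerSum n / primorial n = Σ_{2 < p ≤ n} lg p / p
  lowerSum : ℕ → ℕ
  lowerSum zero = 0
  lowerSum (suc n) with prime? (suc n)
  ... | yes _ = suc n * lowerSum n + oddLg (suc n) * primorial n
  ... | no _ = lowerSum n

  module _ {n : ℕ} where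
    upperSum-prime : Prime (suc n) → upperSum (suc n) ≡ n * upperSum n + weight (suc n) * totientProduct n
    upperSum-prime p with prime? (suc n)
    ... | yes _ = refl
    ... | no ¬p = ⊥-elim (¬p p)

    upperSum-nonprime : ¬ Prime (suc n) → upperSum (suc n) ≡ upperSum n
    upperSum-nonprime ¬p with prime? (suc n)
    ... | yes p = ⊥-elim (¬p p)
    ... | no _ = refl

    lowerSum-prime : Prime (suc n) → lowerSum (suc n) ≡ suc n * lowerSum n + oddLg (suc n) * primorial n
    lowerSum-prime p with prime? (suc n)
    ... | yes _ = refl
    ... | no ¬p = ⊥-elim (¬p p)

    lowerSum-nonprime : ¬ Prime (suc n) → lowerSum (suc n) ≡ lowerSum n
    lowerSum-nonprime ¬p with prime? (suc n)
    ... | yes p = ⊥-elim (¬p p)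
    ... | no _ = refl

    primeCount-prime : Prime (suc n) → primeCount (suc n) ≡ suc (primeCount n)
    primeCount-prime p with prime? (suc n)
    ... | yes _ = refl
    ... | no ¬p = ⊥-elim (¬p p)

    primeCount-nonprime : ¬ Prime (suc n) → primeCount (suc n) ≡ primeCount n
    primeCount-nonprime ¬p with prime? (suc n)
    ... | yes p = ⊥-elim (¬p p)
    ... | no _ = refl

  oddLg-large : ∀ {n} → 3 ≤ n → oddLg n ≡ lg n
  oddLg-large {n} 3≤n with n <ᵇ 3 in eq
  ... | false = refl
  ... | true = ⊥-elim (<⇒≱ (<ᵇ⇒< n 3 (subst T (sym eq) _)) 3≤n)

  pow32≤2^^ : ∀ p e → pow32 (p ^ e) ≤ 2 ^ (weight p * e)
  pow32≤2^^ p e = ≤-trans (≤-reflexive (pow32-pow p e)) (≤-trans (^-monoˡ-≤ e (weighted p)) (≤-reflexive (^-*-assoc 2 (weight p) e)))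

  2^^≤pow32 : ∀ p e → 0 < p → 2 ^ (lg p * e) ≤ pow32 (p ^ e)
  2^^≤pow32 p e 0<p = ≤-trans (≤-reflexive (sym (^-*-assoc 2 (lg p) e))) (≤-trans (^-monoˡ-≤ e (2^lg≤ 0<p)) (≤-reflexive (sym (pow32-pow p e))))

  module Upper (N : ℕ) (0<N : 0 < N) where
    open ≤-Reasoning

    -- R is what remains of N! once all primes up to z are removed, and E bounds the logarithm of
    -- the removed part, each p entering with exponent at most N / (p - 1).
    Factored : ℕ → Set
    Factored z = ∃ λ E → ∃ λ R → pow32 (N !) ≤ 2 ^ E * pow32 R × E * totientProduct z ≤ N * upperSum z × R ∣ N ! × Sieved z R

    factored : ∀ z → Factored z
    factored zero = 0 , N ! , ≤-reflexive (sym (+-identityʳ _)) , z≤n , ∣-refl , (λ p pp p≤0 → ⊥-elim (<⇒≱ (prime>0 pp) p≤0))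
    factored (suc z) with factored z | decPrime (suc z)
    ... | E , R , size , sum , div , sieved | no ¬p = E , R , size ,
            subst₂ (λ a b → E * a ≤ N * b) (sym (totient-nonprime ¬p)) (sym (upperSum-nonprime ¬p)) sum , div , sieved-suc sieved (⊥-elim ∘ ¬p)
    ... | E , R , size , sum , div , sieved | yes pp with exact-power pp R R ≤-refl R>0
      where
      R>0 : 0 < R
      R>0 = n≢0⇒n>0 λ { refl → <⇒≢ (!>0 N) (sym (0∣⇒≡0 div)) }
    ...   | e , R′ , refl , ∤R′ = E + w * e , R′ , size′ ,
            subst₂ (λ a b → (E + w * e) * a ≤ N * b) (sym (totient-prime pp)) (sym (upperSum-prime pp)) sum′ ,
            ∣-trans (n∣m*n (p ^ e)) div , sieved-suc (λ q qq q≤z d → sieved q qq q≤z (∣n⇒∣m*n (p ^ e) d)) (λ _ → ∤R′)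
      where
      p = suc z
      w = weight p
      F = totientProduct z
      size′ : pow32 (N !) ≤ 2 ^ (E + w * e) * pow32 R′
      size′ = begin
        pow32 (N !) ≤⟨ size ⟩
        2 ^ E * pow32 (p ^ e * R′) ≡⟨ cong (2 ^ E *_) (pow32-* (p ^ e) R′) ⟩
        2 ^ E * (pow32 (p ^ e) * pow32 R′) ≤⟨ *-monoʳ-≤ (2 ^ E) (*-monoˡ-≤ (pow32 R′) (pow32≤2^^ p e)) ⟩
        2 ^ E * (2 ^ (w * e) * pow32 R′) ≡⟨ *-assoc (2 ^ E) _ _ ⟨
        2 ^ E * 2 ^ (w * e) * pow32 R′ ≡⟨ cong (_* pow32 R′) (^-distribˡ-+-* 2 E (w * e)) ⟨
        2 ^ (E + w * e) * pow32 R′ ∎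
      ez≤N : e * z ≤ N
      ez≤N = <⇒≤ (legendre-bound pp N e 0<N (∣-trans (m∣m*n R′) div))
      sum′ : (E + w * e) * (z * F) ≤ N * (z * upperSum z + w * F)
      sum′ = begin
        (E + w * e) * (z * F) ≡⟨ e₁ E w e z F ⟩
        z * (E * F) + e * z * (w * F) ≤⟨ +-mono-≤ (*-monoʳ-≤ z sum) (*-monoˡ-≤ (w * F) ez≤N) ⟩
        z * (N * upperSum z) + N * (w * F) ≡⟨ e₂ z N (upperSum z) (w * F) ⟩
        N * (z * upperSum z + w * F) ∎
        where
        e₁ : ∀ E w e z F → (E + w * e) * (z * F) ≡ z * (E * F) + e * z * (w * F)
        e₁ = solve-∀
        e₂ : ∀ z N U t → z * (N * U) + N * t ≡ N * (z * U + t)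
        e₂ = solve-∀

    log-factorial : ∃ λ E → pow32 (N !) ≤ 2 ^ E × E * totientProduct N ≤ N * upperSum N
    log-factorial with factored N
    ... | E , R , size , sum , div , sieved = E , ≤-trans size (≤-reflexive (trans (cong (λ r → 2 ^ E * pow32 r) R≡1) (trans (cong (2 ^ E *_) pow32-1) (*-identityʳ (2 ^ E))))) , sum
      where
      R≡1 : R ≡ 1
      R≡1 with <-cmp R 1
      ... | tri≈ _ eq _ = eq
      ... | tri< R<1 _ _ = ⊥-elim (<⇒≢ (!>0 N) (sym (0∣⇒≡0 (subst (_∣ N !) (n<1⇒n≡0 R<1) div))))
      ... | tri> _ _ 1<R with prime-divisor 1<R
      ...   | p , pp , p∣R = ⊥-elim (sieved p pp (prime∣!⇒≤ N pp (∣-trans p∣R div)) p∣R)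

    private
      11^32 : pow32 11 ≤ 2 ^ 111
      11^32 = subst (_≤ 2 ^ 111) (sym (pow32-^ 11)) (≤ᵇ-sound (11 ^ 32) (2 ^ 111) refl)

    -- 47 = 111 - 64 stems from N! ≥ (4 N / 11)^N with 11³² ≤ 2¹¹¹ and 4³² = 2⁶⁴.
    lg-bound : 300 ≤ N → lg N * totientProduct N ≤ 47 * totientProduct N + upperSum N
    lg-bound 300≤N with log-factorial
    ... | E , size , sum = *-cancelˡ-≤′ N 0<N (begin
        N * (lg N * F) ≡⟨ *-assoc N (lg N) F ⟨
        N * lg N * F ≤⟨ *-monoˡ-≤ F exponents ⟩
        (N * 47 + E) * F ≡⟨ *-distribʳ-+ F (N * 47) E ⟩
        N * 47 * F + E * F ≤⟨ +-monoʳ-≤ (N * 47 * F) sum ⟩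
        N * 47 * F + N * upperSum N ≡⟨ e₀ N F (upperSum N) 47 ⟩
        N * (47 * F + upperSum N) ∎)
      where
      F = totientProduct N
      e₀ : ∀ N F U c → N * c * F + N * U ≡ N * (c * F + U)
      e₀ = solve-∀
      exponents : N * lg N ≤ N * 47 + E
      exponents = +-cancelˡ-≤ (64 * N) _ _ (≤-trans (2^-cancel-≤ {64 * N + N * lg N} {111 * N + E} (begin
        2 ^ (64 * N + N * lg N) ≡⟨ ^-distribˡ-+-* 2 (64 * N) (N * lg N) ⟩
        2 ^ (64 * N) * 2 ^ (N * lg N) ≡⟨ cong₂ _*_ (trans (sym (^-*-assoc 2 64 N)) (cong (_^ N) (sym (pow32-2^ 2)))) (trans (cong (2 ^_) (*-comm N (lg N))) (sym (^-*-assoc 2 (lg N) N))) ⟩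
        pow32 4 ^ N * (2 ^ lg N) ^ N ≤⟨ *-monoʳ-≤ (pow32 4 ^ N) (^-monoˡ-≤ N (2^lg≤ 0<N)) ⟩
        pow32 4 ^ N * pow32 N ^ N ≡⟨ *-^ (pow32 4) (pow32 N) N ⟨
        (pow32 4 * pow32 N) ^ N ≡⟨ cong (_^ N) (pow32-* 4 N) ⟨
        pow32 (4 * N) ^ N ≡⟨ pow32-pow (4 * N) N ⟨
        pow32 ((4 * N) ^ N) ≤⟨ pow32-mono (!-lower N 300≤N) ⟩
        pow32 (N ! * 11 ^ N) ≡⟨ trans (pow32-* (N !) (11 ^ N)) (cong (pow32 (N !) *_) (pow32-pow 11 N)) ⟩
        pow32 (N !) * pow32 11 ^ N ≤⟨ *-mono-≤ size (^-monoˡ-≤ N 11^32) ⟩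
        2 ^ E * (2 ^ 111) ^ N ≡⟨ trans (*-comm (2 ^ E) _) (cong (_* 2 ^ E) (^-*-assoc 2 111 N)) ⟩
        2 ^ (111 * N) * 2 ^ E ≡⟨ ^-distribˡ-+-* 2 (111 * N) E ⟨
        2 ^ (111 * N + E) ∎)) (≤-reflexive (e₁ N E)))
        where
        e₁ : ∀ N E → 111 * N + E ≡ 64 * N + (N * 47 + E)
        e₁ = solve-∀

  -- 49 = 47 + 2: one unit for the rounding in `weight`, one for the step from N to N + 1. This is
  -- exactly the condition for V (M + 49) not to increase at a prime N + 1.
  upper-window : ∀ N → 300 ≤ N → weight (suc N) * totientProduct N ≤ upperSum N + 49 * totientProduct N
  upper-window N 300≤N = begin
    weight (suc N) * F ≤⟨ *-monoˡ-≤ F (s≤s (lg-suc (≤-trans (≤ᵇ-sound 47 300 refl) 300≤N))) ⟩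
    (2 + lg N) * F ≡⟨ *-distribʳ-+ F 2 (lg N) ⟩
    2 * F + lg N * F ≤⟨ +-monoʳ-≤ (2 * F) (Upper.lg-bound N (≤-trans (s≤s z≤n) 300≤N) 300≤N) ⟩
    2 * F + (47 * F + upperSum N) ≡⟨ e F (upperSum N) ⟩
    upperSum N + 49 * F ∎
    where
    open ≤-Reasoning
    F = totientProduct N
    e : ∀ F U → 2 * F + (47 * F + U) ≡ U + 49 * F
    e = solve-∀

  module Lower (N : ℕ) (1<N : 1 < N) where
    open ≤-Reasoning

    private
      0<N : 0 < N
      0<N = <-trans (s≤s z≤n) 1<N

    -- After k halvings the exponent of 2 is known to be at least N - N / 2^k - k; k = 6 is used,
    -- which yields 63/64 of N.
    two-part : ∀ k → ∃ λ v → ∃ λ q → 2 ^ v * q ! ∣ N ! × N ≤ v + q + k × q * 2 ^ k ≤ N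
    two-part zero = 0 , N , subst (_∣ N !) (sym (+-identityʳ (N !))) ∣-refl , m≤m+n N 0 , ≤-reflexive (*-identityʳ N)
    two-part (suc k) with two-part k
    ... | v , q , div , big , small = v + h , h ,
            ∣-trans (subst (_∣ 2 ^ v * q !) (trans (sym (*-assoc (2 ^ v) (2 ^ h) (h !))) (cong (_* h !) (sym (^-distribˡ-+-* 2 v h)))) (*-monoʳ-∣ (2 ^ v) (∣-trans (quotient-power∣! 2 h) (m≤n⇒m!∣n! (m/n*n≤m q 2))))) div ,
            (begin
              N ≤⟨ big ⟩
              v + q + k ≤⟨ +-monoˡ-≤ k (+-monoʳ-≤ v (begin
                q ≡⟨ m≡m%n+[m/n]*n q 2 ⟩
                q % 2 + h * 2 ≤⟨ +-monoˡ-≤ (h * 2) (s≤s⁻¹ (m%n<n q 2)) ⟩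
                1 + h * 2 ∎)) ⟩
              v + (1 + h * 2) + k ≡⟨ e₁ v h k ⟩
              v + h + h + suc k ∎) ,
            (begin
              h * (2 * 2 ^ k) ≡⟨ *-assoc h 2 (2 ^ k) ⟨
              h * 2 * 2 ^ k ≤⟨ *-monoˡ-≤ (2 ^ k) (m/n*n≤m q 2) ⟩
              q * 2 ^ k ≤⟨ small ⟩
              N ∎)
      where
      h = q / 2
      e₁ : ∀ v h k → v + (1 + h * 2) + k ≡ v + h + h + suc k
      e₁ = solve-∀

    private
      finish : (∃ λ v → ∃ λ q → 2 ^ v * q ! ∣ N ! × N ≤ v + q + 6 × q * 64 ≤ N) → ∃ λ v → 2 ^ v ∣ N ! × 63 * N ≤ 64 * v + 384
      finish (v , q , div , big , small) = v , ∣-trans (m∣m*n (q !)) div , +-cancelʳ-≤ N _ _ (begin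
          63 * N + N ≡⟨ +-comm (63 * N) N ⟩
          64 * N ≤⟨ *-monoʳ-≤ 64 big ⟩
          64 * (v + q + 6) ≡⟨ e v q 64 6 ⟩
          64 * v + 384 + q * 64 ≤⟨ +-monoʳ-≤ (64 * v + 384) small ⟩
          64 * v + 384 + N ∎)
        where
        e : ∀ v q c d → c * (v + q + d) ≡ c * v + c * d + q * c
        e = solve-∀

    opaque
      powers-of-two : ∃ λ v → 2 ^ v ∣ N ! × 63 * N ≤ 64 * v + 384
      powers-of-two = finish (two-part 6)

    private
      v = proj₁ powers-of-two

    -- F is a divisor of N! made of 2^v and the powers of the odd p ≤ z with exponent the integer
    -- part of N / p. E bounds its logarithm from below, and τ accounts for the parts lost by
    -- rounding N / p down.
    record Product (z : ℕ) : Set where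
      field
        E τ F : ℕ
        divides-! : F ∣ N !
        smooth : ∀ p → Prime p → p ∣ F → p ≤ z
        size : 2 ^ E ≤ pow32 F
        slack : 2 ^ τ ≤ pow32 (primorial z)
        total : N * lowerSum z + 32 * v * primorial z ≤ (E + τ) * primorial z

    product : ∀ t → Product (t + 2)
    product zero = record
      { E = v * 32 ; τ = 0 ; F = 2 ^ v ; divides-! = proj₁ (proj₂ powers-of-two)
      ; smooth = smooth ; size = ≤-reflexive (sym (pow32-2^ v)) ; slack = pow32>0 (s≤s (z≤n {1}))
      ; total = ≤-reflexive (trans (cong (_+ 32 * v * 2) (*-zeroʳ N)) (e v)) }
      where
      e : ∀ v → 32 * v * 2 ≡ (v * 32 + 0) * 2
      e = solve-∀
      smooth : ∀ p → Prime p → p ∣ 2 ^ v → p ≤ 2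
      smooth p pp d with p ≟ 2
      ... | yes refl = ≤-refl
      ... | no p≢2 = ⊥-elim (prime∤^ pp prime[2] p≢2 v d)
    product (suc t) with decPrime (suc (t + 2))
    ... | no ¬p = record
      { E = E ; τ = τ ; F = F ; divides-! = divides-! ; smooth = λ p pp d → m≤n⇒m≤1+n (smooth p pp d) ; size = size
      ; slack = subst (λ P → 2 ^ τ ≤ pow32 P) (sym (primorial-nonprime ¬p)) slack
      ; total = subst₂ (λ A P → N * A + 32 * v * P ≤ (E + τ) * P) (sym (lowerSum-nonprime ¬p)) (sym (primorial-nonprime ¬p)) total }
      where open Product (product t)
    ... | yes pp = record
      { E = E + w * e ; τ = τ + w ; F = F * p ^ e
      ; divides-! = coprime-product-∣ pp (λ d → <⇒≱ (n<1+n (t + 2)) (smooth p pp d)) e divides-! p^e∣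
      ; smooth = smooth′
      ; size = (begin
          2 ^ (E + w * e) ≡⟨ ^-distribˡ-+-* 2 E (w * e) ⟩
          2 ^ E * 2 ^ (w * e) ≤⟨ *-mono-≤ size (2^^≤pow32 p e (s≤s z≤n)) ⟩
          pow32 F * pow32 (p ^ e) ≡⟨ pow32-* F (p ^ e) ⟨
          pow32 (F * p ^ e) ∎)
      ; slack = (begin
          2 ^ (τ + w) ≡⟨ ^-distribˡ-+-* 2 τ w ⟩
          2 ^ τ * 2 ^ w ≤⟨ *-mono-≤ slack (2^lg≤ {p} (s≤s z≤n)) ⟩
          pow32 (primorial (t + 2)) * pow32 p ≡⟨ pow32-* (primorial (t + 2)) p ⟨
          pow32 (primorial (t + 2) * p) ≡⟨ cong pow32 (trans (*-comm (primorial (t + 2)) p) (sym (primorial-prime pp))) ⟩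
          pow32 (primorial p) ∎)
      ; total = subst₂ (λ A P → N * A + 32 * v * P ≤ (E + w * e + (τ + w)) * P)
          (sym (trans (lowerSum-prime pp) (cong (λ o → p * lowerSum (t + 2) + o * primorial (t + 2)) (oddLg-large (s≤s (m≤n+m 2 t)))))) (sym (primorial-prime pp)) total′ }
      where
      open Product (product t)
      p = suc (t + 2)
      P = primorial (t + 2)
      w = lg p
      e = N / p
      p^e∣ : p ^ e ∣ N !
      p^e∣ = ∣-trans (m∣m*n (e !)) (∣-trans (quotient-power∣! p e) (m≤n⇒m!∣n! (m/n*n≤m N p)))
      smooth′ : ∀ q → Prime q → q ∣ F * p ^ e → q ≤ p
      smooth′ q qq d with euclidsLemma F (p ^ e) qq d
      ... | inj₁ d′ = m≤n⇒m≤1+n (smooth q qq d′)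
      ... | inj₂ d′ with q ≟ p
      ...   | yes refl = ≤-refl
      ...   | no q≢p = ⊥-elim (prime∤^ qq pp q≢p e d′)
      N≤ : N ≤ (e + 1) * p
      N≤ = begin
        N ≡⟨ m≡m%n+[m/n]*n N p ⟩
        N % p + e * p ≤⟨ +-monoˡ-≤ (e * p) (<⇒≤ (m%n<n N p)) ⟩
        p + e * p ≡⟨ cong (_* p) (+-comm 1 e) ⟩
        (e + 1) * p ∎
      total′ : N * (p * lowerSum (t + 2) + w * P) + 32 * v * (p * P) ≤ (E + w * e + (τ + w)) * (p * P)
      total′ = begin
        N * (p * lowerSum (t + 2) + w * P) + 32 * v * (p * P) ≡⟨ e₁ N p (lowerSum (t + 2)) (w * P) (32 * v) P ⟩
        p * (N * lowerSum (t + 2) + 32 * v * P) + N * (w * P) ≤⟨ +-mono-≤ (*-monoʳ-≤ p total) (*-monoˡ-≤ (w * P) N≤) ⟩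
        p * ((E + τ) * P) + (e + 1) * p * (w * P) ≡⟨ e₂ p E τ P e w ⟩
        (E + w * e + (τ + w)) * (p * P) ∎
        where
        e₁ : ∀ N p A x y P → N * (p * A + x) + y * (p * P) ≡ p * (N * A + y * P) + N * x
        e₁ = solve-∀
        e₂ : ∀ p E τ P e w → p * ((E + τ) * P) + (e + 1) * p * (w * P) ≡ (E + w * e + (τ + w)) * (p * P)
        e₂ = solve-∀

    private
      3^32 : pow32 3 ≤ 2 ^ 51
      3^32 = subst (_≤ 2 ^ 51) (sym (pow32-^ 3)) (≤ᵇ-sound (3 ^ 32) (2 ^ 51) refl)

      at-N : Product N
      at-N = subst Product (m∸n+n≡m 1<N) (product (N ∸ 2))

    module _ (300≤N : 300 ≤ N) where
      open Product at-N

      -- 44 = 96 - 51 - 1, from N! ≤ (3 N / 8)^N with 8³² = 2⁹⁶ and 3³² ≤ 2⁵¹, and one unit for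
      -- rounding the logarithm of N.
      E-bound : E + 44 * N ≤ N * lg N
      E-bound = +-cancelʳ-≤ (52 * N) _ _ (≤-trans (≤-reflexive (e₁ E N)) (≤-trans (2^-cancel-≤ {E + 96 * N} {51 * N + weight N * N} (begin
        2 ^ (E + 96 * N) ≡⟨ ^-distribˡ-+-* 2 E (96 * N) ⟩
        2 ^ E * 2 ^ (96 * N) ≤⟨ *-mono-≤ (≤-trans size (pow32-mono (∣⇒≤ {{N !≢0}} divides-!))) (≤-reflexive (trans (sym (^-*-assoc 2 96 N)) (cong (_^ N) (sym (pow32-2^ 3))))) ⟩
        pow32 (N !) * pow32 8 ^ N ≡⟨ trans (cong (pow32 (N !) *_) (sym (pow32-pow 8 N))) (sym (pow32-* (N !) (8 ^ N))) ⟩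
        pow32 (N ! * 8 ^ N) ≤⟨ pow32-mono (!-upper N 300≤N) ⟩
        pow32 ((3 * N) ^ N) ≡⟨ trans (cong pow32 (*-^ 3 N N)) (pow32-* (3 ^ N) (N ^ N)) ⟩
        pow32 (3 ^ N) * pow32 (N ^ N) ≤⟨ *-mono-≤ (≤-trans (≤-reflexive (pow32-pow 3 N)) (≤-trans (^-monoˡ-≤ N 3^32) (≤-reflexive (^-*-assoc 2 51 N)))) (pow32≤2^^ N N) ⟩
        2 ^ (51 * N) * 2 ^ (weight N * N) ≡⟨ ^-distribˡ-+-* 2 (51 * N) (weight N * N) ⟨
        2 ^ (51 * N + weight N * N) ∎)) (≤-reflexive (e₂ N (lg N)))))
        where
        e₁ : ∀ E N → E + 44 * N + 52 * N ≡ E + 96 * N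
        e₁ = solve-∀
        e₂ : ∀ N l → 51 * N + suc l * N ≡ N * l + 52 * N
        e₂ = solve-∀

      T-bound : τ ≤ 64 * N
      T-bound = 2^-cancel-≤ (begin
        2 ^ τ ≤⟨ slack ⟩
        pow32 (primorial N) ≤⟨ pow32-mono (primorial≤4^ N) ⟩
        pow32 (4 ^ N) ≡⟨ pow32-pow 4 N ⟩
        pow32 4 ^ N ≡⟨ cong (_^ N) (pow32-2^ 2) ⟩
        (2 ^ 64) ^ N ≡⟨ ^-*-assoc 2 64 N ⟩
        2 ^ (64 * N) ∎)

      -- Per unit of N the prime 2 gains 31.5 and `E-bound` gains 44, while the rounding losses cost
      -- 64: in total 11.5. The doubling keeps the half, which later pays for lower-order terms.
      sum-bound : 2 * (N * (lowerSum N + 11 * primorial N)) + N * primorial N ≤ 2 * (N * lg N * primorial N) + 384 * primorial N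
      sum-bound = +-cancelʳ-≤ ((40 * N + 64 * v) * P) _ _ (begin
        2 * (N * (lowerSum N + 11 * P)) + N * P + (40 * N + 64 * v) * P ≡⟨ e₁ N (lowerSum N) P v ⟩
        2 * (N * lowerSum N + 32 * v * P) + 63 * N * P ≤⟨ +-mono-≤ (*-monoʳ-≤ 2 total) (*-monoˡ-≤ P (proj₂ (proj₂ powers-of-two))) ⟩
        2 * ((E + τ) * P) + (64 * v + 384) * P ≤⟨ +-monoˡ-≤ ((64 * v + 384) * P) (*-monoʳ-≤ 2 (*-monoˡ-≤ P E+T)) ⟩
        2 * ((N * lg N + 20 * N) * P) + (64 * v + 384) * P ≡⟨ e₂ (N * lg N) N P v ⟩
        2 * (N * lg N * P) + 384 * P + (40 * N + 64 * v) * P ∎)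
        where
        P = primorial N
        E+T : E + τ ≤ N * lg N + 20 * N
        E+T = +-cancelʳ-≤ (44 * N) _ _ (begin
          E + τ + 44 * N ≡⟨ e₃ E τ (44 * N) ⟩
          E + 44 * N + τ ≤⟨ +-mono-≤ E-bound T-bound ⟩
          N * lg N + 64 * N ≡⟨ e₄ (N * lg N) N ⟩
          N * lg N + 20 * N + 44 * N ∎)
          where
          e₃ : ∀ E τ x → E + τ + x ≡ E + x + τ
          e₃ = solve-∀
          e₄ : ∀ x N → x + 64 * N ≡ x + 20 * N + 44 * N
          e₄ = solve-∀
        e₁ : ∀ N A P v → 2 * (N * (A + 11 * P)) + N * P + (40 * N + 64 * v) * P ≡ 2 * (N * A + 32 * v * P) + 63 * N * P
        e₁ = solve-∀
        e₂ : ∀ x N P v → 2 * ((x + 20 * N) * P) + (64 * v + 384) * P ≡ 2 * (x * P) + 384 * P + (40 * N + 64 * v) * P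
        e₂ = solve-∀

  -- With N + 1 on the left and N on the right this is what makes V (M + 11) nondecreasing at a
  -- prime N + 1; the extra term is paid by the spare half of `sum-bound`.
  lower-window : ∀ N → 600 ≤ N → 384 + 2 * lg N ≤ N →
    suc N * (lowerSum N + 11 * primorial N) ≤ N * (lg N * primorial N)
  lower-window N 600≤N small = *-cancelˡ-≤ 2 (+-cancelʳ-≤ (N * P) _ _ (begin
    2 * (suc N * B) + N * P ≡⟨ e₁ N B P ⟩
    2 * (N * B) + N * P + 2 * B ≤⟨ +-mono-≤ bound (*-monoʳ-≤ 2 B≤) ⟩
    2 * (N * lg N * P) + 384 * P + 2 * (lg N * P) ≡⟨ e₂ N (lg N) P ⟩
    2 * (N * (lg N * P)) + (384 + 2 * lg N) * P ≤⟨ +-monoʳ-≤ (2 * (N * (lg N * P))) (*-monoˡ-≤ P small) ⟩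
    2 * (N * (lg N * P)) + N * P ∎))
    where
    open ≤-Reasoning
    P = primorial N
    B = lowerSum N + 11 * P
    bound = Lower.sum-bound N (≤-trans (s≤s (s≤s z≤n)) 600≤N) (≤-trans (≤ᵇ-sound 300 600 refl) 600≤N)
    B≤ : B ≤ lg N * P
    B≤ = *-cancelˡ-≤′ (2 * N) (*-mono-≤ (s≤s (z≤n {1})) (≤-trans (s≤s z≤n) 600≤N)) (+-cancelʳ-≤ (N * P) _ _ (begin
      2 * N * B + N * P ≡⟨ cong (_+ N * P) (*-assoc 2 N B) ⟩
      2 * (N * B) + N * P ≤⟨ bound ⟩
      2 * (N * lg N * P) + 384 * P ≤⟨ +-monoʳ-≤ (2 * (N * lg N * P)) (*-monoˡ-≤ P (≤-trans (≤ᵇ-sound 384 600 refl) 600≤N)) ⟩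
      2 * (N * lg N * P) + N * P ≡⟨ cong (_+ N * P) (e₃ N (lg N) P) ⟩
      2 * N * (lg N * P) + N * P ∎))
      where
      e₃ : ∀ N l P → 2 * (N * l * P) ≡ 2 * N * (l * P)
      e₃ = solve-∀
    e₁ : ∀ N B P → 2 * (suc N * B) + N * P ≡ 2 * (N * B) + N * P + 2 * B
    e₁ = solve-∀
    e₂ : ∀ N l P → 2 * (N * l * P) + 384 * P + 2 * (l * P) ≡ 2 * (N * (l * P)) + (384 + 2 * l) * P
    e₂ = solve-∀

-- The computation over the primes up to a million.

module PrimeTable where

  open import Data.List using (List; []; _∷_)

  -- Lack of fuel yields 0, which `branch` rejects, so the number of division steps need not be
  -- estimated.
  euclid : ℕ → ℕ → ℕ → ℕ
  euclid zero a b = 0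
  euclid (suc f) a zero = a
  euclid (suc f) a (suc b) = euclid f (suc b) (a % suc b)

  square : ℕ → ℕ
  square x = x * x

  fast32 : ℕ → ℕ
  fast32 x = square (square (square (square (square x))))

  -- Proposes by how much the logarithm grows from one prime to the next; `checks` verifies the
  -- proposal from both sides, so nothing has to be proved about it.
  bumps : ℕ → ℕ → ℕ → ℕ
  bump : ℕ → ℕ → ℕ → Bool → ℕ
  bumps zero p t = 0
  bumps (suc f) p t = bump f p t (t <ᵇ p)
  bump f p t true = 0
  bump f p t false = suc (bumps f (2 * p) t)

  -- The data at a million from which the asymptotic part continues: π, V (M + 49) ≤ 27 for the
  -- upper sum, and V (M + 11) ≥ 579/25 and M + 11 ≤ 570 for the lower one. The values 27 and 23.16
  -- enclose the common limit 25.92.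
  final : (n P F U A : ℕ) → Bool
  final n P F U A = (n ≡ᵇ 78498) ∧ ((U + 49 * F ≤ᵇ 27 * P) ∧ ((579 * (P * P) ≤ᵇ 25 * (F * (A + 11 * P))) ∧ (A + 11 * P ≤ᵇ 570 * P)))

  checks : (x n P F U A l p k q : ℕ) → Bool
  checks x n P F U A l p k q =
    (fast32 (suc x) <ᵇ p) ∧ ((p ≤ᵇ 2 * fast32 (suc x)) ∧ ((fast32 (suc n) <ᵇ q) ∧ ((q ≤ᵇ 2 * fast32 (suc n)) ∧
    ((F * suc l ≤ᵇ 27 * P) ∧ (((suc x <ᵇ 421) ∨ (83 * (27 * (suc x * P)) ≤ᵇ 40 * (x * F) * (3 * k))) ∧
    ((1 ≤ᵇ U) ∧ (1 ≤ᵇ A)))))))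

  -- At x the state consists of n = π(x), the products P = Π p and F = Π (p − 1), the two weighted sums U and A,
  -- and l, k with p = 2^(l+1) and q = 2^(k+1), the binary logarithms at the last prime.  Primality of x + 1 is
  -- read off from its greatest common divisor with big, the product of the primes up to the start of the stage.
  run : ℕ → List ℕ → (big x n P F U A l p k q : ℕ) → Bool
  branch : List ℕ → ℕ → (big x n P F U A l p k q g : ℕ) → Bool
  adjust : List ℕ → ℕ → (big x n P F U A l p k q b c : ℕ) → Bool
  update : List ℕ → ℕ → (big x n P F U A l p k q : ℕ) → Bool
  run zero [] big x n P F U A l p k q = final n P F U A
  run zero (f ∷ fs) big x n P F U A l p k q = (x + f <ᵇ suc x * suc x) ∧ run f fs P x n P F U A l p k q
  run (suc f) fs big x n P F U A l p k q = branch fs f big x n P F U A l p k q (euclid 64 big (suc x))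
  branch fs f big x n P F U A l p k q 0 = false
  branch fs f big x n P F U A l p k q 1 = adjust fs f big x n P F U A l p k q (bumps 40 p (fast32 (suc x))) (bumps 40 q (fast32 (suc n)))
  branch fs f big x n P F U A l p k q (suc (suc _)) = run f fs big (suc x) n P F U A l p k q
  adjust fs f big x n P F U A l p k q b c = update fs f big x n P F U A (b + l) (2 ^ b * p) (c + k) (2 ^ c * q)
  update fs f big x n P F U A l p k q = checks x n P F U A l p k q ∧
    run f fs big (suc x) (suc n) (suc x * P) (x * F) (x * U + suc l * F) (suc x * A + l * P) l p k q

-- Soundness of the computation.

module PrimeTableSound where

  open import Data.List using ([]; _∷_)
  open import Data.Nat.ListAction using (sum)
  open SieveProfile
  open ProfileTable using (≤ᵇ-sound; ∧-split; unT; <ᵇ-false)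
  open Pow32
  open Rough
  open Logs
  open Mertens
  open PrimeTable

  euclid-common : ∀ f a b → euclid f a b ≡ 0 ⊎ (euclid f a b ∣ a × euclid f a b ∣ b × (∀ d → d ∣ a → d ∣ b → d ∣ euclid f a b))
  euclid-common zero a b = inj₁ refl
  euclid-common (suc f) a zero = inj₂ (∣-refl , (a ∣0) , λ d d∣a _ → d∣a)
  euclid-common (suc f) a (suc b) with euclid-common f (suc b) (a % suc b)
  ... | inj₁ eq = inj₁ eq
  ... | inj₂ (g∣b , g∣r , greatest) = inj₂
    ( subst (euclid f (suc b) (a % suc b) ∣_) (sym a≡) (∣m∣n⇒∣m+n g∣r (∣n⇒∣m*n (a / suc b) g∣b))
    , g∣b
    , λ d d∣a d∣b → greatest d d∣b (∣m+n∣m⇒∣n (subst (d ∣_) (trans a≡ (+-comm (a % suc b) _)) d∣a) (∣n⇒∣m*n (a / suc b) d∣b)))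
    where
    a≡ = m≡m%n+[m/n]*n a (suc b)

  fast32-pow32 : ∀ x → fast32 x ≡ pow32 x
  fast32-pow32 x = trans (sq {a = 16} (sq {a = 8} (sq {a = 4} (sq {a = 2} (sq {a = 1} (sym (*-identityʳ x))))))) (sym (pow32-^ x))
    where
    sq : ∀ {y a} → y ≡ x ^ a → square y ≡ x ^ (a * 2)
    sq {a = a} refl = trans (cong (x ^ a *_) (sym (*-identityʳ (x ^ a)))) (^-*-assoc x a 2)

  bumps-shift : ∀ b l p → p ≡ 2 ^ suc l → 2 ^ b * p ≡ 2 ^ suc (b + l)
  bumps-shift b l p refl = trans (sym (^-distribˡ-+-* 2 b (suc l))) (cong (2 ^_) (+-suc b l))

  lg-exact : ∀ {l p y} → p ≡ 2 ^ suc l → 0 < y → fast32 y < p → p ≤ 2 * fast32 y → lg y ≡ l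
  lg-exact {l} {p} {y} refl 0<y <p p≤ = ≤-antisym (lg≤ 0<y (subst (_< 2 ^ suc l) (fast32-pow32 y) <p))
    (≤lg {l} {y} (*-cancelˡ-≤ 2 (subst (λ t → 2 ^ suc l ≤ 2 * t) (fast32-pow32 y) p≤)))

  coprime⇒prime : ∀ {B y} → 1 < y → y < suc B * suc B → (∀ p → Prime p → p ≤ B → ¬ p ∣ y) → Prime y
  coprime⇒prime {B} {y} 1<y y<B² h = rough∧square>⇒prime {{n>1⇒nonTrivial 1<y}} rough y<B²
    where
    rough : suc B Rough y
    rough (hasNonTrivialDivisor {d} {{nt}} d<1+B d∣y) with prime-divisor (nonTrivial⇒n>1 d {{nt}})
    ... | p , pp , p∣d = h p pp (≤-trans (∣⇒≤ {{nonTrivial⇒nonZero d {{nt}}}} p∣d) (s≤s⁻¹ d<1+B)) (∣-trans p∣d d∣y)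

  -- `Enough` is s ≥ 83/40 for an interval of length π(z)³, with three times the rounded logarithm
  -- of π(z) in place of 32 log₂ of the length.
  Dense Enough : ℕ → Set
  Dense z = Prime (suc z) → totientProduct z * weight (suc z) ≤ 27 * primorial z
  Enough z = 83 * (27 * primorial z) ≤ 40 * totientProduct z * (3 * lg (primeCount z))

  record Between (a b : ℕ) : Set where
    field
      dense : ∀ z → a ≤ z → z < b → Dense z
      enough : ∀ z → a ≤ z → z < b → Prime (suc z) → 421 ≤ suc z → Enough (suc z)

  open Between public

  between-empty : ∀ {a} → Between a a
  between-empty .dense z a≤z z<a = ⊥-elim (<⇒≱ z<a a≤z)
  between-empty .enough z a≤z z<a = ⊥-elim (<⇒≱ z<a a≤z)

  between-cons : ∀ {x b} → Dense x → (Prime (suc x) → 421 ≤ suc x → Enough (suc x)) → Between (suc x) b → Between x b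
  between-cons {x} d e rest .dense z x≤z z<b with m≤n⇒m<n∨m≡n x≤z
  ... | inj₁ x<z = dense rest z x<z z<b
  ... | inj₂ refl = d
  between-cons {x} d e rest .enough z x≤z z<b with m≤n⇒m<n∨m≡n x≤z
  ... | inj₁ x<z = enough rest z x<z z<b
  ... | inj₂ refl = e

  record Final (x : ℕ) : Set where
    field
      size : primeCount x ≡ 78498
      upper : upperSum x + 49 * totientProduct x ≤ 27 * primorial x
      lower : 579 * (primorial x * primorial x) ≤ 25 * (totientProduct x * (lowerSum x + 11 * primorial x))
      start : lowerSum x + 11 * primorial x ≤ 570 * primorial x

  record State (x n P F U A l p k q : ℕ) : Set where
    constructor state
    field
      n≡ : n ≡ primeCount x
      P≡ : P ≡ primorial x
      F≡ : F ≡ totientProduct x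
      U≡ : U ≡ upperSum x
      A≡ : A ≡ lowerSum x
      p≡ : p ≡ 2 ^ suc l
      q≡ : q ≡ 2 ^ suc k

  -- All numbers examined in a stage lie above B and below (B + 1)², so they are prime exactly when
  -- they are coprime to the product of the primes up to B.
  record Stage (B big x f : ℕ) : Set where
    constructor stage
    field
      big≡ : big ≡ primorial B
      5≤x : 5 ≤ x
      B≤x : B ≤ x
      x+f< : x + f < suc B * suc B

  private
    advance : ∀ {B big x f} → Stage B big x (suc f) → Stage B big (suc x) f
    advance {B} {x = x} {f} (stage big≡ 5≤x B≤x x+f<) = stage big≡ (m≤n⇒m≤1+n 5≤x) (m≤n⇒m≤1+n B≤x) (subst (_< suc B * suc B) (+-suc x f) x+f<)

  sound : ∀ fs f {B} big x n P F U A l p k q → run f fs big x n P F U A l p k q ≡ true →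
    State x n P F U A l p k q → Stage B big x f → Between x (x + f + sum fs) × Final (x + f + sum fs)
  sound-branch : ∀ fs f {B} big x n P F U A l p k q g → euclid 64 big (suc x) ≡ g → branch fs f big x n P F U A l p k q g ≡ true →
    State x n P F U A l p k q → Stage B big x (suc f) → Between x (x + suc f + sum fs) × Final (x + suc f + sum fs)
  sound-update : ∀ fs f {B} big x n P F U A l p k q → Prime (suc x) → update fs f big x n P F U A l p k q ≡ true →
    State x n P F U A l p k q → Stage B big x (suc f) → Between x (suc x + f + sum fs) × Final (suc x + f + sum fs)

  sound [] zero big x n P F U A l p k q h (state refl refl refl refl refl _ _) _ =
    subst (λ b → Between x b × Final b) (sym (trans (+-identityʳ (x + 0)) (+-identityʳ x)))
      (between-empty , record
        { size = ≡ᵇ⇒≡ n 78498 (unT (proj₁ h₁)) ; upper = ≤ᵇ-sound _ _ (proj₁ h₂) ; lower = ≤ᵇ-sound _ _ (proj₁ h₃) ; start = ≤ᵇ-sound _ _ (proj₂ h₃) })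
    where
    h₁ = ∧-split {n ≡ᵇ 78498} h
    h₂ = ∧-split {U + 49 * F ≤ᵇ 27 * P} (proj₂ h₁)
    h₃ = ∧-split {579 * (P * P) ≤ᵇ 25 * (F * (A + 11 * P))} (proj₂ h₂)
  sound (f ∷ fs) zero big x n P F U A l p k q h s st = subst (λ b → Between x b × Final b) (e x f (sum fs))
    (sound fs f P x n P F U A l p k q (proj₂ h′) s
      (stage (State.P≡ s) (Stage.5≤x st) ≤-refl (<ᵇ⇒< (x + f) (suc x * suc x) (unT (proj₁ h′)))))
    where
    h′ = ∧-split {x + f <ᵇ suc x * suc x} h
    e : ∀ x f s → x + f + s ≡ x + 0 + (f + s)
    e = solve-∀
  sound fs (suc f) big x n P F U A l p k q h s st = sound-branch fs f big x n P F U A l p k q (euclid 64 big (suc x)) refl h s st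

  sound-branch fs f {B} big x n P F U A l p k q 1 g≡ h s st =
    subst (λ b → Between x (b + sum fs) × Final (b + sum fs)) (sym (+-suc x f))
      (sound-update fs f big x n P F U A (b + l) (2 ^ b * p) (c + k) (2 ^ c * q) prime h
        (record { n≡ = n≡ ; P≡ = P≡ ; F≡ = F≡ ; U≡ = U≡ ; A≡ = A≡ ; p≡ = bumps-shift b l p p≡ ; q≡ = bumps-shift c k q q≡ }) st)
    where
    open State s
    open Stage st
    b = bumps 40 p (fast32 (suc x))
    c = bumps 40 q (fast32 (suc n))
    prime : Prime (suc x)
    prime = coprime⇒prime {B} (s≤s (≤-trans (s≤s z≤n) 5≤x)) (≤-<-trans (≤-trans (m≤m+n (suc x) f) (≤-reflexive (sym (+-suc x f)))) x+f<)
      λ r rr r≤B r∣ → prime∤1 rr (common r (subst (r ∣_) (sym big≡) (≤⇒prime∣primorial B rr r≤B)) r∣)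
      where
      common : ∀ d → d ∣ big → d ∣ suc x → d ∣ 1
      common with euclid-common 64 big (suc x)
      ... | inj₁ eq with trans (sym g≡) eq
      ...   | ()
      common | inj₂ (_ , _ , greatest) = λ d d₁ d₂ → subst (d ∣_) g≡ (greatest d d₁ d₂)
  sound-branch fs f {B} big x n P F U A l p k q g@(suc (suc g′)) g≡ h s st =
    subst (λ b → Between x (b + sum fs) × Final (b + sum fs)) (sym (+-suc x f))
      (between-cons (⊥-elim ∘ composite) (λ pp _ → ⊥-elim (composite pp)) (proj₁ rest) , proj₂ rest)
    where
    open State s
    open Stage st
    divides-both : g ∣ big × g ∣ suc x
    divides-both with euclid-common 64 big (suc x)
    ... | inj₂ (d₁ , d₂ , _) = subst (_∣ big) g≡ d₁ , subst (_∣ suc x) g≡ d₂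
    ... | inj₁ eq with trans (sym g≡) eq
    ...   | ()
    composite : ¬ Prime (suc x)
    -- Were x + 1 prime, the nontrivial common divisor g would equal it, and x + 1 would divide a
    -- product of primes not exceeding B ≤ x.
    composite pp with prime⇒irreducible pp (proj₂ divides-both)
    ... | inj₁ ()
    ... | inj₂ refl = <⇒≱ (s≤s B≤x) (prime∣primorial⇒≤ B pp (subst (suc x ∣_) big≡ (proj₁ divides-both)))
    rest = sound fs f big (suc x) n P F U A l p k q h
      (record { n≡ = trans n≡ (sym (primeCount-nonprime composite)) ; P≡ = trans P≡ (sym (primorial-nonprime composite))
              ; F≡ = trans F≡ (sym (totient-nonprime composite)) ; U≡ = trans U≡ (sym (upperSum-nonprime composite))
              ; A≡ = trans A≡ (sym (lowerSum-nonprime composite)) ; p≡ = p≡ ; q≡ = q≡ }) (advance st)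

  sound-update fs f {B} big x n P F U A l p k q pp h (state refl refl refl refl refl p≡ q≡) st =
    between-cons (λ _ → dense-x) (λ _ → enough-x) (proj₁ rest) , proj₂ rest
    where
    open Stage st
    h₀ = ∧-split {checks x n P F U A l p k q} h
    h₁ = ∧-split {fast32 (suc x) <ᵇ p} (proj₁ h₀)
    h₂ = ∧-split {p ≤ᵇ 2 * fast32 (suc x)} (proj₂ h₁)
    h₃ = ∧-split {fast32 (suc n) <ᵇ q} (proj₂ h₂)
    h₄ = ∧-split {q ≤ᵇ 2 * fast32 (suc n)} (proj₂ h₃)
    h₅ = ∧-split {F * suc l ≤ᵇ 27 * P} (proj₂ h₄)
    h₆ = ∧-split {(suc x <ᵇ 421) ∨ (83 * (27 * (suc x * P)) ≤ᵇ 40 * (x * F) * (3 * k))} (proj₂ h₅)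
    lg-x : lg (suc x) ≡ l
    lg-x = lg-exact p≡ (s≤s z≤n) (<ᵇ⇒< (fast32 (suc x)) p (unT (proj₁ h₁))) (≤ᵇ-sound p _ (proj₁ h₂))
    lg-n : lg (suc n) ≡ k
    lg-n = lg-exact q≡ (s≤s z≤n) (<ᵇ⇒< (fast32 (suc n)) q (unT (proj₁ h₃))) (≤ᵇ-sound q _ (proj₁ h₄))
    dense-x : F * weight (suc x) ≤ 27 * P
    dense-x = subst (λ l → F * suc l ≤ 27 * P) (sym lg-x) (≤ᵇ-sound _ _ (proj₁ h₅))
    enough-x : 421 ≤ suc x → Enough (suc x)
    enough-x large = subst₂ (λ P F → 83 * (27 * P) ≤ 40 * F * (3 * lg (primeCount (suc x)))) (sym (primorial-prime pp)) (sym (totient-prime pp))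
      (subst (λ k → 83 * (27 * (suc x * P)) ≤ 40 * (x * F) * (3 * k)) (trans (sym lg-n) (cong lg (sym (primeCount-prime pp))))
        (≤ᵇ-sound _ _ (trans (cong (_∨ (83 * (27 * (suc x * P)) ≤ᵇ 40 * (x * F) * (3 * k))) (sym (<ᵇ-false large))) (proj₁ h₆))))
    rest = sound fs f big (suc x) (suc n) (suc x * P) (x * F) (x * U + suc l * F) (suc x * A + l * P) l p k q (proj₂ h₀)
      (record { n≡ = sym (primeCount-prime pp) ; P≡ = sym (primorial-prime pp) ; F≡ = sym (totient-prime pp)
              ; U≡ = trans (cong (λ l → x * U + suc l * F) (sym lg-x)) (sym (upperSum-prime pp))
              ; A≡ = trans (cong (λ l → suc x * A + l * P) (trans (sym lg-x) (sym (oddLg-large (s≤s (≤-trans (s≤s (s≤s z≤n)) 5≤x)))))) (sym (lowerSum-prime pp))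
              ; p≡ = p≡ ; q≡ = q≡ }) (advance st)

  initial : State 5 3 30 8 618 944 74 (2 ^ 75) 50 (2 ^ 51)
  initial = record { n≡ = refl ; P≡ = refl ; F≡ = refl ; U≡ = U-start ; A≡ = A-start ; p≡ = refl ; q≡ = refl }
    where
    at : ∀ x l → 0 < x → (fast32 x <ᵇ 2 ^ suc l) ≡ true → (2 ^ suc l ≤ᵇ 2 * fast32 x) ≡ true → lg x ≡ l
    at x l 0<x h₁ h₂ = lg-exact {l} refl 0<x (<ᵇ⇒< (fast32 x) (2 ^ suc l) (unT h₁)) (≤ᵇ-sound _ _ h₂)
    lg2 = at 2 32 (s≤s z≤n) refl refl
    lg3 = at 3 50 (s≤s z≤n) refl refl
    lg5 = at 5 74 (s≤s z≤n) refl refl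
    p3 = from-yes (prime? 3)
    p5 = from-yes (prime? 5)
    ¬p4 = from-no (prime? 4)
    U-start : 618 ≡ upperSum 5
    U-start = sym (trans (upperSum-prime p5) (cong₂ (λ u l → 4 * u + suc l * 2)
      (trans (upperSum-nonprime ¬p4) (trans (upperSum-prime p3) (cong₂ (λ u l → 2 * u + suc l * 1)
        (trans (upperSum-prime prime[2]) (cong (λ l → 1 * 0 + suc l * 1) lg2)) lg3))) lg5))
    A-start : 944 ≡ lowerSum 5
    A-start = sym (trans (lowerSum-prime p5) (cong₂ (λ a l → 5 * a + l * 6)
      (trans (lowerSum-nonprime ¬p4) (trans (lowerSum-prime p3) (cong (λ l → 3 * 0 + l * 2) lg3))) lg5))

-- Beyond a million: monotonicity of V times the Mertens sums, and many primes.

module Growth where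

  open SieveProfile
  open ProfileTable using (≤ᵇ-sound)
  open Pow32
  open Rough
  open Logs
  open Factorials using (from)
  open Mertens
  open PrimeTableSound

  -- Divided by the primorial this is M + 11, with the shift that `lower-window` provides.
  shiftedSum : ℕ → ℕ
  shiftedSum z = lowerSum z + 11 * primorial z

  shiftedSum-prime : ∀ {z} → 3 ≤ suc z → Prime (suc z) → shiftedSum (suc z) ≡ suc z * shiftedSum z + lg (suc z) * primorial z
  shiftedSum-prime {z} 3≤ pp = trans (cong₂ _+_ (trans (lowerSum-prime pp) (cong (λ o → suc z * lowerSum z + o * primorial z) (oddLg-large 3≤)))
      (cong (11 *_) (primorial-prime pp))) (e (suc z) (lowerSum z) (lg (suc z)) (primorial z))
    where
    e : ∀ q A l P → q * A + l * P + 11 * (q * P) ≡ q * (A + 11 * P) + l * P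
    e = solve-∀

  shiftedSum-nonprime : ∀ {z} → ¬ Prime (suc z) → shiftedSum (suc z) ≡ shiftedSum z
  shiftedSum-nonprime ¬p = cong₂ (λ a b → a + 11 * b) (lowerSum-nonprime ¬p) (primorial-nonprime ¬p)

  primeCount-mono : ∀ {a b} → a ≤ b → primeCount a ≤ primeCount b
  primeCount-mono {a} {b} a≤b = subst (λ b → primeCount a ≤ primeCount b) (m∸n+n≡m a≤b) (go (b ∸ a))
    where
    go : ∀ t → primeCount a ≤ primeCount (t + a)
    go zero = ≤-refl
    go (suc t) with decPrime (suc (t + a))
    ... | yes pp = ≤-trans (go t) (≤-trans (n≤1+n _) (≤-reflexive (sym (primeCount-prime pp))))
    ... | no ¬p = ≤-trans (go t) (≤-reflexive (sym (primeCount-nonprime ¬p)))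

  -- V (M + 49) does not increase, where V = Π (1 − 1/p) and M = upperSum / totientProduct.
  module Above {z₀ : ℕ} (300≤z₀ : 300 ≤ z₀) (base : upperSum z₀ + 49 * totientProduct z₀ ≤ 27 * primorial z₀) where
    open ≤-Reasoning

    upper-product : ∀ z → z₀ ≤ z → upperSum z + 49 * totientProduct z ≤ 27 * primorial z
    upper-product = from {P} z₀ base step
      where
      P : ℕ → Set
      P z = upperSum z + 49 * totientProduct z ≤ 27 * primorial z
      step : ∀ z → z₀ ≤ z → P z → P (suc z)
      step z z₀≤z h with decPrime (suc z)
      ... | no ¬p = subst₂ _≤_ (sym (cong₂ (λ a b → a + 49 * b) (upperSum-nonprime ¬p) (totient-nonprime ¬p))) (cong (27 *_) (sym (primorial-nonprime ¬p))) h
      ... | yes pp = subst₂ _≤_ (sym (cong₂ (λ a b → a + 49 * b) (upperSum-prime pp) (totient-prime pp))) (cong (27 *_) (sym (primorial-prime pp))) (begin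
          z * upperSum z + weight (suc z) * totientProduct z + 49 * (z * totientProduct z)
            ≤⟨ +-monoˡ-≤ (49 * (z * totientProduct z)) (+-monoʳ-≤ (z * upperSum z) (upper-window z (≤-trans 300≤z₀ z₀≤z))) ⟩
          z * upperSum z + (upperSum z + 49 * totientProduct z) + 49 * (z * totientProduct z) ≡⟨ e₁ z (upperSum z) (totientProduct z) ⟩
          suc z * (upperSum z + 49 * totientProduct z) ≤⟨ *-monoʳ-≤ (suc z) h ⟩
          suc z * (27 * primorial z) ≡⟨ e₂ (suc z) (primorial z) ⟩
          27 * (suc z * primorial z) ∎)
        where
        e₁ : ∀ z U F → z * U + (U + 49 * F) + 49 * (z * F) ≡ suc z * (U + 49 * F)
        e₁ = solve-∀
        e₂ : ∀ q P → q * (27 * P) ≡ 27 * (q * P)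
        e₂ = solve-∀

    dense-above : ∀ z → z₀ ≤ z → Dense z
    dense-above z z₀≤z _ = ≤-trans (≤-reflexive (*-comm (totientProduct z) _)) (≤-trans (upper-window z (≤-trans 300≤z₀ z₀≤z)) (upper-product z z₀≤z))

  private
    base₀ : 2 ^ 637 ≤ pow32 1000000 × pow32 225000 ≤ 2 ^ 637
    base₀ = subst₂ (λ a b → 2 ^ 637 ≤ a × b ≤ 2 ^ 637) (sym (pow32-^ 1000000)) (sym (pow32-^ 225000)) (≤ᵇ-sound _ _ refl , ≤ᵇ-sound _ _ refl)

  private
    quarter : ∀ m c l z → 0 < c → 4 * m ≤ c → l * c ≤ m * (z * 1) → 4 * l ≤ z
    quarter m c l z c>0 4m≤c h = *-cancelˡ-≤′ c c>0 (begin
      c * (4 * l) ≡⟨ e₁ c l ⟩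
      4 * (l * c) ≤⟨ *-monoʳ-≤ 4 h ⟩
      4 * (m * (z * 1)) ≡⟨ e₂ m z ⟩
      4 * m * z ≤⟨ *-monoˡ-≤ z 4m≤c ⟩
      c * z ∎)
      where
      open ≤-Reasoning
      e₁ : ∀ c l → c * (4 * l) ≡ 4 * (l * c)
      e₁ = solve-∀
      e₂ : ∀ m z → 4 * (m * (z * 1)) ≡ 4 * m * z
      e₂ = solve-∀

  lg-small : ∀ z → 1000000 ≤ z → 384 + 2 * lg z ≤ z
  lg-small z big = *-cancelˡ-≤ 2 (begin
    2 * (384 + 2 * lg z) ≡⟨ e (lg z) 384 ⟩
    2 * 384 + 4 * lg z ≤⟨ +-mono-≤ (≤-trans (≤ᵇ-sound (2 * 384) 1000000 refl) big)
        (quarter 637 225000 (lg z) z (≤ᵇ-sound 1 225000 refl) (≤ᵇ-sound (4 * 637) 225000 refl) (lg-sublinear {637} {225000} {1} {z} (≤ᵇ-sound 47 637 refl) 0<z (≤-trans (proj₂ base₀) (≤-reflexive (sym (trans (cong (2 ^ 637 *_) pow32-1) (*-identityʳ (2 ^ 637))))))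
          (≤lg (≤-trans (proj₁ base₀) (pow32-mono big))))) ⟩
    z + z ≡⟨ cong (z +_) (+-identityʳ z) ⟨
    2 * z ∎)
    where
    open ≤-Reasoning
    0<z : 0 < z
    0<z = ≤-trans (≤ᵇ-sound 1 1000000 refl) big
    e : ∀ l c → 2 * (c + 2 * l) ≡ 2 * c + 4 * l
    e = solve-∀

  window : ∀ z → 1000000 ≤ z → suc z * shiftedSum z ≤ z * (lg (suc z) * primorial z)
  window z big = ≤-trans (lower-window z (≤-trans (≤ᵇ-sound 600 1000000 refl) big) (lg-small z big))
    (*-monoʳ-≤ z (*-monoˡ-≤ (primorial z) (lg-mono (≤-trans (≤ᵇ-sound 1 1000000 refl) big) (n≤1+n z))))

  module Beyond {z₀ : ℕ} (huge : 1000000 ≤ z₀) (at : Final z₀) where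
    open ≤-Reasoning

    private
      3≤ : ∀ {z} → z₀ ≤ z → 3 ≤ suc z
      3≤ big = m≤n⇒m≤1+n (≤-trans (≤ᵇ-sound 3 1000000 refl) (≤-trans huge big))

    open Above {z₀} (≤-trans (≤ᵇ-sound 300 1000000 refl) huge) (Final.upper at) public

    -- V (M + 11) does not decrease, where now M = lowerSum / primorial.
    lower-product : ∀ z → z₀ ≤ z → 579 * (primorial z * primorial z) ≤ 25 * (totientProduct z * shiftedSum z)
    lower-product = from {Q} z₀ (Final.lower at) step
      where
      Q : ℕ → Set
      Q z = 579 * (primorial z * primorial z) ≤ 25 * (totientProduct z * shiftedSum z)
      step : ∀ z → z₀ ≤ z → Q z → Q (suc z)
      step z big h with decPrime (suc z)
      ... | no ¬p = subst₂ _≤_ (cong (λ P → 579 * (P * P)) (sym (primorial-nonprime ¬p))) (cong₂ (λ F B → 25 * (F * B)) (sym (totient-nonprime ¬p)) (sym (shiftedSum-nonprime ¬p))) h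
      ... | yes pp = subst₂ _≤_ (cong (λ P → 579 * (P * P)) (sym (primorial-prime pp))) (cong₂ (λ F B → 25 * (F * B)) (sym (totient-prime pp)) (sym (shiftedSum-prime (3≤ big) pp))) (begin
          579 * (q * P * (q * P)) ≡⟨ e₁ q P ⟩
          q * q * (579 * (P * P)) ≤⟨ *-monoʳ-≤ (q * q) h ⟩
          q * q * (25 * (F * B)) ≡⟨ e₂ z F B ⟩
          25 * F * (z * (q * B) + q * B) ≤⟨ *-monoʳ-≤ (25 * F) (+-monoʳ-≤ (z * (q * B)) (window z (≤-trans huge big))) ⟩
          25 * F * (z * (q * B) + z * (lg q * P)) ≡⟨ e₃ z F (q * B) (lg q * P) ⟩
          25 * (z * F * (q * B + lg q * P)) ∎)
        where
        q = suc z
        P = primorial z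
        F = totientProduct z
        B = shiftedSum z
        e₁ : ∀ q P → 579 * (q * P * (q * P)) ≡ q * q * (579 * (P * P))
        e₁ = solve-∀
        e₂ : ∀ z F B → suc z * suc z * (25 * (F * B)) ≡ 25 * F * (z * (suc z * B) + suc z * B)
        e₂ = solve-∀
        e₃ : ∀ z F x y → 25 * F * (z * x + z * y) ≡ 25 * (z * F * (x + y))
        e₃ = solve-∀

    -- Many m R D: π(z) ≥ R / D as soon as M(z) + 11 ≥ m.
    Many : ℕ → ℕ → ℕ → Set
    Many m R D = ∀ z → z₀ ≤ z → m * primorial z ≤ shiftedSum z → R ≤ primeCount z * D

    -- A prime q raises M by lg q / q ≤ m D / Y once lg q ≥ m, since lg q / q decreases. So raising
    -- M + 11 from m to m + δ takes about δ Y / (m D) primes, in addition to the R / D already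
    -- present at m; the summand D allows for the prime at which m is crossed.
    supply : ∀ m R D Y → 570 ≤ m → pow32 Y ≤ 2 ^ m * pow32 D → Many m R D →
      ∀ z → z₀ ≤ z → m * primorial z ≤ shiftedSum z →
      shiftedSum z * Y + R * (m * primorial z) ≤ m * primorial z * Y + (primeCount z * D + D) * (m * primorial z)
    supply m R D Y 570≤m hY many = from {Q} z₀ base step
      where
      Q : ℕ → Set
      Q z = m * primorial z ≤ shiftedSum z → shiftedSum z * Y + R * (m * primorial z) ≤ m * primorial z * Y + (primeCount z * D + D) * (m * primorial z)
      base : Q z₀
      base le = +-mono-≤ (*-monoˡ-≤ Y (≤-trans (Final.start at) (*-monoˡ-≤ (primorial z₀) 570≤m)))
        (*-monoˡ-≤ (m * primorial z₀) (≤-trans (many z₀ ≤-refl le) (m≤m+n _ D)))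
      step : ∀ z → z₀ ≤ z → Q z → Q (suc z)
      step z big ih with decPrime (suc z)
      ... | no ¬p = subst (λ P → m * P ≤ shiftedSum (suc z) → shiftedSum (suc z) * Y + R * (m * P) ≤ m * P * Y + (primeCount (suc z) * D + D) * (m * P)) (sym (primorial-nonprime ¬p))
                      (subst₂ (λ B n → m * primorial z ≤ B → B * Y + R * (m * primorial z) ≤ m * primorial z * Y + (n * D + D) * (m * primorial z)) (sym (shiftedSum-nonprime ¬p)) (sym (primeCount-nonprime ¬p)) ih)
      ... | yes pp = λ le → subst (λ n → B′ * Y + R * (m * P′) ≤ m * P′ * Y + (n * D + D) * (m * P′)) (sym (primeCount-prime pp))
            (subst₂ (λ B P → B * Y + R * (m * P) ≤ m * P * Y + (suc n * D + D) * (m * P)) (sym B≡) (sym P≡) (main le (≤-<-connex (m * P) B)))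
        where
        q = suc z
        P = primorial z
        P′ = primorial q
        B = shiftedSum z
        B′ = shiftedSum q
        n = primeCount z
        B≡ = shiftedSum-prime (3≤ big) pp
        P≡ = primorial-prime pp
        -- By `window` the shifted sum at q, and hence m, is at most lg q.
        m≤lg : m * P′ ≤ B′ → m ≤ lg q
        m≤lg le = *-cancelˡ-≤′ (q * P) (*-mono-≤ (s≤s (z≤n {z})) (primorial>0 z)) (begin
          q * P * m ≡⟨ *-comm (q * P) m ⟩
          m * (q * P) ≡⟨ cong (m *_) P≡ ⟨
          m * P′ ≤⟨ le ⟩
          B′ ≡⟨ B≡ ⟩
          q * B + lg q * P ≤⟨ +-monoˡ-≤ (lg q * P) (window z (≤-trans huge big)) ⟩
          z * (lg q * P) + lg q * P ≡⟨ e z (lg q) P ⟩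
          q * P * lg q ∎)
          where
          e : ∀ z l P → z * (l * P) + l * P ≡ suc z * P * l
          e = solve-∀
        jump : m * P′ ≤ B′ → lg q * Y ≤ m * (q * D)
        jump le = lg-sublinear (≤-trans (≤ᵇ-sound 47 570 refl) 570≤m) (s≤s z≤n) hY (m≤lg le)
        main : m * P′ ≤ B′ → m * P ≤ B ⊎ B < m * P →
          (q * B + lg q * P) * Y + R * (m * (q * P)) ≤ m * (q * P) * Y + (suc n * D + D) * (m * (q * P))
        main le (inj₁ above) = begin
          (q * B + lg q * P) * Y + R * (m * (q * P)) ≡⟨ e₁ q B (lg q) P Y R m ⟩
          q * (B * Y + R * (m * P)) + lg q * Y * P ≤⟨ +-mono-≤ (*-monoʳ-≤ q (ih above)) (*-monoˡ-≤ P (jump le)) ⟩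
          q * (m * P * Y + (n * D + D) * (m * P)) + m * (q * D) * P ≡⟨ e₂ q m P Y n D ⟩
          m * (q * P) * Y + (suc n * D + D) * (m * (q * P)) ∎
          where
          e₁ : ∀ q B l P Y R m → (q * B + l * P) * Y + R * (m * (q * P)) ≡ q * (B * Y + R * (m * P)) + l * Y * P
          e₁ = solve-∀
          e₂ : ∀ q m P Y n D → q * (m * P * Y + (n * D + D) * (m * P)) + m * (q * D) * P ≡ m * (q * P) * Y + (suc n * D + D) * (m * (q * P))
          e₂ = solve-∀
        main le (inj₂ below) = begin
          (q * B + lg q * P) * Y + R * (m * (q * P)) ≡⟨ e₁ q B (lg q) P Y (R * (m * (q * P))) ⟩
          q * B * Y + lg q * Y * P + R * (m * (q * P))
            ≤⟨ +-mono-≤ (+-mono-≤ (*-monoˡ-≤ Y (*-monoʳ-≤ q (<⇒≤ below))) (*-monoˡ-≤ P (jump le)))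
                 (*-monoˡ-≤ (m * (q * P)) (subst (λ n → R ≤ n * D) (primeCount-prime pp) (many q (m≤n⇒m≤1+n big) le))) ⟩
          q * (m * P) * Y + m * (q * D) * P + suc n * D * (m * (q * P)) ≡⟨ e₂ q m P Y n D ⟩
          m * (q * P) * Y + (suc n * D + D) * (m * (q * P)) ∎
          where
          e₁ : ∀ q B l P Y x → (q * B + l * P) * Y + x ≡ q * B * Y + l * Y * P + x
          e₁ = solve-∀
          e₂ : ∀ q m P Y n D → q * (m * P) * Y + m * (q * D) * P + suc n * D * (m * (q * P)) ≡ m * (q * P) * Y + (suc n * D + D) * (m * (q * P))
          e₂ = solve-∀

    -- Solved for the number of primes: π(z) + 1 ≥ R / D + δ Y / (m D) as soon as M + 11 ≥ m + δ.
    more : ∀ m δ R D Y → 570 ≤ m → pow32 Y ≤ 2 ^ m * pow32 D → Many m R D →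
      ∀ z → z₀ ≤ z → (m + δ) * primorial z ≤ shiftedSum z → δ * Y + R * m ≤ (primeCount z * D + D) * m
    more m δ R D Y 570≤m hY many z big le = *-cancelˡ-≤′ P (primorial>0 z) (+-cancelʳ-≤ (m * P * Y) _ _ (begin
      P * (δ * Y + R * m) + m * P * Y ≡⟨ e₁ P δ Y R m ⟩
      (m + δ) * P * Y + R * (m * P) ≤⟨ +-monoˡ-≤ (R * (m * P)) (*-monoˡ-≤ Y le) ⟩
      shiftedSum z * Y + R * (m * P) ≤⟨ supply m R D Y 570≤m hY many z big (≤-trans (*-monoˡ-≤ P (m≤m+n m δ)) le) ⟩
      m * P * Y + (primeCount z * D + D) * (m * P) ≡⟨ e₂ m P Y (primeCount z * D + D) ⟩
      P * ((primeCount z * D + D) * m) + m * P * Y ∎))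
      where
      P = primorial z
      e₁ : ∀ P δ Y R m → P * (δ * Y + R * m) + m * P * Y ≡ (m + δ) * P * Y + R * (m * P)
      e₁ = solve-∀
      e₂ : ∀ m P Y x → m * P * Y + x * (m * P) ≡ P * (x * m) + m * P * Y
      e₂ = solve-∀

-- Beyond a million: π(z)³ stays above the sifting limit.

module Levels where

  open SieveProfile
  open ProfileTable using (≤ᵇ-sound)
  open Pow32
  open Rough
  open Logs
  open Mertens
  open PrimeTableSound
  open Growth

  Sufficient : ℕ → Set
  Sufficient z = ∃ λ L → 2 ^ L ≤ pow32 (primeCount z ^ 3) × 83 * (27 * primorial z) ≤ 40 * totientProduct z * L

  private
    module _ where
      open ≤-Reasoning

      -- The first two estimates say V ≥ α / (β m); inserting this leaves an inequality between m
      -- and L alone.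
      convert : ∀ α β γ κ {P F B m L} → 0 < α → 0 < P → α * (P * P) ≤ β * (F * B) → B ≤ m * P → γ * β * m ≤ α * κ * L → γ * P ≤ κ * F * L
      convert α β γ κ {P} {F} {B} {m} {L} α>0 P>0 h hB hm = *-cancelˡ-≤′ α α>0 (begin
        α * (γ * P) ≡⟨ e₁ α γ P ⟩
        γ * (α * P) ≤⟨ *-monoʳ-≤ γ αP≤ ⟩
        γ * (β * (F * m)) ≡⟨ e₂ γ β F m ⟩
        F * (γ * β * m) ≤⟨ *-monoʳ-≤ F hm ⟩
        F * (α * κ * L) ≡⟨ e₃ F α κ L ⟩
        α * (κ * F * L) ∎)
        where
        e₁ : ∀ α γ P → α * (γ * P) ≡ γ * (α * P)
        e₁ = solve-∀
        e₂ : ∀ γ β F m → γ * (β * (F * m)) ≡ F * (γ * β * m)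
        e₂ = solve-∀
        e₃ : ∀ F α κ L → F * (α * κ * L) ≡ α * (κ * F * L)
        e₃ = solve-∀
        αP≤ : α * P ≤ β * (F * m)
        αP≤ = *-cancelˡ-≤′ P P>0 (begin
          P * (α * P) ≡⟨ e₁ P α P ⟩
          α * (P * P) ≤⟨ h ⟩
          β * (F * B) ≤⟨ *-monoʳ-≤ β (*-monoʳ-≤ F hB) ⟩
          β * (F * (m * P)) ≡⟨ e₄ β F m P ⟩
          P * (β * (F * m)) ∎)
          where
          e₄ : ∀ β F m P → β * (F * (m * P)) ≡ P * (β * (F * m))
          e₄ = solve-∀

      cube-* : ∀ x y → pow32 ((x * y) ^ 3) ≡ pow32 (x ^ 3) * pow32 (y ^ 3)
      cube-* x y = trans (cong pow32 (*-^ x y 3)) (pow32-* (x ^ 3) (y ^ 3))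

      -- 29/25 is slightly less than the growth 2^(1/4) of q over eight units of lg q, allowing for the factor lg q.
      cubes : ∀ a b e → 2 ^ e * pow32 (a ^ 3) ≤ pow32 (b ^ 3) → ∀ i → 2 ^ (i * e) * pow32 ((a ^ i) ^ 3) ≤ pow32 ((b ^ i) ^ 3)
      cubes a b e h zero = ≤-reflexive (+-identityʳ _)
      cubes a b e h (suc i) = begin
        2 ^ (e + i * e) * pow32 ((a * a ^ i) ^ 3) ≡⟨ cong₂ _*_ (^-distribˡ-+-* 2 e (i * e)) (cube-* a (a ^ i)) ⟩
        2 ^ e * 2 ^ (i * e) * (pow32 (a ^ 3) * pow32 ((a ^ i) ^ 3)) ≡⟨ e₁ (2 ^ e) (2 ^ (i * e)) (pow32 (a ^ 3)) (pow32 ((a ^ i) ^ 3)) ⟩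
        2 ^ e * pow32 (a ^ 3) * (2 ^ (i * e) * pow32 ((a ^ i) ^ 3)) ≤⟨ *-mono-≤ h (cubes a b e h i) ⟩
        pow32 (b ^ 3) * pow32 ((b ^ i) ^ 3) ≡⟨ cube-* b (b ^ i) ⟨
        pow32 ((b * b ^ i) ^ 3) ∎
        where
        e₁ : ∀ x y u v → x * y * (u * v) ≡ x * u * (y * v)
        e₁ = solve-∀

      cube-growth : ∀ {n D R T e₁ e₂} → 0 < D → R * T ≤ n * D → 2 ^ e₁ ≤ pow32 (R ^ 3) → 2 ^ e₂ * pow32 (D ^ 3) ≤ pow32 (T ^ 3) → 2 ^ (e₂ + e₁) ≤ pow32 (n ^ 3)
      cube-growth {n} {D} {R} {T} {e₁} {e₂} D>0 h hR hT = *-cancelˡ-≤′ (pow32 (D ^ 3)) (pow32>0 (m^n>0 D {{>-nonZero D>0}} 3)) (begin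
        pow32 (D ^ 3) * 2 ^ (e₂ + e₁) ≡⟨ cong (pow32 (D ^ 3) *_) (^-distribˡ-+-* 2 e₂ e₁) ⟩
        pow32 (D ^ 3) * (2 ^ e₂ * 2 ^ e₁) ≡⟨ e (pow32 (D ^ 3)) (2 ^ e₂) (2 ^ e₁) ⟩
        2 ^ e₁ * (2 ^ e₂ * pow32 (D ^ 3)) ≤⟨ *-mono-≤ hR hT ⟩
        pow32 (R ^ 3) * pow32 (T ^ 3) ≡⟨ cube-* R T ⟨
        pow32 ((R * T) ^ 3) ≤⟨ pow32-mono (^-monoˡ-≤ 3 h) ⟩
        pow32 ((n * D) ^ 3) ≡⟨ trans (cube-* n D) (*-comm (pow32 (n ^ 3)) _) ⟩
        pow32 (D ^ 3) * pow32 (n ^ 3) ∎)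
        where
        e : ∀ d x y → d * (x * y) ≡ y * (x * d)
        e = solve-∀

    opaque
      -- 230160 and 1143000 are close to 2^(570/32) and 2^(644/32), the sizes of q whose logarithms
      -- are 570 and 644.
      numeric : pow32 230160 ≤ 2 ^ 570 × pow32 1143000 ≤ 2 ^ 644 × pow32 (2561 * 663) ≤ 2 ^ 663
      numeric = subst₂ _≤_ (sym (pow32-^ 230160)) refl (≤ᵇ-sound _ _ refl) , subst₂ _≤_ (sym (pow32-^ 1143000)) refl (≤ᵇ-sound _ _ refl) ,
                subst₂ _≤_ (sym (pow32-^ (2561 * 663))) refl (≤ᵇ-sound _ _ refl)

      numeric-cubes : 2 ^ 1560 ≤ pow32 (78498 ^ 3) × 2 ^ 1605 ≤ pow32 (108000 ^ 3) × 2 ^ 1628 ≤ pow32 (128000 ^ 3) × 2 ^ 20 * pow32 (25 ^ 3) ≤ pow32 (29 ^ 3)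
      numeric-cubes = subst (2 ^ 1560 ≤_) (sym (pow32-^ (78498 ^ 3))) (≤ᵇ-sound _ _ refl) , subst (2 ^ 1605 ≤_) (sym (pow32-^ (108000 ^ 3))) (≤ᵇ-sound _ _ refl) ,
                      subst (2 ^ 1628 ≤_) (sym (pow32-^ (128000 ^ 3))) (≤ᵇ-sound _ _ refl) ,
                      subst₂ (λ a b → 2 ^ 20 * a ≤ b) (sym (pow32-^ (25 ^ 3))) (sym (pow32-^ (29 ^ 3))) (≤ᵇ-sound _ _ refl)

      -- Over eight units of the logarithm q grows by 2^(1/4), which must cover the factor 29/25 and
      -- the growth of m itself, at most 41/40 as m ≥ 320.
      numeric-step : pow32 (41 * 29) ≤ 2 ^ 8 * (pow32 40 * pow32 25)
      numeric-step = subst₂ (λ a b → a ≤ 2 ^ 8 * b) (sym (pow32-^ (41 * 29))) (sym (cong₂ _*_ (pow32-^ 40) (pow32-^ 25))) (≤ᵇ-sound _ _ refl)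

    times-1 : ∀ {Y m} → pow32 Y ≤ 2 ^ m → pow32 Y ≤ 2 ^ m * pow32 1
    times-1 {Y} {m} h = ≤-trans h (≤-reflexive (sym (trans (cong (2 ^ m *_) pow32-1) (*-identityʳ (2 ^ m)))))

  module BeyondMain {z₀ : ℕ} (huge : 1000000 ≤ z₀) (at : Final z₀) where
    open ≤-Reasoning
    open Beyond huge at

    advance : ∀ m δ R Y R′ → 570 ≤ m → pow32 Y ≤ 2 ^ m → R′ * m < δ * Y + R * m → Many m R 1 → Many (m + δ) R′ 1
    advance m δ R Y R′ 570≤m hY hR many z big le with ≤-<-connex R′ (primeCount z * 1)
    ... | inj₁ ok = ok
    ... | inj₂ small = ⊥-elim (<⇒≱ hR (≤-trans (more m δ R 1 Y 570≤m (times-1 {Y} {m} hY) many z big le)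
            (*-monoˡ-≤ m (≤-trans (≤-reflexive (+-comm (primeCount z * 1) 1)) small))))

    many₀ : Many 570 78498 1
    many₀ z big _ = ≤-trans (≤-reflexive (sym (Final.size at))) (≤-trans (primeCount-mono big) (≤-reflexive (sym (*-identityʳ _))))

    many₁ : Many 644 108000 1
    many₁ = advance 570 74 78498 230160 108000 ≤-refl (proj₁ numeric) (≤ᵇ-sound (suc (108000 * 570)) (74 * 230160 + 78498 * 570) refl) many₀

    many₂ : Many 663 128000 1
    many₂ = advance 644 19 108000 1143000 128000 (≤ᵇ-sound 570 644 refl) (proj₁ (proj₂ numeric)) (≤ᵇ-sound (suc (128000 * 644)) (19 * 1143000 + 108000 * 644) refl) many₁

    -- With Y / m = c (29/25)^i, the next eight units of M supply 8 c (29/25)^i primes. Multiplying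
    -- the count by 29/25 needs R (4/25) (29/25)^i of them and one for the crossing; `hc` says that
    -- this suffices.
    module Geometric (c R m₀ : ℕ) (570≤m₀ : 570 ≤ m₀) (hc : 4 * R + 25 ≤ 200 * c) (h₀ : pow32 (c * m₀) ≤ 2 ^ m₀) (many : Many m₀ R 1) where

      Y : ℕ → ℕ
      Y i = c * (i * 8 + m₀) * 29 ^ i

      Y-small : ∀ i → pow32 (Y i) ≤ 2 ^ (i * 8 + m₀) * pow32 (25 ^ i)
      Y-small zero = times-1 {c * m₀ * 1} {m₀} (≤-trans (≤-reflexive (cong pow32 (*-identityʳ (c * m₀)))) h₀)
      Y-small (suc i) = *-cancelˡ-≤′ (pow32 40) (pow32>0 (s≤s (z≤n {39}))) (begin
        pow32 40 * pow32 (Y (suc i)) ≡⟨ pow32-* 40 (Y (suc i)) ⟨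
        pow32 (40 * Y (suc i)) ≤⟨ pow32-mono (begin
          40 * (c * (8 + m) * (29 * 29 ^ i)) ≡⟨ e₁ c (8 + m) (29 ^ i) ⟩
          c * (40 * (8 + m)) * (29 * 29 ^ i) ≤⟨ *-monoˡ-≤ (29 * 29 ^ i) (*-monoʳ-≤ c (begin
            40 * (8 + m) ≡⟨ *-distribˡ-+ 40 8 m ⟩
            320 + 40 * m ≤⟨ +-monoˡ-≤ (40 * m) (≤-trans (≤ᵇ-sound 320 570 refl) (≤-trans 570≤m₀ (m≤n+m m₀ (i * 8)))) ⟩
            41 * m ∎)) ⟩
          c * (41 * m) * (29 * 29 ^ i) ≡⟨ e₂ 41 29 c m (29 ^ i) ⟩
          41 * 29 * Y i ∎) ⟩
        pow32 (41 * 29 * Y i) ≡⟨ pow32-* (41 * 29) (Y i) ⟩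
        pow32 (41 * 29) * pow32 (Y i) ≤⟨ *-mono-≤ numeric-step (Y-small i) ⟩
        2 ^ 8 * (pow32 40 * pow32 25) * (2 ^ m * pow32 (25 ^ i)) ≡⟨ e₃ (2 ^ 8) (pow32 40) (pow32 25) (2 ^ m) (pow32 (25 ^ i)) ⟩
        pow32 40 * (2 ^ 8 * 2 ^ m * (pow32 25 * pow32 (25 ^ i))) ≡⟨ cong (pow32 40 *_) (cong₂ _*_ (^-distribˡ-+-* 2 8 m) (pow32-* 25 (25 ^ i))) ⟨
        pow32 40 * (2 ^ (8 + m) * pow32 (25 ^ suc i)) ∎)
        where
        m = i * 8 + m₀
        e₁ : ∀ c x t → 40 * (c * x * (29 * t)) ≡ c * (40 * x) * (29 * t)
        e₁ = solve-∀
        e₂ : ∀ a b c m t → c * (a * m) * (b * t) ≡ a * b * (c * m * t)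
        e₂ = solve-∀
        e₃ : ∀ a b c x y → a * (b * c) * (x * y) ≡ b * (a * x * (c * y))
        e₃ = solve-∀

      many-at : ∀ i → Many (i * 8 + m₀) (R * 29 ^ i) (25 ^ i)
      many-at zero z big le = subst (_≤ primeCount z * 1) (sym (*-identityʳ R)) (many z big le)
      many-at (suc i) z big le = +-cancelʳ-≤ (25 * t) _ _ (begin
          R * (29 * s) + 25 * t ≤⟨ +-monoʳ-≤ (R * (29 * s)) (*-monoʳ-≤ 25 (^-monoˡ-≤ i (≤ᵇ-sound 25 29 refl))) ⟩
          R * (29 * s) + 25 * s ≡⟨ e₁ R s ⟩
          (4 * R + 25) * s + 25 * (R * s) ≤⟨ +-monoˡ-≤ (25 * (R * s)) (*-monoˡ-≤ s hc) ⟩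
          200 * c * s + 25 * (R * s) ≡⟨ e₂ c s R ⟩
          25 * (8 * (c * s) + R * s) ≤⟨ *-monoʳ-≤ 25 (*-cancelˡ-≤′ m m>0 (begin
            m * (8 * (c * s) + R * s) ≡⟨ e₃ m c s R ⟩
            8 * Y i + R * s * m ≤⟨ more m 8 (R * s) t (Y i) 570≤m (Y-small i) (many-at i) z big (≤-trans (≤-reflexive (cong (_* primorial z) (+-comm m 8))) le) ⟩
            (primeCount z * t + t) * m ≡⟨ *-comm _ m ⟩
            m * (primeCount z * t + t) ∎)) ⟩
          25 * (primeCount z * t + t) ≡⟨ e₄ (primeCount z) t ⟩
          primeCount z * (25 * t) + 25 * t ∎)
        where
        m = i * 8 + m₀
        s = 29 ^ i
        t = 25 ^ i
        570≤m : 570 ≤ m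
        570≤m = ≤-trans 570≤m₀ (m≤n+m m₀ (i * 8))
        m>0 : 0 < m
        m>0 = ≤-trans (≤ᵇ-sound 1 570 refl) 570≤m
        e₁ : ∀ R s → R * (29 * s) + 25 * s ≡ (4 * R + 25) * s + 25 * (R * s)
        e₁ = solve-∀
        e₂ : ∀ c s R → 200 * c * s + 25 * (R * s) ≡ 25 * (8 * (c * s) + R * s)
        e₂ = solve-∀
        e₃ : ∀ m c s R → m * (8 * (c * s) + R * s) ≡ 8 * (c * m * s) + R * s * m
        e₃ = solve-∀
        e₄ : ∀ n t → 25 * (n * t + t) ≡ n * (25 * t) + 25 * t
        e₄ = solve-∀

    opaque
      many-geometric : ∀ i → Many (i * 8 + 663) (128000 * 29 ^ i) (25 ^ i)
      many-geometric = Geometric.many-at 2561 128000 663 (≤ᵇ-sound 570 663 refl) (≤ᵇ-sound (4 * 128000 + 25) (200 * 2561) refl) (proj₂ (proj₂ numeric)) many₂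

    cell : ∀ z K i → (i * 8 + 663) * primorial z ≤ shiftedSum z → shiftedSum z ≤ ((K + i) * 8 + 663) * primorial z →
      ∃ λ i → (i * 8 + 663) * primorial z ≤ shiftedSum z × shiftedSum z ≤ (suc i * 8 + 663) * primorial z
    cell z zero i lo hi = i , lo , ≤-trans hi (*-monoˡ-≤ (primorial z) (+-monoˡ-≤ 663 (*-monoˡ-≤ 8 (n≤1+n i))))
    cell z (suc K) i lo hi with ≤-total (shiftedSum z) ((suc i * 8 + 663) * primorial z)
    ... | inj₁ le = i , lo , le
    ... | inj₂ ge = cell z K (suc i) ge (subst (λ k → shiftedSum z ≤ (k * 8 + 663) * primorial z) (sym (+-suc K i)) hi)

    private
      level-arith : ∀ a b c d m L i → a * m ≤ b * L → a * c ≤ b * d → a * (i * c + m) ≤ b * (i * d + L)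
      level-arith a b c d m L i h₀ h₁ = begin
        a * (i * c + m) ≡⟨ e a i c m ⟩
        i * (a * c) + a * m ≤⟨ +-mono-≤ (*-monoʳ-≤ i h₁) h₀ ⟩
        i * (b * d) + b * L ≡⟨ e b i d L ⟨
        b * (i * d + L) ∎
        where
        e : ∀ a i c m → a * (i * c + m) ≡ i * (a * c) + a * m
        e = solve-∀

      -- 2241 = 83 · 27. By `lower-product` the requirement s ≥ 83/40 becomes L ≥ 2.42 m, where m
      -- bounds M + 11 and L is 32 log₂ of π(z)³.
      package : ∀ z → z₀ ≤ z → ∀ L m → shiftedSum z ≤ m * primorial z → 2241 * 25 * m ≤ 579 * 40 * L → 2 ^ L ≤ pow32 (primeCount z ^ 3) → Sufficient z
      package z big L m hB hm hL = L , hL , ≤-trans (≤-reflexive (sym (*-assoc 83 27 (primorial z))))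
        (convert 579 25 2241 40 {primorial z} {totientProduct z} {shiftedSum z} {m} {L} (≤ᵇ-sound 1 579 refl) (primorial>0 z) (lower-product z big) hB hm)

      cubed : ∀ {R z L} → R ≤ primeCount z * 1 → 2 ^ L ≤ pow32 (R ^ 3) → 2 ^ L ≤ pow32 (primeCount z ^ 3)
      cubed {R} {z} h hL = ≤-trans hL (pow32-mono (^-monoˡ-≤ 3 (subst (R ≤_) (*-identityʳ (primeCount z)) h)))

    -- Each eight units of m cost 2.42 · 8 < 20 in L, and (29/25)³ supplies at least 20, so the
    -- geometric growth suffices from 663 on. The levels 644 and 663 bridge the gap from the count
    -- at a million, where the margin is narrow.
    sufficient-above : ∀ z → z₀ ≤ z → Sufficient z
    sufficient-above z big with ≤-total (shiftedSum z) (644 * primorial z)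
    ... | inj₁ small = package z big 1560 644 small (≤ᵇ-sound (2241 * 25 * 644) (579 * 40 * 1560) refl)
            (cubed {78498} {z} {1560} (≤-trans (≤-reflexive (sym (Final.size at))) (≤-trans (primeCount-mono big) (≤-reflexive (sym (*-identityʳ _))))) (proj₁ numeric-cubes))
    ... | inj₂ above₁ with ≤-total (shiftedSum z) (663 * primorial z)
    ...   | inj₁ small = package z big 1605 663 small (≤ᵇ-sound (2241 * 25 * 663) (579 * 40 * 1605) refl)
              (cubed {108000} {z} {1605} (many₁ z big above₁) (proj₁ (proj₂ numeric-cubes)))
    ...   | inj₂ above₂ with cell z (shiftedSum z) 0 above₂ top
      where
      top : shiftedSum z ≤ ((shiftedSum z + 0) * 8 + 663) * primorial z
      top = ≤-trans (m≤m*n (shiftedSum z) 8) (≤-trans (≤-trans (≤-reflexive (cong (_* 8) (sym (+-identityʳ (shiftedSum z))))) (m≤m+n _ 663))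
        (m≤m*n _ (primorial z) {{>-nonZero (primorial>0 z)}}))
    ...     | i , lo , hi = package z big (i * 20 + 1628) (suc i * 8 + 663) hi
                (≤-trans (≤-reflexive (cong (2241 * 25 *_) (e i))) (level-arith (2241 * 25) (579 * 40) 8 20 671 1628 i
                  (≤ᵇ-sound (2241 * 25 * 671) (579 * 40 * 1628) refl) (≤ᵇ-sound (2241 * 25 * 8) (579 * 40 * 20) refl)))
                (cube-growth {primeCount z} {25 ^ i} {128000} {29 ^ i} {1628} {i * 20} (m^n>0 25 i) (many-geometric i z big lo)
                  (proj₁ (proj₂ (proj₂ numeric-cubes))) (cubes 25 29 20 (proj₂ (proj₂ (proj₂ numeric-cubes))) i))
      where
      e : ∀ i → suc i * 8 + 663 ≡ i * 8 + 671
      e i = trans (cong (_+ 663) (+-comm 8 (i * 8))) (+-assoc (i * 8) 8 663)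

-- Running the computation.

module PrimesToMillion where

  open import Data.List using ([]; _∷_)
  open ProfileTable using (≤ᵇ-sound)
  open PrimeTable
  open PrimeTableSound

  opaque
    -- The stages end at 35 < 6², 1000 < 36² and 1000000 < 1001²; the initial state holds the data
    -- of the primes 2, 3, 5.
    tabulated : run 30 (965 ∷ 999000 ∷ []) 30 5 3 30 8 618 944 74 (2 ^ 75) 50 (2 ^ 51) ≡ true
    tabulated = refl

  -- Opaque, lest the type checker evaluate functions of a million.
  opaque
    million : ℕ
    million = 1000000

    million-large : 1000000 ≤ million
    million-large = ≤-refl

    upto-million : Between 5 million × Final million
    upto-million = sound (965 ∷ 999000 ∷ []) 30 {5} 30 5 3 30 8 618 944 74 (2 ^ 75) 50 (2 ^ 51) tabulated initial
      (stage refl ≤-refl ≤-refl (≤ᵇ-sound 36 36 refl))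

-- The bound π(r)³ for Jacobsthal's function.

module Jacobsthal where

  open import Data.List using (List; []; _∷_)
  open SieveProfile
  open ProfileTable using (≤ᵇ-sound)
  open Pow32
  open Rough
  open Logs
  open Factorials using (from)
  open Mertens
  open LinearSieve
  open PrimeTableSound
  open Growth
  open Levels
  open PrimesToMillion

  smaller-primes : ℕ → List ℕ
  smaller-primes zero = []
  smaller-primes (suc z) = if does (prime? (suc z)) then z ∷ smaller-primes z else smaller-primes z

  -- Bounds for the number of elements that survive sieving M or M + 1 consecutive integers by the primes z + 1, z in the list.
  fewest most : List ℕ → ℕ → ℕ
  fewest zs zero = 0
  fewest [] M = M
  fewest (z ∷ zs) M = fewest zs M ∸ most zs (M / suc z)
  most zs zero = 1
  most [] M = suc M
  most (z ∷ zs) M = most zs M ∸ fewest zs (M / suc z)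

  module Small (a N : ℕ) where
    open Interval a N
    open ≤-Reasoning

    S-decreases : ∀ t d → 0 < d → S d (t + 1) ≤ S d 1
    S-decreases zero d 0<d = ≤-refl
    S-decreases (suc t) d 0<d with decPrime (suc (t + 1))
    ... | yes pp = ≤-trans (m≤m+n _ _) (≤-trans (≤-reflexive (sym (S-prime d (t + 1) 0<d pp))) (S-decreases t d 0<d))
    ... | no ¬p = ≤-trans (≤-reflexive (S-other d (t + 1) ¬p)) (S-decreases t d 0<d)

    few : ∀ M d → 0 < d → N < suc M * d → S d 1 ≤ suc M
    few M d 0<d N< = s≤s⁻¹ (*-cancelʳ-< d (S d 1) (suc (suc M)) (begin-strict
      S d 1 * d ≤⟨ S-upper d 0<d ⟩
      N + d <⟨ +-monoˡ-< d N< ⟩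
      suc M * d + d ≡⟨ +-comm (suc M * d) d ⟩
      suc (suc M) * d ∎))

    many : ∀ M d → 0 < d → M * d ≤ N → M ≤ S d 1
    many M d 0<d ≤N = s≤s⁻¹ (*-cancelʳ-< d M (suc (S d 1)) (begin-strict
      M * d ≤⟨ ≤N ⟩
      N <⟨ S-lower d 0<d ⟩
      S d 1 * d + d ≡⟨ +-comm (S d 1 * d) d ⟩
      suc (S d 1) * d ∎))

    -- M is the integer part of N / d, so wherever the interval lies it contains M or M + 1
    -- multiples of d.
    Bounded : List ℕ → ℕ → Set
    Bounded zs z = ∀ M d → 0 < d → M * d ≤ N → N < suc M * d → fewest zs M ≤ S d z × S d z ≤ most zs M

    bounded-step : ∀ {zs z} t → z ≡ t + 1 → Prime (suc z) → Bounded zs z → Bounded (z ∷ zs) (suc z)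
    bounded-step t refl pp ih zero d 0<d ≤N N< = z≤n , ≤-trans (S-decreases (suc t) d 0<d) (few 0 d 0<d N<)
    bounded-step {zs} {z} t _ pp ih M@(suc _) d 0<d ≤N N< = lower , upper
      where
      p = suc z
      Q = M / p
      here = ih M d 0<d ≤N N<
      -- Nested integer parts: that of M / p is also that of N / (d p).
      there = ih Q (d * p) (*-mono-≤ 0<d (s≤s (z≤n {z}))) (begin
          Q * (d * p) ≡⟨ e Q d p ⟩
          Q * p * d ≤⟨ *-monoˡ-≤ d (m/n*n≤m M p) ⟩
          M * d ≤⟨ ≤N ⟩
          N ∎) (begin-strict
          N <⟨ N< ⟩
          suc M * d ≤⟨ *-monoˡ-≤ d (begin-strict
            M ≡⟨ m≡m%n+[m/n]*n M p ⟩
            M % p + Q * p <⟨ +-monoˡ-< (Q * p) (m%n<n M p) ⟩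
            suc Q * p ∎) ⟩
          suc Q * p * d ≡⟨ e (suc Q) d p ⟨
          suc Q * (d * p) ∎)
        where
        e : ∀ Q d p → Q * (d * p) ≡ Q * p * d
        e = solve-∀
      split : S d (suc z) ≡ S d z ∸ S (d * p) z
      split = sym (trans (cong (_∸ S (d * p) z) (S-prime d z 0<d pp)) (m+n∸n≡m (S d (suc z)) (S (d * p) z)))
      lower : fewest zs M ∸ most zs Q ≤ S d (suc z)
      lower = ≤-trans (∸-mono (proj₁ here) (proj₂ there)) (≤-reflexive (sym split))
      upper : S d (suc z) ≤ most zs M ∸ fewest zs Q
      upper = ≤-trans (≤-reflexive split) (∸-mono (proj₂ here) (proj₁ there))

    bounded : ∀ t → Bounded (smaller-primes (t + 1)) (t + 1)
    bounded zero zero d 0<d ≤N N< = z≤n , few 0 d 0<d N<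
    bounded zero M@(suc _) d 0<d ≤N N< = many M d 0<d ≤N , few M d 0<d N<
    bounded (suc t) = step (prime? (suc (t + 1)))
      where
      step : (dec : Dec (Prime (suc (t + 1)))) →
        Bounded (if does dec then t + 1 ∷ smaller-primes (t + 1) else smaller-primes (t + 1)) (suc (t + 1))
      step (yes pp) = bounded-step t refl pp (bounded t)
      step (no ¬p) M d 0<d ≤N N< = subst (λ s → fewest (smaller-primes (t + 1)) M ≤ s × s ≤ most (smaller-primes (t + 1)) M)
        (sym (S-other d (t + 1) ¬p)) (bounded t M d 0<d ≤N N<)

    survives : ∀ z → 1 ≤ z → 0 < fewest (smaller-primes z) N → ∃ λ y → a ≤ y × y < a + N × Sieved z y
    survives z 1≤z pos = survivor z (≤-trans pos (proj₁ (subst (λ z → Bounded (smaller-primes z) z) (m∸n+n≡m 1≤z) (bounded (z ∸ 1))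
      N 1 (s≤s z≤n) (≤-reflexive (*-identityʳ N)) (≤-reflexive (sym (*-identityʳ (suc N)))))))

  opaque
    -- The ranges 3-4, 5-6, 7-16, 17-40, 41-126, 127-466 are treated at once each: the length is the
    -- cube of π at the left end, and the sieving primes are those up to the right end.
    small-sieves : 1 ≤ fewest (smaller-primes 4) 8 × 1 ≤ fewest (smaller-primes 6) 27 × 1 ≤ fewest (smaller-primes 16) 64 ×
      1 ≤ fewest (smaller-primes 40) 343 × 1 ≤ fewest (smaller-primes 126) 2197 × 1 ≤ fewest (smaller-primes 466) 29791
    small-sieves = ≤ᵇ-sound 1 _ refl , ≤ᵇ-sound 1 _ refl , ≤ᵇ-sound 1 _ refl , ≤ᵇ-sound 1 _ refl , ≤ᵇ-sound 1 _ refl , ≤ᵇ-sound 1 _ refl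

    small-counts : 2 ≤ primeCount 3 × 3 ≤ primeCount 5 × 4 ≤ primeCount 7 × 7 ≤ primeCount 17 × 13 ≤ primeCount 41 × 31 ≤ primeCount 127
    small-counts = ≤ᵇ-sound 2 _ refl , ≤ᵇ-sound 3 _ refl , ≤ᵇ-sound 4 _ refl , ≤ᵇ-sound 7 _ refl , ≤ᵇ-sound 13 _ refl , ≤ᵇ-sound 31 _ refl

  HasSieved : ℕ → Set
  HasSieved z = ∀ a → ∃ λ y → a ≤ y × y < a + primeCount z ^ 3 × Sieved z y

  private
    small : ∀ lo hi n N → n ^ 3 ≡ N → n ≤ primeCount lo → 1 ≤ hi → 1 ≤ fewest (smaller-primes hi) N → ∀ z → lo ≤ z → z ≤ hi → HasSieved z
    small lo hi n N refl hn 1≤hi pos z lo≤z z≤hi a with Small.survives a (n ^ 3) hi 1≤hi pos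
    ... | y , a≤y , y< , sieved = y , a≤y , <-≤-trans y< (+-monoʳ-≤ a (^-monoˡ-≤ 3 (≤-trans hn (primeCount-mono lo≤z)))) ,
            λ p pp p≤z → sieved p pp (≤-trans p≤z z≤hi)

    sieved-small : ∀ z → 3 ≤ z → z ≤ 466 → HasSieved z
    sieved-small z 3≤z z≤ with ≤-<-connex z 4
    ... | inj₁ le = small 3 4 2 8 refl (proj₁ small-counts) (s≤s z≤n) (proj₁ small-sieves) z 3≤z le
    ... | inj₂ g₁ with ≤-<-connex z 6
    ...   | inj₁ le = small 5 6 3 27 refl (proj₁ (proj₂ small-counts)) (s≤s z≤n) (proj₁ (proj₂ small-sieves)) z g₁ le
    ...   | inj₂ g₂ with ≤-<-connex z 16
    ...     | inj₁ le = small 7 16 4 64 refl (proj₁ (proj₂ (proj₂ small-counts))) (s≤s z≤n) (proj₁ (proj₂ (proj₂ small-sieves))) z g₂ le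
    ...     | inj₂ g₃ with ≤-<-connex z 40
    ...       | inj₁ le = small 17 40 7 343 refl (proj₁ (proj₂ (proj₂ (proj₂ small-counts)))) (s≤s z≤n) (proj₁ (proj₂ (proj₂ (proj₂ small-sieves)))) z g₃ le
    ...       | inj₂ g₄ with ≤-<-connex z 126
    ...         | inj₁ le = small 41 126 13 2197 refl (proj₁ (proj₂ (proj₂ (proj₂ (proj₂ small-counts))))) (s≤s z≤n) (proj₁ (proj₂ (proj₂ (proj₂ (proj₂ small-sieves))))) z g₄ le
    ...         | inj₂ g₅ = small 127 466 31 29791 refl (proj₂ (proj₂ (proj₂ (proj₂ (proj₂ small-counts))))) (s≤s z≤n) (proj₂ (proj₂ (proj₂ (proj₂ (proj₂ small-sieves))))) z g₅ z≤

    module Million = BeyondMain million-large (proj₂ upto-million)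
    module Million′ = Beyond million-large (proj₂ upto-million)

  dense-all : ∀ z → 3 ≤ z → Prime (suc z) → totientProduct z * weight (suc z) ≤ 27 * primorial z
  dense-all z 3≤z pp with ≤-<-connex million z
  ... | inj₁ big = Million′.dense-above z big pp
  ... | inj₂ below with ≤-<-connex 5 z
  ...   | inj₁ 5≤z = dense (proj₁ upto-million) z 5≤z below pp
  ...   | inj₂ z<5 with m≤n⇒m<n∨m≡n 3≤z
  ...     | inj₂ refl = ⊥-elim (from-no (prime? 4) pp)
  ...     | inj₁ 4≤z with ≤-antisym (s≤s⁻¹ z<5) 4≤z
  ...       | refl = ≤-trans (*-monoʳ-≤ 2 (s≤s lg5≤)) (≤ᵇ-sound 150 162 refl)
    where
    lg5≤ : lg 5 ≤ 74
    lg5≤ = lg≤ {74} {5} (s≤s z≤n) (subst (_< 2 ^ 75) (sym (pow32-^ 5)) (≤ᵇ-sound (suc (5 ^ 32)) (2 ^ 75) refl))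

  opaque
    prime-421 : Prime 421
    prime-421 = from-yes (prime? 421)

  -- All quantities involved change only at primes, so the table needs entries at primes only.
  enough-from : ∀ {b} z₁ → Between 5 b → 5 ≤ z₁ → 421 ≤ suc z₁ → Prime (suc z₁) → ∀ z → suc z₁ ≤ z → z ≤ b → Enough z
  enough-from {b} z₁ table 5≤z₁ large pp₁ = from {λ z → z ≤ b → Enough z} (suc z₁) (λ ≤b → enough table z₁ 5≤z₁ ≤b pp₁ large) step
    where
    step : ∀ z → suc z₁ ≤ z → (z ≤ b → Enough z) → suc z ≤ b → Enough (suc z)
    step z z₁<z ih ≤b with decPrime (suc z)
    ... | yes pp = enough table z (≤-trans 5≤z₁ (<⇒≤ z₁<z)) ≤b pp (≤-trans large (m≤n⇒m≤1+n z₁<z))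
    ... | no ¬p = subst₂ (λ P n → 83 * (27 * P) ≤ 40 * totientProduct (suc z) * (3 * lg n)) (sym (primorial-nonprime ¬p)) (sym (primeCount-nonprime ¬p))
                    (subst (λ F → 83 * (27 * primorial z) ≤ 40 * F * (3 * lg (primeCount z))) (sym (totient-nonprime ¬p)) (ih (<⇒≤ ≤b)))

  enough-all : ∀ z → 421 ≤ z → z ≤ million → Enough z
  enough-all = enough-from 420 (proj₁ upto-million) (≤ᵇ-sound 5 420 refl) ≤-refl prime-421

  count-positive : ∀ {z} → 3 ≤ z → 0 < primeCount z
  count-positive 3≤z = ≤-trans (≤-trans (s≤s z≤n) (proj₁ small-counts)) (primeCount-mono 3≤z)

  sufficient : ∀ z → 421 ≤ z → Sufficient z
  sufficient z 421≤z with ≤-total million z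
  ... | inj₁ big = Million.sufficient-above z big
  ... | inj₂ below = 3 * lg n , (begin
      2 ^ (3 * lg n) ≡⟨ cong (2 ^_) (*-comm 3 (lg n)) ⟩
      2 ^ (lg n * 3) ≡⟨ ^-*-assoc 2 (lg n) 3 ⟨
      (2 ^ lg n) ^ 3 ≤⟨ ^-monoˡ-≤ 3 (2^lg≤ (count-positive (≤-trans (≤ᵇ-sound 3 421 refl) 421≤z))) ⟩
      pow32 n ^ 3 ≡⟨ pow32-pow n 3 ⟨
      pow32 (n ^ 3) ∎) , enough-all z 421≤z below
    where
    open ≤-Reasoning
    n = primeCount z

  -- Jacobsthal's function at the product of the first n primes is at most n³.
  has-sieved : ∀ z → 3 ≤ z → HasSieved z
  has-sieved z 3≤z a with ≤-<-connex z 466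
  ... | inj₁ le = sieved-small z 3≤z le a
  ... | inj₂ gt with sufficient z (≤-trans (≤ᵇ-sound 421 467 refl) gt)
  ...   | L , valid , big = survivor z (unsifted sifted weight weighted dense-all z L 3≤z valid big)
    where
    open Interval a (primeCount z ^ 3)
    sifted : Sifted (primeCount z ^ 3)
    sifted = record { S = S ; N>0 = m^n>0 (primeCount z) {{>-nonZero (count-positive 3≤z)}} 3 ; sift-prime = S-prime ; sift-other = S-other
                    ; upper₁ = S-upper ; lower₁ = λ d 0<d → <⇒≤ (S-lower d 0<d) }

-- Lower bounds: colourings whose exceptional points have a constant step.

module VdwLower where

  open import Data.Nat.GCD using (module Bézout)
  open import Data.Nat.Coprimality using (Coprime; coprime-Bézout)
  open import Data.Fin using (Fin; zero; suc; toℕ; fromℕ<)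
  open import Data.Fin.Properties using (toℕ-fromℕ<; toℕ<n) renaming (suc-injective to Fin-suc-injective)
  open SieveProfile using (split-≤)

  vdw-mono : ∀ {r ks m n} → m ≤ n → VdWProperty r ks m → VdWProperty r ks n
  vdw-mono m≤n h χ with h χ
  ... | i , x , d , 1≤x , 1≤d , fits , mono = i , x , d , 1≤x , 1≤d , ≤-trans fits m≤n , mono

  -- x + t d ≡ k modulo q is solvable in t, with both sides padded by multiples of q.
  solve-class : ∀ {d q} k x → 0 < q → Coprime d q → ∃ λ t → t < q × ∃ λ a → ∃ λ b → x + t * d + a * q ≡ k + b * q
  solve-class {d} {q@(suc q′)} k x _ coprime = reduce (bezout (coprime-Bézout coprime))
    where
    bezout : Bézout.Identity 1 d q → ∃ λ t → ∃ λ a → ∃ λ b → x + t * d + a * q ≡ k + b * q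
    bezout (Bézout.+- u y eq) = u * (k + q′ * x) , 0 , x + y * (k + q′ * x) ,
      trans (e₁ x u (k + q′ * x) d q) (trans (cong (λ s → x + s * (k + q′ * x)) (sym eq)) (e₂ x y k q′))
      where
      e₁ : ∀ x u w d q → x + u * w * d + 0 * q ≡ x + u * d * w
      e₁ = solve-∀
      e₂ : ∀ x y k q′ → x + (1 + y * suc q′) * (k + q′ * x) ≡ k + (x + y * (k + q′ * x)) * suc q′
      e₂ = solve-∀
    bezout (Bézout.-+ u y eq) = u * (x + q′ * k) , k , y * (x + q′ * k) , +-cancelˡ-≡ (x + q′ * k) _ _
      (trans (e₁ x u d q′ k) (trans (cong (λ s → x + s * (x + q′ * k) + k * suc q′) eq) (e₂ x y k q′)))
      where
      e₁ : ∀ x u d q′ k → x + q′ * k + (x + u * (x + q′ * k) * d + k * suc q′) ≡ x + (1 + u * d) * (x + q′ * k) + k * suc q′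
      e₁ = solve-∀
      e₂ : ∀ x y k q′ → x + y * suc q′ * (x + q′ * k) + k * suc q′ ≡ x + q′ * k + (k + y * (x + q′ * k) * suc q′)
      e₂ = solve-∀
    reduce : (∃ λ t → ∃ λ a → ∃ λ b → x + t * d + a * q ≡ k + b * q) → ∃ λ t → t < q × ∃ λ a → ∃ λ b → x + t * d + a * q ≡ k + b * q
    reduce (t , a , b , eq) = t % q , m%n<n t q , t / q * d + a , b , trans (e x (t % q) (t / q) d a q) (trans (cong (λ t → x + t * d + a * q) (sym (m≡m%n+[m/n]*n t q))) eq)
      where
      e : ∀ x t s d a q → x + t * d + (s * d + a) * q ≡ x + (t + s * q) * d + a * q
      e = solve-∀

  -- The colouring with the r₁ = r − 1 points k, k + q, …, k + (r₁ − 1) q in distinct non-zero colours.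
  module Colouring (r₁ k q j : ℕ) (0<q : 0 < q) (q+j≡k : q + j ≡ k) where

    Point : ℕ → Set
    Point x = ∃ λ (i : Fin r₁) → x ≡ k + toℕ i * q

    point? : ∀ x → Dec (Point x)
    point? x with k ≤? x
    ... | no k≰x = no λ (i , eq) → k≰x (subst (k ≤_) (sym eq) (m≤m+n k _))
    ... | yes k≤x with q ∣? (x ∸ k)
    ...   | no ¬d = no λ (i , eq) → ¬d (divides (toℕ i) (trans (cong (_∸ k) eq) (m+n∸m≡n k _)))
    ...   | yes (divides i eq) with i <? r₁
    ...     | yes i<r = yes (fromℕ< i<r , trans (sym (m+[n∸m]≡n k≤x)) (trans (cong (k +_) eq) (cong (λ i → k + i * q) (sym (toℕ-fromℕ< i<r)))))
    ...     | no i≮r = no λ (i′ , eq′) → i≮r (subst (_< r₁) (*-cancelʳ-≡ (toℕ i′) i q {{>-nonZero 0<q}}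
                  (trans (sym (trans (cong (_∸ k) eq′) (m+n∸m≡n k _))) eq)) (toℕ<n i′))

    χ : ℕ → Fin (suc r₁)
    χ x with point? x
    ... | yes (i , _) = suc i
    ... | no _ = zero

    χ-point : ∀ x i → χ x ≡ suc i → x ≡ k + toℕ i * q
    χ-point x i eq with point? x
    ... | yes (i′ , p) = trans p (cong (λ i → k + toℕ i * q) (Fin-suc-injective eq))
    χ-point x i () | no _

    χ-nonzero : ∀ x → Point x → χ x ≢ zero
    χ-nonzero x p eq with point? x
    ... | no ¬p = ¬p p
    χ-nonzero x p () | yes _

    module Avoids (n : ℕ) (0<k : 0 < k) (fits : n + j * (r₁ ∸ 1) < suc r₁ * k) (1≤r₁ : 1 ≤ r₁) where

      private
        Hit : ℕ → ℕ → Set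
        Hit x d = ∃ λ t → t < k × Point (x + t * d)

        -- With k = q + j one has r k = k + r₁ q + j + j (r₁ - 1), so `fits` puts the first number
        -- after the points in their class modulo q above n - j.
        top : k + r₁ * q + j > n
        top = +-cancelʳ-< (j * (r₁ ∸ 1)) n _ (<-≤-trans fits (≤-reflexive (trans (cong (λ k → suc r₁ * k) (sym q+j≡k)) (trans (e (r₁ ∸ 1) r₁ q j (m+[n∸m]≡n 1≤r₁)) (cong (λ k → k + r₁ * q + j + j * (r₁ ∸ 1)) q+j≡k)))))
          where
          e : ∀ s r q j → suc s ≡ r → suc r * (q + j) ≡ q + j + r * q + j + j * s
          e s .(suc s) q j refl = ring s q j
            where
            ring : ∀ s q j → suc (suc s) * (q + j) ≡ q + j + suc s * q + j + j * s
            ring = solve-∀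

        classify : ∀ v a b → v + a * q ≡ k + b * q → (v + q ≤ k) ⊎ Point v ⊎ (k + r₁ * q ≤ v)
        classify v a b eq with <-≤-connex v k
        ... | inj₁ v<k with <-≤-connex b a
        ...   | inj₂ a≤b = ⊥-elim (<⇒≢ (+-mono-<-≤ v<k (*-monoˡ-≤ q a≤b)) eq)
        ...   | inj₁ b<a = inj₁ (+-cancelʳ-≤ (b * q) _ _ (≤-trans (≤-reflexive (+-assoc v q (b * q))) (≤-trans (+-monoʳ-≤ v (*-monoˡ-≤ q b<a)) (≤-reflexive eq))))
        classify v a b eq | inj₂ k≤v with split-≤ k≤v
        ... | δ , refl with <-≤-connex b a
        ...   | inj₁ b<a = ⊥-elim (<⇒≢ (<-≤-trans (+-monoʳ-< k (*-monoˡ-< q {{>-nonZero 0<q}} b<a)) (+-monoˡ-≤ (a * q) (m≤m+n k δ))) (sym eq))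
        ...   | inj₂ a≤b with split-≤ a≤b
        ...     | i , refl with <-≤-connex i r₁
        ...       | inj₁ i<r = inj₂ (inj₁ (fromℕ< i<r , trans (cong (k +_) δ≡) (cong (λ i → k + i * q) (sym (toℕ-fromℕ< i<r)))))
          where
          δ≡ : δ ≡ i * q
          δ≡ = +-cancelˡ-≡ (k + a * q) δ (i * q) (trans (e₁ k δ (a * q)) (trans eq (trans (cong (k +_) (*-distribʳ-+ q a i)) (sym (+-assoc k _ _)))))
            where
            e₁ : ∀ k δ x → k + x + δ ≡ k + δ + x
            e₁ = solve-∀
        ...       | inj₂ r≤i = inj₂ (inj₂ (+-monoʳ-≤ k (≤-trans (*-monoˡ-≤ q r≤i) (≤-reflexive (sym δ≡)))))
          where
          δ≡ : δ ≡ i * q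
          δ≡ = +-cancelˡ-≡ (k + a * q) δ (i * q) (trans (e₁ k δ (a * q)) (trans eq (trans (cong (k +_) (*-distribʳ-+ q a i)) (sym (+-assoc k _ _)))))
            where
            e₁ : ∀ k δ x → k + x + δ ≡ k + δ + x
            e₁ = solve-∀

        below⇒≤j : ∀ v → v + q ≤ k → v ≤ j
        below⇒≤j v le = +-cancelʳ-≤ q v j (≤-trans le (≤-reflexive (trans (sym q+j≡k) (+-comm q j))))

        -- From a term of the class below the points, climb by q d; the next term cannot jump over all of them.
        climb : ∀ fuel x d t a b → 1 ≤ x → 1 ≤ d → d < suc r₁ ⊎ j ≡ 0 → k ≤ t + fuel → t < k →
          x + t * d + a * q ≡ k + b * q → x + t * d + q ≤ k → Hit x d
        climb zero x d t a b _ _ _ k≤ t<k _ _ = ⊥-elim (<⇒≱ t<k (≤-trans k≤ (≤-reflexive (+-identityʳ t))))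
        climb (suc fuel) x d t a b 1≤x 1≤d small k≤ t<k class low with <-≤-connex (t + q) k
        -- Here t ≥ k - q = j, so the term is at least t + 1 > j; yet a term not above k - q is at
        -- most j.
        ... | inj₂ k≤t+q = ⊥-elim (<⇒≱ (≤-<-trans (below⇒≤j _ low) (≤-<-trans j≤t t<v)) ≤-refl)
          where
          j≤t : j ≤ t
          j≤t = +-cancelʳ-≤ q j t (≤-trans (≤-reflexive (trans (+-comm j q) q+j≡k)) k≤t+q)
          t<v : t < x + t * d
          t<v = +-mono-≤ 1≤x (m≤m*n t d {{>-nonZero 1≤d}})
        ... | inj₁ t+q<k = next (classify (x + (t + q) * d) a (d + b) class′)
          where
          e₁ : ∀ x t q d a → x + (t + q) * d + a * q ≡ x + t * d + a * q + d * q
          e₁ = solve-∀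
          e₂ : ∀ k b q d → k + b * q + d * q ≡ k + (d + b) * q
          e₂ = solve-∀
          class′ : x + (t + q) * d + a * q ≡ k + (d + b) * q
          class′ = trans (e₁ x t q d a) (trans (cong (_+ d * q) class) (e₂ k b q d))
          next : (x + (t + q) * d + q ≤ k) ⊎ Point (x + (t + q) * d) ⊎ (k + r₁ * q ≤ x + (t + q) * d) → Hit x d
          next (inj₁ low′) = climb fuel x d (t + q) a (d + b) 1≤x 1≤d small
            (≤-trans k≤ (≤-trans (≤-reflexive (+-suc t fuel)) (≤-trans (+-monoˡ-≤ fuel (m<m+n t 0<q)) ≤-refl))) t+q<k class′ low′
          next (inj₂ (inj₁ p)) = t + q , t+q<k , p
          -- A step q d from at most k - q to at least k + r₁ q forces d > r₁; and when j = 0 a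
          -- positive term cannot have been low at all.
          next (inj₂ (inj₂ high)) = ⊥-elim (impossible small)
            where
            open ≤-Reasoning
            1+r₁≤d : suc r₁ ≤ d
            1+r₁≤d = *-cancelʳ-≤ (suc r₁) d q {{>-nonZero 0<q}} (+-cancelˡ-≤ (x + t * d) _ _ (begin
              x + t * d + suc r₁ * q ≡⟨ +-assoc (x + t * d) q (r₁ * q) ⟨
              x + t * d + q + r₁ * q ≤⟨ +-monoˡ-≤ (r₁ * q) low ⟩
              k + r₁ * q ≤⟨ high ⟩
              x + (t + q) * d ≡⟨ e₃ x t q d ⟩
              x + t * d + d * q ∎))
              where
              e₃ : ∀ x t q d → x + (t + q) * d ≡ x + t * d + d * q
              e₃ = solve-∀
            impossible : ¬ (d < suc r₁ ⊎ j ≡ 0)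
            impossible (inj₁ d<) = <⇒≱ d< 1+r₁≤d
            impossible (inj₂ j≡0) = <⇒≱ (≤-trans 1≤x (m≤m+n x (t * d))) (≤-trans (below⇒≤j _ low) (≤-reflexive j≡0))

      -- Some term with index t < q lies in the class of the points. If it lay beyond them, then, as
      -- t + j ≤ k - 1, the term j places later would still be at most n, against `top`; if it lies
      -- below them, `climb` applies.
      hit : ∀ x d → 1 ≤ x → 1 ≤ d → x + (k ∸ 1) * d ≤ n → Coprime d q → d < suc r₁ ⊎ j ≡ 0 → Hit x d
      hit x d 1≤x 1≤d inside coprime small with solve-class k x 0<q coprime
      ... | t , t<q , a , b , class = decide (classify (x + t * d) a b class)
        where
        open ≤-Reasoning
        q≤k : q ≤ k
        q≤k = subst (q ≤_) q+j≡k (m≤m+n q j)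
        t<k = <-≤-trans t<q q≤k
        decide : (x + t * d + q ≤ k) ⊎ Point (x + t * d) ⊎ (k + r₁ * q ≤ x + t * d) → Hit x d
        decide (inj₁ low) = climb k x d t a b 1≤x 1≤d small (m≤n+m k t) t<k class low
        decide (inj₂ (inj₁ p)) = t , t<k , p
        decide (inj₂ (inj₂ high)) = ⊥-elim (<⇒≱ top (begin
          k + r₁ * q + j ≤⟨ +-mono-≤ high (m≤m*n j d {{>-nonZero 1≤d}}) ⟩
          x + t * d + j * d ≡⟨ trans (+-assoc x _ _) (cong (x +_) (sym (*-distribʳ-+ d t j))) ⟩
          x + (t + j) * d ≤⟨ +-monoʳ-≤ x (*-monoˡ-≤ d (∸-monoˡ-≤ {suc (t + j)} {k} 1 (subst (suc (t + j) ≤_) q+j≡k (+-monoˡ-≤ j t<q)))) ⟩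
          x + (k ∸ 1) * d ≤⟨ inside ⟩
          n ∎))

      not-vdw : (∀ x d → 1 ≤ x → 1 ≤ d → x + (k ∸ 1) * d ≤ n → (Coprime d q × (d < suc r₁ ⊎ j ≡ 0)) ⊎ (∃ λ t → t < k × x + t * d ≡ k)) →
        ¬ VdWProperty (suc r₁) (k22 k) n
      not-vdw h vdw with vdw χ
      ... | zero , x , d , 1≤x , 1≤d , inside , mono with h x d 1≤x 1≤d inside
      ...   | inj₁ (coprime , small) with hit x d 1≤x 1≤d inside coprime small
      ...     | t , t<k , p = χ-nonzero _ p (mono t t<k)
      not-vdw h vdw | zero , x , d , 1≤x , 1≤d , inside , mono | inj₂ (t , t<k , eq) =
        χ-nonzero _ (fromℕ< 1≤r₁ , trans eq (trans (sym (+-identityʳ k)) (cong (λ i → k + i * q) (sym (toℕ-fromℕ< 1≤r₁))))) (mono t t<k)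
      not-vdw h vdw | suc i , x , d , 1≤x , 1≤d , inside , mono =
        <⇒≢ 1≤d (sym (trans (sym (*-identityˡ d)) (+-cancelˡ-≡ x (1 * d) 0 (trans (χ-point (x + 1 * d) i (mono 1 (s≤s (s≤s z≤n)))) (sym (χ-point (x + 0) i (mono 0 (s≤s z≤n))))))))

-- Upper bounds: too few points to meet every progression.

module VdwUpper where

  open import Data.Fin using (Fin; zero; suc; toℕ; fromℕ<)
  open import Data.Fin.Properties using (toℕ-fromℕ<; toℕ<n; pigeonhole; any?) renaming (_≟_ to _≟ᶠ_)
  open SieveProfile using (split-≤)
  open Rough using (prime>1)

  -- The points outside colour 0 are s 1 < … < s r₁, and they meet every k-term progression in [1, n].
  record Hitting (r₁ k n : ℕ) : Set where
    field
      s : ℕ → ℕ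
      s-zero : s 0 ≡ 0
      s-< : ∀ i → i < r₁ → s i < s (suc i)
      s-gap : ∀ i → i < r₁ → s (suc i) ≤ s i + k
      s-top : n < s r₁ + k
      hits : ∀ x d → 1 ≤ x → 1 ≤ d → x + (k ∸ 1) * d ≤ n → ∃ λ t → t < k × ∃ λ i → i < r₁ × x + t * d ≡ s (suc i)

  module Search (r₁ k n : ℕ) (2≤k : 2 ≤ k) (χ : ℕ → Fin (suc r₁)) where

    Mono : Set
    Mono = ∃ λ (i : Fin (suc r₁)) → ∃ λ x → ∃ λ d → 1 ≤ x × 1 ≤ d × x + (k22 k i ∸ 1) * d ≤ n × (∀ t → t < k22 k i → χ (x + t * d) ≡ i)

    -- A progression has to be exhibited, so its existence is decided by bounded search, and only
    -- its absence is refuted.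
    mono? : Dec Mono
    mono? = any? λ i → map′ (λ (x , _ , d , _ , h) → x , d , h) (λ (x , d , h) → x , x< i x d h , d , d< i x d h , h)
        (anyUpTo? (λ x → anyUpTo? (λ d → (1 ≤? x) ×-dec ((1 ≤? d) ×-dec ((x + (k22 k i ∸ 1) * d ≤? n) ×-dec
          map′ (λ f t lt → f lt) (λ f {t} lt → f t lt) (allUpTo? (λ t → χ (x + t * d) ≟ᶠ i) (k22 k i))))) (suc n)) (suc n))
      where
      Body : Fin (suc r₁) → ℕ → ℕ → Set
      Body i x d = 1 ≤ x × 1 ≤ d × x + (k22 k i ∸ 1) * d ≤ n × (∀ t → t < k22 k i → χ (x + t * d) ≡ i)
      x< : ∀ i x d → Body i x d → x < suc n
      x< i x d (_ , _ , fits , _) = s≤s (≤-trans (m≤m+n x _) fits)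
      long : ∀ (i : Fin (suc r₁)) → 0 < k22 k i ∸ 1
      long zero = ∸-monoˡ-≤ 1 2≤k
      long (suc _) = s≤s z≤n
      d< : ∀ i x d → Body i x d → d < suc n
      d< i x d (_ , _ , fits , _) = s≤s (≤-trans (m≤n*m d (k22 k i ∸ 1) {{>-nonZero (long i)}}) (≤-trans (m≤n+m _ x) fits))

    module _ (none : ¬ Mono) (fits : r₁ * k ≤ n) where

      private
        Bad : ℕ → Set
        Bad y = χ y ≢ zero

      meets : ∀ x d → 1 ≤ x → 1 ≤ d → x + (k ∸ 1) * d ≤ n → ∃ λ t → t < k × Bad (x + t * d)
      meets x d 1≤x 1≤d inside with anyUpTo? (λ t → ¬? (χ (x + t * d) ≟ᶠ zero)) k
      ... | yes h = h
      ... | no ¬h = ⊥-elim (none (zero , x , d , 1≤x , 1≤d , inside , all))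
        where
        all : ∀ t → t < k → χ (x + t * d) ≡ zero
        all t t<k with χ (x + t * d) ≟ᶠ zero
        ... | yes eq = eq
        ... | no bad = ⊥-elim (¬h (t , t<k , bad))

      private
        distinct : ∀ x y → 1 ≤ x → x < y → y ≤ n → Bad x → χ x ≢ χ y
        distinct x y 1≤x x<y y≤n bad eq with χ x in eqx
        ... | zero = bad refl
        ... | suc c = none (suc c , x , y ∸ x , 1≤x , m<n⇒0<n∸m x<y ,
                ≤-trans (≤-reflexive (trans (cong (x +_) (*-identityˡ (y ∸ x))) (m+[n∸m]≡n (<⇒≤ x<y)))) y≤n , both)
          where
          both : ∀ t → t < 2 → χ (x + t * (y ∸ x)) ≡ suc c
          both zero _ = trans (cong χ (+-identityʳ x)) eqx
          both (suc zero) _ = trans (cong χ (trans (cong (x +_) (*-identityˡ (y ∸ x))) (m+[n∸m]≡n (<⇒≤ x<y)))) (sym eq)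
          both (suc (suc t)) (s≤s (s≤s ()))

        same : ∀ x y → 1 ≤ x → x ≤ n → 1 ≤ y → y ≤ n → Bad x → χ x ≡ χ y → x ≡ y
        same x y 1≤x x≤n 1≤y y≤n bad eq with <-cmp x y
        ... | tri≈ _ x≡y _ = x≡y
        ... | tri< x<y _ _ = ⊥-elim (distinct x y 1≤x x<y y≤n bad eq)
        ... | tri> _ _ y<x = ⊥-elim (distinct y x 1≤y y<x x≤n (λ z → bad (trans eq z)) (sym eq))

        inside : ∀ y → y + k ≤ n → suc y + (k ∸ 1) * 1 ≤ n
        inside y h = ≤-trans (≤-reflexive (trans (cong (suc y +_) (*-identityʳ (k ∸ 1))) (trans (sym (+-suc y (k ∸ 1))) (cong (y +_) (m+[n∸m]≡n (≤-trans (s≤s z≤n) 2≤k)))))) h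

        -- Some point in the k integers after y, not necessarily the nearest; `complete` shows
        -- afterwards that none was skipped.
        next : ℕ → ℕ
        next y with y + k ≤? n
        ... | yes h = suc y + proj₁ (meets (suc y) 1 (s≤s z≤n) ≤-refl (inside y h)) * 1
        ... | no _ = suc y

        next-spec : ∀ y → y + k ≤ n → y < next y × next y ≤ y + k × Bad (next y)
        next-spec y h with y + k ≤? n
        ... | no ¬h = ⊥-elim (¬h h)
        ... | yes h′ with meets (suc y) 1 (s≤s z≤n) ≤-refl (inside y h′)
        ...   | t , t<k , bad = s≤s (m≤m+n y _) , ≤-trans (≤-reflexive (trans (cong (suc y +_) (*-identityʳ t)) (sym (+-suc y t)))) (+-monoʳ-≤ y t<k) , bad

        s : ℕ → ℕ
        s zero = 0
        s (suc i) = next (s i)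

        s≤ : ∀ i → i ≤ r₁ → s i ≤ i * k
        room : ∀ i → i < r₁ → s i + k ≤ n
        s≤ zero _ = z≤n
        s≤ (suc i) i<r = ≤-trans (proj₁ (proj₂ (next-spec (s i) (room i i<r)))) (≤-trans (+-monoˡ-≤ k (s≤ i (<⇒≤ i<r))) (≤-reflexive (+-comm (i * k) k)))
        room i i<r = ≤-trans (+-monoˡ-≤ k (s≤ i (<⇒≤ i<r))) (≤-trans (≤-reflexive (+-comm (i * k) k)) (≤-trans (*-monoˡ-≤ k i<r) fits))

        spec : ∀ i → i < r₁ → s i < s (suc i) × s (suc i) ≤ s i + k × Bad (s (suc i))
        spec i i<r = next-spec (s i) (room i i<r)

        s-mono : ∀ t i → t + i ≤ r₁ → s i ≤ s (t + i)
        s-mono zero i _ = ≤-refl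
        s-mono (suc t) i h = ≤-trans (s-mono t i (<⇒≤ h)) (<⇒≤ (proj₁ (spec (t + i) h)))

        s-strict : ∀ i i′ → i < i′ → i′ ≤ r₁ → s i < s i′
        s-strict i i′ i<i′ i′≤r = <-≤-trans (proj₁ (spec i (<-≤-trans i<i′ i′≤r)))
          (subst (λ j → s (suc i) ≤ s j) (m∸n+n≡m i<i′) (s-mono (i′ ∸ suc i) (suc i) (≤-trans (≤-reflexive (m∸n+n≡m i<i′)) i′≤r)))

        in-range : ∀ i → i < r₁ → 1 ≤ s (suc i) × s (suc i) ≤ n
        in-range i i<r = ≤-trans (s≤s z≤n) (proj₁ (spec i i<r)) , ≤-trans (s≤ (suc i) i<r) (≤-trans (*-monoˡ-≤ k i<r) fits)

        -- Each nonzero colour occurs at most once in range. The points s 1, ..., s r₁ and y, with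
        -- colour zero reserved, are r₁ + 2 objects for r₁ + 1 colours, so y coincides with one of
        -- the points.
        complete : ∀ y → 1 ≤ y → y ≤ n → Bad y → ∃ λ i → i < r₁ × y ≡ s (suc i)
        complete y 1≤y y≤n bad = conclude (pigeonhole ≤-refl f)
          where
          point : Fin (suc r₁) → ℕ
          point zero = y
          point (suc i) = s (suc (toℕ i))
          point-bad : ∀ c → Bad (point c)
          point-bad zero = bad
          point-bad (suc i) = proj₂ (proj₂ (spec (toℕ i) (toℕ<n i)))
          point-range : ∀ c → 1 ≤ point c × point c ≤ n
          point-range zero = 1≤y , y≤n
          point-range (suc i) = in-range (toℕ i) (toℕ<n i)
          f : Fin (suc (suc r₁)) → Fin (suc r₁)
          f zero = zero
          f (suc c) = χ (point c)
          conclude : (∃ λ a → ∃ λ b → toℕ a < toℕ b × f a ≡ f b) → ∃ λ i → i < r₁ × y ≡ s (suc i)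
          conclude (zero , zero , () , _)
          conclude (zero , suc b , _ , eq) = ⊥-elim (point-bad b (sym eq))
          conclude (suc a , suc b , s≤s a<b , eq) = locate a b a<b (same (point a) (point b) (proj₁ (point-range a)) (proj₂ (point-range a)) (proj₁ (point-range b)) (proj₂ (point-range b)) (point-bad a) eq)
            where
            locate : ∀ a b → toℕ a < toℕ b → point a ≡ point b → ∃ λ i → i < r₁ × y ≡ s (suc i)
            locate zero (suc i) _ eq = toℕ i , toℕ<n i , eq
            locate (suc a) (suc b) a<b eq = ⊥-elim (<⇒≢ (s-strict (suc (toℕ a)) (suc (toℕ b)) a<b (toℕ<n b)) eq)
            locate zero zero () _
            locate (suc a) zero () _

      hitting : Hitting r₁ k n
      hitting = record { s = s ; s-zero = refl ; s-< = λ i h → proj₁ (spec i h) ; s-gap = λ i h → proj₁ (proj₂ (spec i h)) ; s-top = top ; hits = hits }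
        where
        top : n < s r₁ + k
        top with <-≤-connex n (s r₁ + k)
        ... | inj₁ lt = lt
        ... | inj₂ le with next-spec (s r₁) le
        ...   | lt , bound , bad with complete (next (s r₁)) (≤-trans (s≤s z≤n) lt) (≤-trans bound le) bad
        ...     | i , i<r , eq = ⊥-elim (<⇒≱ lt (≤-trans (≤-reflexive eq)
                    (subst (λ j → s (suc i) ≤ s j) (m∸n+n≡m i<r) (s-mono (r₁ ∸ suc i) (suc i) (≤-reflexive (m∸n+n≡m i<r))))))
        hits : ∀ x d → 1 ≤ x → 1 ≤ d → x + (k ∸ 1) * d ≤ n → ∃ λ t → t < k × ∃ λ i → i < r₁ × x + t * d ≡ s (suc i)
        hits x d 1≤x 1≤d fit with meets x d 1≤x 1≤d fit
        ... | t , t<k , bad with complete (x + t * d) (≤-trans 1≤x (m≤m+n x _)) (≤-trans (+-monoʳ-≤ x (*-monoˡ-≤ d (∸-monoˡ-≤ 1 t<k))) fit) bad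
        ...   | i , i<r , eq = t , t<k , i , i<r , eq

  vdw-from-contradiction : ∀ r₁ k n → 2 ≤ k → r₁ * k ≤ n → ¬ Hitting r₁ k n → VdWProperty (suc r₁) (k22 k) n
  vdw-from-contradiction r₁ k n 2≤k fits impossible χ with Search.mono? r₁ k n 2≤k χ
  ... | yes h = h
  ... | no none = ⊥-elim (impossible (Search.hitting r₁ k n 2≤k χ none fits))

  residue-clash : ∀ {p c c′} A B → c < c′ → c′ < p → c + A * p ≢ c′ + B * p
  residue-clash {p@(suc _)} {c} {c′} A B c<c′ c′<p eq = <⇒≢ c<c′ (trans (sym (m<n⇒m%n≡m (<-trans c<c′ c′<p)))
    (trans (sym ([m+kn]%n≡m%n c A p)) (trans (cong (_% p) eq) (trans ([m+kn]%n≡m%n c′ B p) (m<n⇒m%n≡m c′<p)))))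
  residue-clash {zero} _ _ _ ()

  module Contradiction {R k n : ℕ} (H : Hitting R k n) (2≤k : 2 ≤ k) (1≤R : 1 ≤ R) (D : ℕ) (n+D : n + D ≡ suc R * k) where
    open Hitting H
    open ≤-Reasoning

    private
      0<k : 0 < k
      0<k = ≤-trans (s≤s z≤n) 2≤k

    climb : ∀ t i → t + i ≤ R → s (t + i) ≤ s i + t * k
    climb zero i _ = ≤-reflexive (sym (+-identityʳ (s i)))
    climb (suc t) i h = begin
      s (suc (t + i)) ≤⟨ s-gap (t + i) h ⟩
      s (t + i) + k ≤⟨ +-monoˡ-≤ k (climb t i (<⇒≤ h)) ⟩
      s i + t * k + k ≡⟨ e (s i) (t * k) k ⟩
      s i + suc t * k ∎
      where
      e : ∀ a b k → a + b + k ≡ a + (k + b)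
      e = solve-∀

    increasing : ∀ t i → t + i ≤ R → s i ≤ s (t + i)
    increasing zero i _ = ≤-refl
    increasing (suc t) i h = ≤-trans (increasing t i (<⇒≤ h)) (<⇒≤ (s-< (t + i) h))

    s-≤ : ∀ i → i ≤ R → s i ≤ i * k
    s-≤ i h = subst₂ (λ a b → s a ≤ b + i * k) (+-identityʳ i) s-zero (climb i 0 (≤-trans (≤-reflexive (+-identityʳ i)) h))

    monotone : ∀ {a b} → a ≤ b → b ≤ R → s a ≤ s b
    monotone {a} {b} a≤b b≤R = subst (λ b → s a ≤ s b) (m∸n+n≡m a≤b) (increasing (b ∸ a) a (≤-trans (≤-reflexive (m∸n+n≡m a≤b)) b≤R))

    -- Counted from the top: the last point exceeds n - k and the gaps after b are at most k, so
    -- point b falls short of b k by less than D.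
    s-large : ∀ b → b ≤ R → b * k < s b + D
    s-large b b≤R = +-cancelʳ-< (suc u * k) _ _ (begin-strict
      b * k + suc u * k ≡⟨ e₁ b u k ⟩
      suc (u + b) * k ≡⟨ cong (λ r → suc r * k) u+b ⟩
      suc R * k ≡⟨ n+D ⟨
      n + D <⟨ +-monoˡ-< D s-top ⟩
      s R + k + D ≡⟨ cong (λ r → s r + k + D) u+b ⟨
      s (u + b) + k + D ≤⟨ +-monoˡ-≤ D (+-monoˡ-≤ k (climb u b (≤-reflexive u+b))) ⟩
      s b + u * k + k + D ≡⟨ e₂ (s b) u k D ⟩
      s b + D + suc u * k ∎)
      where
      u = R ∸ b
      u+b : u + b ≡ R
      u+b = m∸n+n≡m b≤R
      e₁ : ∀ b u k → b * k + suc u * k ≡ suc (u + b) * k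
      e₁ = solve-∀
      e₂ : ∀ x u k D → x + u * k + k + D ≡ x + D + suc u * k
      e₂ = solve-∀

    module Window (p : ℕ) (1<p : 1 < p) (D≤k : D ≤ k) (i : ℕ) (g : ℕ) (gap : s (suc i) ≡ s i + g * p)
                  (a : ℕ) (a<i : a < i) (i<a+p : i < a + p) (a+p≤R : a + p ≤ R) where

      fits : s a + k * p ≤ n
      fits = +-cancelʳ-≤ D _ _ (begin
        s a + k * p + D ≤⟨ +-mono-≤ (+-monoˡ-≤ (k * p) (s-≤ a (≤-trans (m≤m+n a p) a+p≤R))) D≤k ⟩
        a * k + k * p + k ≡⟨ e a k p ⟩
        suc (a + p) * k ≤⟨ *-monoˡ-≤ k (s≤s a+p≤R) ⟩
        suc R * k ≡⟨ n+D ⟨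
        n + D ∎)
        where
        e : ∀ a k p → a * k + k * p + k ≡ suc (a + p) * k
        e = solve-∀

      Index : ℕ → Set
      Index c = ∃ λ b → a < b × b ≤ a + p × ∃ λ t → suc (s a + c) + t * p ≡ s b

      -- Each residue class modulo p meets the window in a k-term progression with difference p,
      -- hence contains a point; the window is too short to reach past the point of index a + p.
      index : ∀ c → c < p → Index c
      index c c<p with hits (suc (s a + c)) p (s≤s z≤n) (<⇒≤ 1<p) (≤-trans span fits)
        where
        span : suc (s a + c) + (k ∸ 1) * p ≤ s a + k * p
        span = begin
          suc (s a + c) + (k ∸ 1) * p ≡⟨ e (s a) c ((k ∸ 1) * p) ⟩
          s a + (suc c + (k ∸ 1) * p) ≤⟨ +-monoʳ-≤ (s a) (+-monoˡ-≤ ((k ∸ 1) * p) c<p) ⟩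
          s a + suc (k ∸ 1) * p ≡⟨ cong (λ k → s a + k * p) (m+[n∸m]≡n 0<k) ⟩
          s a + k * p ∎
          where
          e : ∀ x c y → suc (x + c) + y ≡ x + (suc c + y)
          e = solve-∀
      ... | t , t<k , i₀ , i₀<R , eq = suc i₀ , above , below , t , eq
        where
        above : a < suc i₀
        above with <-≤-connex a (suc i₀)
        ... | inj₁ lt = lt
        ... | inj₂ le = ⊥-elim (<⇒≱ (s≤s (≤-trans (m≤m+n (s a) c) (m≤m+n _ (t * p)))) (≤-trans (≤-reflexive eq) (monotone le (≤-trans (m≤m+n a p) a+p≤R))))
        below : suc i₀ ≤ a + p
        below with ≤-<-connex (suc i₀) (a + p)
        ... | inj₁ le = le
        -- A point of larger index lies beyond (a + p) k, by `s-large` and D ≤ k, but the window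
        -- ends at s a + k p ≤ (a + p) k.
        ... | inj₂ gt = ⊥-elim (<⇒≱ (+-cancelʳ-< k ((a + p) * k) (s (suc i₀)) (begin-strict
            (a + p) * k + k ≡⟨ +-comm ((a + p) * k) k ⟩
            suc (a + p) * k ≤⟨ *-monoˡ-≤ k gt ⟩
            suc i₀ * k <⟨ s-large (suc i₀) i₀<R ⟩
            s (suc i₀) + D ≤⟨ +-monoʳ-≤ (s (suc i₀)) D≤k ⟩
            s (suc i₀) + k ∎)) (begin
            s (suc i₀) ≡⟨ eq ⟨
            suc (s a + c) + t * p ≡⟨ e₁ (s a) c (t * p) ⟩
            s a + (suc c + t * p) ≤⟨ +-mono-≤ (s-≤ a (≤-trans (m≤m+n a p) a+p≤R)) (≤-trans (+-monoˡ-≤ (t * p) c<p) (*-monoˡ-≤ p t<k)) ⟩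
            a * k + k * p ≡⟨ e₂ a k p ⟩
            (a + p) * k ∎))
          where
          e₁ : ∀ x c y → suc (x + c) + y ≡ x + (suc c + y)
          e₁ = solve-∀
          e₂ : ∀ a k p → a * k + k * p ≡ (a + p) * k
          e₂ = solve-∀

      -- The indices i and i + 1, whose points agree modulo p, are merged.
      merged : ℕ → ℕ
      merged b with b ≤? i
      ... | yes _ = b ∸ suc a
      ... | no _ = b ∸ 1 ∸ suc a

      merged< : ∀ b → a < b → b ≤ a + p → merged b < p ∸ 1
      merged< b a<b b≤ with b ≤? i
      ... | yes b≤i = +-cancelˡ-< (suc a) _ _ (≤-trans (s≤s (≤-reflexive (m+[n∸m]≡n a<b))) (≤-trans (s≤s b≤i) (≤-trans i<a+p (≤-reflexive (sym (trans (sym (+-suc a (p ∸ 1))) (cong (a +_) (m+[n∸m]≡n (<⇒≤ 1<p)))))))))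
      ... | no b≰i = +-cancelˡ-< (suc a) _ _ (≤-trans (s≤s (≤-reflexive (m+[n∸m]≡n a<b-1))) (≤-trans (≤-reflexive (m+[n∸m]≡n (≤-trans (s≤s z≤n) a<b))) (≤-trans b≤ (≤-reflexive (sym (trans (sym (+-suc a (p ∸ 1))) (cong (a +_) (m+[n∸m]≡n (<⇒≤ 1<p)))))))))
        where
        a<b-1 : a < b ∸ 1
        a<b-1 = ≤-trans a<i (∸-monoˡ-≤ 1 (≰⇒> b≰i))

      merged-injective : ∀ b b′ → a < b → a < b′ → merged b ≡ merged b′ → ∃ λ α → ∃ λ β → s b + α * p ≡ s b′ + β * p
      merged-injective b b′ a<b a<b′ eq with b ≤? i | b′ ≤? i
      ... | yes _ | yes _ = 0 , 0 , cong (λ b → s b + 0) (∸-cancelʳ-≡ a<b a<b′ eq)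
      ... | no b≰i | no b′≰i = 0 , 0 , cong (λ b → s b + 0) (∸-cancelʳ-≡ (≤-trans (s≤s z≤n) a<b) (≤-trans (s≤s z≤n) a<b′) (∸-cancelʳ-≡ (≤-trans a<i (∸-monoˡ-≤ 1 (≰⇒> b≰i))) (≤-trans a<i (∸-monoˡ-≤ 1 (≰⇒> b′≰i))) eq))
      ... | yes b≤i | no b′≰i = g , 0 , trans (cong₂ (λ x y → s x + y) b≡i refl) (trans (sym gap) (trans (cong s (sym b′≡)) (sym (+-identityʳ (s b′)))))
        where
        b≡ : b ≡ b′ ∸ 1
        b≡ = ∸-cancelʳ-≡ a<b (≤-trans a<i (∸-monoˡ-≤ 1 (≰⇒> b′≰i))) eq
        b≡i : b ≡ i
        b≡i = ≤-antisym b≤i (subst (i ≤_) (sym b≡) (∸-monoˡ-≤ 1 (≰⇒> b′≰i)))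
        b′≡ : b′ ≡ suc i
        b′≡ = trans (sym (m+[n∸m]≡n (≤-trans (s≤s z≤n) a<b′))) (cong suc (trans (sym b≡) b≡i))
      ... | no b≰i | yes b′≤i = 0 , g , trans (+-identityʳ (s b)) (trans (cong s b≡suc) (trans gap (cong (λ x → s x + g * p) (sym b′≡i))))
        where
        b′≡ : b′ ≡ b ∸ 1
        b′≡ = ∸-cancelʳ-≡ a<b′ (≤-trans a<i (∸-monoˡ-≤ 1 (≰⇒> b≰i))) (sym eq)
        b′≡i : b′ ≡ i
        b′≡i = ≤-antisym b′≤i (subst (i ≤_) (sym b′≡) (∸-monoˡ-≤ 1 (≰⇒> b≰i)))
        b≡suc : b ≡ suc i
        b≡suc = trans (sym (m+[n∸m]≡n (≤-trans (s≤s z≤n) a<b))) (cong suc (trans (sym b′≡) b′≡i))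

      clash : ∀ c c′ → c < c′ → c′ < p → (I : Index c) (I′ : Index c′) → merged (proj₁ I) ≡ merged (proj₁ I′) → ⊥
      clash c c′ c<c′ c′<p (b , a<b , b≤ , t , at) (b′ , a<b′ , b′≤ , t′ , at′) eq with merged-injective b b′ a<b a<b′ eq
      ... | α , β , same = residue-clash (t + α) (t′ + β) c<c′ c′<p (+-cancelˡ-≡ (suc (s a)) _ _ (begin-equality
            suc (s a) + (c + (t + α) * p) ≡⟨ e (s a) c t α p ⟩
            suc (s a + c) + t * p + α * p ≡⟨ cong (_+ α * p) at ⟩
            s b + α * p ≡⟨ same ⟩
            s b′ + β * p ≡⟨ cong (_+ β * p) at′ ⟨
            suc (s a + c′) + t′ * p + β * p ≡⟨ e (s a) c′ t′ β p ⟨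
            suc (s a) + (c′ + (t′ + β) * p) ∎))
        where
        e : ∀ x c t α p → suc x + (c + (t + α) * p) ≡ suc (x + c) + t * p + α * p
        e = solve-∀

      slot< : ∀ {c} (I : Index c) → merged (proj₁ I) < p ∸ 1
      slot< (b , a<b , b≤ , _) = merged< b a<b b≤

      indexᶠ : (c : Fin p) → Index (toℕ c)
      indexᶠ c = index (toℕ c) (toℕ<n c)

      slot : Fin p → Fin (p ∸ 1)
      slot c = fromℕ< (slot< (indexᶠ c))

      impossible : ⊥
      impossible = conclude (pigeonhole (∸-monoʳ-< {p} {1} {0} (s≤s z≤n) (<⇒≤ 1<p)) slot)
        where
        conclude : (∃ λ c → ∃ λ c′ → toℕ c < toℕ c′ × slot c ≡ slot c′) → ⊥
        conclude (c , c′ , c<c′ , eq) = clash (toℕ c) (toℕ c′) c<c′ (toℕ<n c′) (indexᶠ c) (indexᶠ c′)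
          (trans (sym (toℕ-fromℕ< (slot< (indexᶠ c)))) (trans (cong toℕ eq) (toℕ-fromℕ< (slot< (indexᶠ c′)))))

    -- A window of k p integers around the gap contains exactly p of the points, which are therefore distinct modulo p.
    no-divisible-gap : ∀ p → 1 < p → p ≤ R → D ≤ k → ∀ i → 1 ≤ i → i < R → ∀ g → s (suc i) ≢ s i + g * p
    no-divisible-gap p 1<p p≤R D≤k (suc i′) _ i<R g gap with ≤-total (i′ + p) R
    ... | inj₁ le = Window.impossible p 1<p D≤k (suc i′) g gap i′ ≤-refl (≤-trans (≤-reflexive (+-comm 2 i′)) (+-monoʳ-≤ i′ 1<p)) le
    ... | inj₂ ge = Window.impossible p 1<p D≤k (suc i′) g gap (R ∸ p) (s≤s (≤-trans (∸-monoˡ-≤ p ge) (≤-reflexive (m+n∸n≡m i′ p))))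
                      (≤-trans i<R (≤-reflexive (sym (m∸n+n≡m p≤R)))) (≤-reflexive (m∸n+n≡m p≤R))

    Short : ℕ → ℕ → Set
    Short m i = s (suc i) + m ≤ s i + k

    gaps : ∀ m u → u ≤ R → (∀ i → 1 ≤ i → i < u → Short m i) ⊎ (∃ λ i → 1 ≤ i × i < R × s i + k < s (suc i) + m)
    gaps m zero _ = inj₁ λ _ _ ()
    gaps m (suc zero) _ = inj₁ λ i 1≤i i<1 → ⊥-elim (<⇒≱ i<1 1≤i)
    gaps m (suc u@(suc _)) u<R with gaps m u (<⇒≤ u<R)
    ... | inj₂ found = inj₂ found
    ... | inj₁ short with ≤-<-connex (s (suc u) + m) (s u + k)
    ...   | inj₂ long = inj₂ (u , s≤s z≤n , u<R , long)
    ...   | inj₁ here = inj₁ λ i 1≤i i<1+u → extend i 1≤i (m≤n⇒m<n∨m≡n (s≤s⁻¹ i<1+u))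
      where
      extend : ∀ i → 1 ≤ i → i < u ⊎ i ≡ u → Short m i
      extend i 1≤i (inj₁ i<u) = short i 1≤i i<u
      extend i 1≤i (inj₂ refl) = here

    sum-short : ∀ m → (∀ i → 1 ≤ i → i < R → Short m i) → ∀ t i → 1 ≤ i → t + i ≤ R → s (t + i) + t * m ≤ s i + t * k
    sum-short m short zero i _ _ = ≤-refl
    sum-short m short (suc t) i 1≤i h = begin
      s (suc (t + i)) + (m + t * m) ≡⟨ +-assoc (s (suc (t + i))) m (t * m) ⟨
      s (suc (t + i)) + m + t * m ≤⟨ +-monoˡ-≤ (t * m) (short (t + i) (≤-trans 1≤i (m≤n+m i t)) h) ⟩
      s (t + i) + k + t * m ≡⟨ e₁ (s (t + i)) k (t * m) ⟩
      s (t + i) + t * m + k ≤⟨ +-monoˡ-≤ k (sum-short m short t i 1≤i (<⇒≤ h)) ⟩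
      s i + t * k + k ≡⟨ e₂ (s i) (t * k) k ⟩
      s i + (k + t * k) ∎
      where
      e₁ : ∀ a k b → a + k + b ≡ a + b + k
      e₁ = solve-∀
      e₂ : ∀ a b k → a + b + k ≡ a + (k + b)
      e₂ = solve-∀

    -- If all R - 1 inner gaps were at most k - m, the last point would be at most R k - D, against
    -- `s-large`. So some inner gap is k - t with t < m, and it has a prime factor p ≤ R.
    contradiction-general : ∀ m → D ≡ m * (R ∸ 1) → D ≤ k → (∀ t → t < m → ∃ λ p → Prime p × p ≤ R × p ∣ k ∸ t) → ⊥
    contradiction-general m D≡ D≤k divisor with gaps m R ≤-refl
    ... | inj₁ short = <⇒≱ (s-large R ≤-refl) (begin
        s R + D ≡⟨ cong₂ (λ r d → s r + d) (sym (m∸n+n≡m 1≤R)) (trans D≡ (*-comm m (R ∸ 1))) ⟩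
        s (R ∸ 1 + 1) + (R ∸ 1) * m ≤⟨ sum-short m short (R ∸ 1) 1 ≤-refl (≤-reflexive (m∸n+n≡m 1≤R)) ⟩
        s 1 + (R ∸ 1) * k ≤⟨ +-monoˡ-≤ ((R ∸ 1) * k) (s-≤ 1 1≤R) ⟩
        1 * k + (R ∸ 1) * k ≡⟨ *-distribʳ-+ k 1 (R ∸ 1) ⟨
        (1 + (R ∸ 1)) * k ≡⟨ cong (_* k) (m+[n∸m]≡n 1≤R) ⟩
        R * k ∎)
    ... | inj₂ (i , 1≤i , i<R , long) with split-≤ (<⇒≤ (s-< i i<R))
    ...   | δ , eq with divisor (k ∸ δ) k∸δ<m
      where
      δ≤k : δ ≤ k
      δ≤k = +-cancelˡ-≤ (s i) _ _ (≤-trans (≤-reflexive (sym eq)) (s-gap i i<R))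
      k∸δ<m : k ∸ δ < m
      k∸δ<m = +-cancelˡ-< δ _ _ (≤-trans (s≤s (≤-reflexive (m+[n∸m]≡n δ≤k))) (+-cancelˡ-< (s i) k (δ + m) (≤-trans long (≤-reflexive (trans (cong (_+ m) eq) (+-assoc (s i) δ m))))))
    ...     | p , pp , p≤R , p∣ with subst (p ∣_) (m∸[m∸n]≡n {k} {δ} (+-cancelˡ-≤ (s i) _ _ (≤-trans (≤-reflexive (sym eq)) (s-gap i i<R)))) p∣
    ...       | divides g δ≡ = no-divisible-gap p (prime>1 pp) p≤R D≤k i 1≤i i<R g (trans eq (cong (s i +_) δ≡))

    module _ (D≡R : D ≡ R) (R≤k : R ≤ k) where

      private
        whole : 1 + (k ∸ 1) * suc R ≤ n
        whole = +-cancelʳ-≤ R _ _ (≤-reflexive (trans (e (k ∸ 1) R) (trans (cong (λ k → suc R * k) (m+[n∸m]≡n 0<k)) (trans (sym n+D) (cong (n +_) D≡R)))))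
          where
          e : ∀ k R → 1 + k * suc R + R ≡ suc R * (1 + k)
          e = solve-∀

      -- No inner gap equals k, as p divides k; so they are at most k - 1, and the total length
      -- leaves only s b = b (k - 1) + 1. The progression 1, 1 + r, ... ends exactly at n and must
      -- contain such a point, so r divides b (k - 1) with 1 ≤ b < r.
      contradiction-coprime : ∀ p → 1 < p → p ≤ R → p ∣ k → (∀ b → 1 ≤ b → b ≤ R → ¬ suc R ∣ b * (k ∸ 1)) → ⊥
      contradiction-coprime p 1<p p≤R (divides g k≡) coprime with gaps 1 R ≤-refl
      ... | inj₂ (i , 1≤i , i<R , long) = no-divisible-gap p 1<p p≤R (≤-trans (≤-reflexive D≡R) R≤k) i 1≤i i<R g
              (trans (≤-antisym (s-gap i i<R) (s≤s⁻¹ (≤-trans long (≤-reflexive (+-comm (s (suc i)) 1))))) (cong (s i +_) k≡))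
      ... | inj₁ short with hits 1 (suc R) ≤-refl (s≤s z≤n) whole
      ...   | t , _ , i , i<R , eq = coprime b (s≤s z≤n) i<R (divides t (sym (+-cancelˡ-≡ 1 _ _ (trans eq (+-cancelʳ-≡ b _ _ (trans (≤-antisym upper lower) (sym sum)))))))
        where
        b = suc i
        sum : 1 + b * (k ∸ 1) + b ≡ b * k + 1
        sum = trans (e b (k ∸ 1)) (cong (λ k → b * k + 1) (m+[n∸m]≡n 0<k))
          where
          e : ∀ b k → 1 + b * k + b ≡ b * (1 + k) + 1
          e = solve-∀
        upper : s b + b ≤ b * k + 1
        upper = begin
          s (suc i) + suc i ≡⟨ cong₂ (λ x y → s x + y) (+-comm 1 i) (cong suc (sym (*-identityʳ i))) ⟩
          s (i + 1) + suc (i * 1) ≡⟨ +-suc (s (i + 1)) (i * 1) ⟩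
          suc (s (i + 1) + i * 1) ≤⟨ s≤s (sum-short 1 short i 1 ≤-refl (≤-trans (≤-reflexive (+-comm i 1)) i<R)) ⟩
          suc (s 1 + i * k) ≤⟨ s≤s (+-monoˡ-≤ (i * k) (s-≤ 1 1≤R)) ⟩
          suc (1 * k + i * k) ≡⟨ e i k ⟩
          suc i * k + 1 ∎
          where
          e : ∀ i k → suc (1 * k + i * k) ≡ suc i * k + 1
          e = solve-∀
        lower : b * k + 1 ≤ s b + b
        lower = +-cancelʳ-≤ (u * k + u) _ _ (begin
          b * k + 1 + (u * k + u) ≡⟨ e₁ b u k ⟩
          suc ((u + b) * k) + u ≡⟨ cong (λ r → suc (r * k) + u) u+b ⟩
          suc (R * k) + u ≤⟨ +-monoˡ-≤ u (subst (λ d → R * k < s R + d) D≡R (s-large R ≤-refl)) ⟩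
          s R + R + u ≡⟨ cong (λ r → s r + r + u) u+b ⟨
          s (u + b) + (u + b) + u ≡⟨ e₂ (s (u + b)) u b ⟩
          s (u + b) + u * 1 + (u + b) ≤⟨ +-monoˡ-≤ (u + b) (sum-short 1 short u b (s≤s z≤n) (≤-reflexive u+b)) ⟩
          s b + u * k + (u + b) ≡⟨ e₃ (s b) (u * k) u b ⟩
          s b + b + (u * k + u) ∎)
          where
          u = R ∸ b
          u+b : u + b ≡ R
          u+b = m∸n+n≡m i<R
          e₁ : ∀ b u k → b * k + 1 + (u * k + u) ≡ suc ((u + b) * k) + u
          e₁ = solve-∀
          e₂ : ∀ x u b → x + (u + b) + u ≡ x + u * 1 + (u + b)
          e₂ = solve-∀
          e₃ : ∀ x y u b → x + y + (u + b) ≡ x + b + (y + u)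
          e₃ = solve-∀

      -- The same progression meets a point b k - e with 0 ≤ e < R; as r divides k, it would divide
      -- e + 1 ≤ R.
      contradiction-multiple : suc R ∣ k → ⊥
      contradiction-multiple r∣k with hits 1 (suc R) ≤-refl (s≤s z≤n) whole
      ... | t , _ , i , i<R , eq with split-≤ (s-≤ (suc i) i<R)
      ...   | e , eqk = <⇒≱ (s≤s e<R) (∣⇒≤ (∣m+n∣m⇒∣n (subst (suc R ∣_) bk≡ (∣n⇒∣m*n (suc i) r∣k)) (n∣m*n t)))
        where
        e<R : e < R
        e<R = +-cancelˡ-< (s (suc i)) _ _ (subst₂ (λ x d → x < s (suc i) + d) eqk D≡R (s-large (suc i) i<R))
        bk≡ : suc i * k ≡ t * suc R + suc e
        bk≡ = trans eqk (trans (cong (_+ e) (sym eq)) (sym (+-suc (t * suc R) e)))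

-- The cases of the theorem.

module Assembly where

  open import Data.Nat.GCD using (gcd; gcd[m,n]∣m; gcd[m,n]∣n; gcd-greatest)
  open import Data.Nat.Coprimality using (Coprime; coprime-divisor)
  open SieveProfile using (primorial-prime; primorial>0)
  open Rough
  open Jacobsthal
  open VdwLower
  open VdwUpper

  find-divisor : ∀ z x → Sieved z x ⊎ (∃ λ p → Prime p × p ≤ z × p ∣ x)
  find-divisor zero x = inj₁ λ p pp p≤0 → ⊥-elim (<⇒≱ (prime>0 pp) p≤0)
  find-divisor (suc z) x with find-divisor z x
  ... | inj₂ (p , pp , p≤z , d) = inj₂ (p , pp , m≤n⇒m≤1+n p≤z , d)
  ... | inj₁ h with decPrime (suc z)
  ...   | no ¬p = inj₁ (sieved-suc h (λ pp → ⊥-elim (¬p pp)))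
  ...   | yes pp with suc z ∣? x
  ...     | yes d = inj₂ (suc z , pp , ≤-refl , d)
  ...     | no ¬d = inj₁ (sieved-suc h (λ _ → ¬d))

  sieved-gcd : ∀ r x → Sieved r x → gcd x (primorial r) ≡ 1
  sieved-gcd r x h with gcd x (primorial r) in eq
  ... | zero = ⊥-elim (<⇒≢ (primorial>0 r) (sym (0∣⇒≡0 (subst (_∣ primorial r) eq (gcd[m,n]∣n x (primorial r))))))
  ... | suc zero = refl
  ... | suc (suc g) with prime-divisor {suc (suc g)} (s≤s (s≤s z≤n))
  ...   | p , pp , d = ⊥-elim (h p pp (prime∣primorial⇒≤ r pp (∣-trans d (subst (_∣ primorial r) eq (gcd[m,n]∣n x (primorial r)))))
            (∣-trans d (subst (_∣ x) eq (gcd[m,n]∣m x (primorial r)))))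

  gcd-sieved : ∀ r x → gcd x (primorial r) ≡ 1 → Sieved r x
  gcd-sieved r x eq p pp p≤r d = prime∤1 pp (subst (p ∣_) eq (gcd-greatest d (≤⇒prime∣primorial r pp p≤r)))

  prime-gcd-sieved : ∀ R x → Prime (suc R) → gcd x (primorial (suc R)) ≡ suc R → Sieved R x × suc R ∣ x
  prime-gcd-sieved R x rr eq = sieved , subst (_∣ x) eq (gcd[m,n]∣m x (primorial (suc R)))
    where
    sieved : Sieved R x
    sieved p pp p≤R d with prime⇒irreducible rr (subst (p ∣_) eq (gcd-greatest d (≤⇒prime∣primorial (suc R) pp (m≤n⇒m≤1+n p≤R))))
    ... | inj₁ refl = <⇒≱ (prime>1 pp) ≤-refl
    ... | inj₂ refl = <⇒≱ ≤-refl p≤R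

  sieved-prime-gcd : ∀ R x → Prime (suc R) → Sieved R x → suc R ∣ x → gcd x (primorial (suc R)) ≡ suc R
  sieved-prime-gcd R x rr h r∣x = conclude (gcd-greatest r∣x (≤⇒prime∣primorial (suc R) rr ≤-refl))
    where
    g = gcd x (primorial (suc R))
    conclude : suc R ∣ g → g ≡ suc R
    conclude (divides zero eq) = ⊥-elim (<⇒≢ (primorial>0 (suc R)) (sym (0∣⇒≡0 (subst (_∣ primorial (suc R)) eq (gcd[m,n]∣n x (primorial (suc R)))))))
    conclude (divides (suc zero) eq) = trans eq (+-identityʳ (suc R))
    conclude (divides c@(suc (suc _)) eq) with prime-divisor {c} (s≤s (s≤s z≤n))
    ... | p , pp , p∣c = ⊥-elim (h p pp (prime∣primorial⇒≤ R pp p∣) (∣-trans (∣-trans p∣c (divides (suc R) (trans eq (*-comm c (suc R))))) (gcd[m,n]∣m x (primorial (suc R)))))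
      where
      p∣ : p ∣ primorial R
      p∣ = ∣-trans p∣c (*-cancelˡ-∣ (suc R) (subst₂ _∣_ (trans eq (*-comm c (suc R))) (primorial-prime rr) (gcd[m,n]∣n x (primorial (suc R)))))

  sieved-coprime : ∀ {z d q} → Sieved z q → 1 ≤ d → d ≤ z → Coprime d q
  sieved-coprime {z} {d} h 1≤d d≤z {zero} (0∣d , _) = ⊥-elim (<⇒≢ 1≤d (sym (0∣⇒≡0 0∣d)))
  sieved-coprime h 1≤d d≤z {suc zero} _ = refl
  sieved-coprime {z} {d} h 1≤d d≤z {c@(suc (suc _))} (c∣d , c∣q) with prime-divisor {c} (s≤s (s≤s z≤n))
  ... | p , pp , p∣c = ⊥-elim (h p pp (≤-trans (∣⇒≤ {{>-nonZero 1≤d}} (∣-trans p∣c c∣d)) d≤z) (∣-trans p∣c c∣q))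

  at-least : ∀ {r ks N} → (0 < N → ¬ VdWProperty r ks (N ∸ 1)) → VdWAtLeast r ks N
  at-least {N = suc N} h m m<N v = h (s≤s z≤n) (vdw-mono (s≤s⁻¹ m<N) v)

  module Cases (R K : ℕ) (1≤R : 1 ≤ R) (r≤K : suc R ≤ K) where
    open ≤-Reasoning

    r k : ℕ
    r = suc R
    k = suc K

    2≤k : 2 ≤ k
    2≤k = s≤s (≤-trans (s≤s z≤n) r≤K)

    R≤k : R ≤ k
    R≤k = ≤-trans (n≤1+n R) (m≤n⇒m≤1+n r≤K)

    r*k : r * k ≡ r * K + r
    r*k = trans (*-suc r K) (+-comm r (r * K))

    r*k∸r : r * k ∸ r ≡ r * K
    r*k∸r = trans (cong (_∸ r) r*k) (m+n∸n≡m (r * K) r)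

    not-vdw : ∀ q j n → 0 < q → q + j ≡ k → n + j * (R ∸ 1) < r * k →
      (∀ x d → 1 ≤ x → 1 ≤ d → x + K * d ≤ n → (Coprime d q × (d < r ⊎ j ≡ 0)) ⊎ (∃ λ t → t < k × x + t * d ≡ k)) → ¬ VdWProperty r (k22 k) n
    not-vdw q j n 0<q eq fits = Colouring.Avoids.not-vdw R k q j 0<q eq n (s≤s z≤n) fits 1≤R

    small-step : ∀ {x d n} → 1 ≤ x → x + K * d ≤ n → n ≤ r * K → d < r
    small-step {x} {d} 1≤x fit n≤ with <-≤-connex d r
    ... | inj₁ lt = lt
    ... | inj₂ r≤d = ⊥-elim (<⇒≱ (≤-trans (+-mono-≤ 1≤x (*-monoʳ-≤ K r≤d)) (≤-trans fit n≤)) (≤-reflexive (*-comm r K)))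

    -- With n = r k the last of the R points would have to exceed R k, while R gaps reach at most R
    -- k. For the lower bound the step is k itself.
    case-I : Sieved r k → IsW₂ k r (r * k)
    case-I sieved = vdw-from-contradiction R k (r * k) 2≤k (*-monoˡ-≤ k (n≤1+n R)) absurd , at-least lower
      where
      absurd : ¬ Hitting R k (r * k)
      absurd H = <⇒≱ (C.s-large R ≤-refl) (≤-trans (≤-reflexive (+-identityʳ _)) (C.s-≤ R ≤-refl))
        where module C = Contradiction H 2≤k 1≤R 0 (+-identityʳ (r * k))
      lower : 0 < r * k → ¬ VdWProperty r (k22 k) (r * k ∸ 1)
      lower pos = not-vdw k 0 (r * k ∸ 1) (s≤s z≤n) (+-identityʳ k)
          (≤-reflexive (trans (cong suc (+-identityʳ _)) (m+[n∸m]≡n pos))) λ x d 1≤x 1≤d fit → inj₁ (sieved-coprime sieved 1≤d (d≤r x d 1≤x fit) , inj₂ refl)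
        where
        d≤r : ∀ x d → 1 ≤ x → x + K * d ≤ r * k ∸ 1 → d ≤ r
        d≤r x d 1≤x fit with ≤-<-connex d r
        ... | inj₁ le = le
        ... | inj₂ r<d = ⊥-elim (<⇒≱ (begin-strict
            r * k ≡⟨ r*k ⟩
            r * K + r ≤⟨ +-monoʳ-≤ (r * K) r≤K ⟩
            r * K + K ≡⟨ e r K ⟩
            K * suc r ≤⟨ *-monoʳ-≤ K r<d ⟩
            K * d <⟨ +-monoˡ-≤ (K * d) 1≤x ⟩
            x + K * d ∎) (≤-trans fit (m∸n≤m (r * k) 1)))
          where
          e : ∀ r K → r * K + K ≡ K * suc r
          e = solve-∀

    module Two where
      N : ℕ
      N = r * k ∸ r + 1

      N+R : N + R ≡ r * k
      N+R = trans (cong (λ t → t + 1 + R) r*k∸r) (trans (+-assoc (r * K) 1 R) (sym r*k))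

      R*k≤N : R * k ≤ N
      R*k≤N = +-cancelʳ-≤ R _ _ (≤-trans (+-monoʳ-≤ (R * k) R≤k) (≤-reflexive (trans (+-comm (R * k) k) (sym N+R))))

      upper : (p : ℕ) → Prime p → p ≤ r → p ∣ k → (p ≤ R → Coprime r K) → VdWProperty r (k22 k) N
      upper p pp p≤r p∣k coprime = vdw-from-contradiction R k N 2≤k R*k≤N λ H → absurd H (m≤n⇒m<n∨m≡n p≤r)
        where
        absurd : Hitting R k N → p < r ⊎ p ≡ r → ⊥
        absurd H (inj₂ refl) = Contradiction.contradiction-multiple H 2≤k 1≤R R N+R refl R≤k p∣k
        absurd H (inj₁ (s≤s p≤R)) = Contradiction.contradiction-coprime H 2≤k 1≤R R N+R refl R≤k p (prime>1 pp) p≤R p∣k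
          λ b 1≤b b≤R d → <⇒≱ (s≤s b≤R) (∣⇒≤ {{>-nonZero 1≤b}} (coprime-divisor (coprime p≤R) (subst (r ∣_) (*-comm b K) d)))

      lower-from : ¬ VdWProperty r (k22 k) (r * K) → W₂AtLeast k r N
      lower-from h = at-least λ _ → subst (λ n → ¬ VdWProperty r (k22 k) n) (sym (trans (m+n∸n≡m (r * k ∸ r) 1) r*k∸r)) h

    case-II : ¬ Sieved r k → Sieved r K → IsW₂ k r (r * k ∸ r + 1)
    case-II ¬sieved sieved = upper-II (find-divisor r k) , Two.lower-from (not-vdw K 1 (r * K) (≤-trans (s≤s z≤n) r≤K) (+-comm K 1)
        (≤-trans (s≤s (+-monoʳ-≤ (r * K) (≤-trans (≤-reflexive (+-identityʳ (R ∸ 1))) (m∸n≤m R 1)))) (≤-reflexive (trans (sym (+-suc (r * K) R)) (sym r*k))))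
        λ x d 1≤x 1≤d fit → inj₁ (sieved-coprime sieved 1≤d (<⇒≤ (small-step 1≤x fit ≤-refl)) , inj₁ (small-step 1≤x fit ≤-refl)))
      where
      upper-II : Sieved r k ⊎ (∃ λ p → Prime p × p ≤ r × p ∣ k) → VdWProperty r (k22 k) (r * k ∸ r + 1)
      upper-II (inj₁ h) = ⊥-elim (¬sieved h)
      upper-II (inj₂ (p , pp , p≤r , d)) = Two.upper p pp p≤r d (λ _ → sieved-coprime sieved (s≤s z≤n) ≤-refl)

    -- Step k works again, because up to r (k - 1) all differences are below r and no prime below r
    -- divides k.
    case-II-prime : Prime r → Sieved R k → r ∣ k → IsW₂ k r (r * k ∸ r + 1)
    case-II-prime rr sieved r∣k = Two.upper r rr ≤-refl r∣k (λ r≤R → ⊥-elim (<⇒≱ ≤-refl r≤R)) ,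
      Two.lower-from (not-vdw k 0 (r * K) (s≤s z≤n) (+-identityʳ k) (≤-trans (s≤s (≤-reflexive (+-identityʳ (r * K)))) (≤-trans (m<m+n (r * K) (s≤s z≤n)) (≤-reflexive (sym r*k))))
        λ x d 1≤x 1≤d fit → inj₁ (sieved-coprime sieved 1≤d (s≤s⁻¹ (small-step 1≤x fit ≤-refl)) , inj₂ refl))

    -- For m ≥ 2 the bound on n forces all differences below r, and q = k - m is coprime to them.
    -- For m = 1 one progression with d = r still fits and is treated separately.
    lower-III : ∀ m → 2 ≤ R → Sieved R (k ∸ m) → 2 ≤ m ⊎ (m ≡ 1 × r ∣ K) → W₂AtLeast k r (r * k ∸ m * (R ∸ 1))
    lower-III m 2≤R sieved kind = at-least lower
      where
      q = k ∸ m
      0<q : 0 < q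
      0<q = n≢0⇒n>0 λ q≡0 → sieved 2 prime[2] 2≤R (subst (2 ∣_) (sym q≡0) (2 ∣0))
      m≤k : m ≤ k
      m≤k = <⇒≤ (m<n⇒0<n∸m′ 0<q)
        where
        m<n⇒0<n∸m′ : 0 < k ∸ m → m < k
        m<n⇒0<n∸m′ h with <-≤-connex m k
        ... | inj₁ lt = lt
        ... | inj₂ le = ⊥-elim (<⇒≢ h (sym (m≤n⇒m∸n≡0 le)))
      N = r * k ∸ m * (R ∸ 1)
      lower : 0 < N → ¬ VdWProperty r (k22 k) (N ∸ 1)
      lower pos = not-vdw q m (N ∸ 1) 0<q (m∸n+n≡m m≤k) fits λ x d 1≤x 1≤d fit → steps kind x d 1≤x 1≤d (≤-<-trans (+-monoˡ-≤ (m * (R ∸ 1)) fit) fits)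
        where
        fits : N ∸ 1 + m * (R ∸ 1) < r * k
        fits = ≤-reflexive (trans (cong (_+ m * (R ∸ 1)) (m+[n∸m]≡n pos)) (m∸n+n≡m (<⇒≤ below)))
          where
          below : m * (R ∸ 1) < r * k
          below with <-≤-connex (m * (R ∸ 1)) (r * k)
          ... | inj₁ lt = lt
          ... | inj₂ le = ⊥-elim (<⇒≢ pos (sym (m≤n⇒m∸n≡0 le)))
        steps : 2 ≤ m ⊎ (m ≡ 1 × r ∣ K) → ∀ x d → 1 ≤ x → 1 ≤ d → x + K * d + m * (R ∸ 1) < r * k →
          (Coprime d q × (d < r ⊎ m ≡ 0)) ⊎ (∃ λ t → t < k × x + t * d ≡ k)
        steps kind x d 1≤x 1≤d fit with <-≤-connex d r
        ... | inj₁ d<r = inj₁ (sieved-coprime sieved 1≤d (s≤s⁻¹ d<r) , inj₁ d<r)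
        steps (inj₁ 2≤m) x d 1≤x 1≤d fit | inj₂ r≤d = ⊥-elim (<⇒≱ fit (begin
            r * k ≡⟨ r*k ⟩
            r * K + suc R ≡⟨ cong (λ R → r * K + suc R) (m+[n∸m]≡n 1≤R) ⟨
            r * K + (2 + (R ∸ 1)) ≡⟨ e (r * K) (R ∸ 1) ⟩
            1 + r * K + (1 + (R ∸ 1)) ≤⟨ +-mono-≤ (+-mono-≤ 1≤x (≤-trans (≤-reflexive (*-comm r K)) (*-monoʳ-≤ K r≤d))) (begin
              1 + (R ∸ 1) ≤⟨ +-monoˡ-≤ (R ∸ 1) (∸-monoˡ-≤ 1 2≤R) ⟩
              R ∸ 1 + (R ∸ 1) ≡⟨ cong (R ∸ 1 +_) (sym (+-identityʳ (R ∸ 1))) ⟩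
              2 * (R ∸ 1) ≤⟨ *-monoˡ-≤ (R ∸ 1) 2≤m ⟩
              m * (R ∸ 1) ∎) ⟩
            x + K * d + m * (R ∸ 1) ∎))
          where
          e : ∀ x y → x + (2 + y) ≡ 1 + x + (1 + y)
          e = solve-∀
        -- Room is left only for x = 1 and d = r; this progression contains k = 1 + c r, the first
        -- of the points.
        steps (inj₂ (refl , divides c K≡)) x d 1≤x 1≤d fit | inj₂ r≤d = inj₂ (c , s≤s (≤-trans (m≤m*n c r) (≤-reflexive (sym K≡))) ,
            trans (cong₂ (λ x d → x + c * d) x≡1 d≡r) (cong suc (sym K≡)))
          where
          tight : x + K * d ≤ 1 + r * K
          tight = +-cancelʳ-≤ (1 + 1 * (R ∸ 1)) _ _ (≤-trans (≤-reflexive (+-suc (x + K * d) (1 * (R ∸ 1)))) (≤-trans fit (≤-reflexive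
            (trans r*k (trans (cong (λ R → r * K + suc R) (sym (m+[n∸m]≡n 1≤R))) (e (r * K) (R ∸ 1)))))))
            where
            e : ∀ y s → y + suc (1 + s) ≡ 1 + y + (1 + 1 * s)
            e = solve-∀
          d≡r : d ≡ r
          d≡r = ≤-antisym (s≤s⁻¹ (*-cancelˡ-< K d (suc r) (begin-strict
              K * d <⟨ +-monoˡ-≤ (K * d) 1≤x ⟩
              x + K * d ≤⟨ tight ⟩
              1 + r * K ≤⟨ +-monoˡ-≤ (r * K) (≤-trans (s≤s z≤n) r≤K) ⟩
              K + r * K ≡⟨ *-comm (suc r) K ⟩
              K * suc r ∎))) r≤d
          x≡1 : x ≡ 1
          x≡1 = ≤-antisym (+-cancelʳ-≤ (K * r) _ _ (≤-trans (+-monoʳ-≤ x (*-monoʳ-≤ K r≤d)) (≤-trans tight (≤-reflexive (cong (1 +_) (*-comm r K)))))) 1≤x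

    upper-III : ∀ m → m * (R ∸ 1) ≤ k → (∀ t → t < m → ∃ λ p → Prime p × p ≤ R × p ∣ k ∸ t) → VdWProperty r (k22 k) (r * k ∸ m * (R ∸ 1))
    upper-III m D≤k divisor = vdw-from-contradiction R k N 2≤k (+-cancelʳ-≤ (m * (R ∸ 1)) _ _
        (≤-trans (+-monoʳ-≤ (R * k) D≤k) (≤-reflexive (trans (+-comm (R * k) k) (sym N+D)))))
        λ H → Contradiction.contradiction-general H 2≤k 1≤R (m * (R ∸ 1)) N+D m refl D≤k divisor
      where
      N = r * k ∸ m * (R ∸ 1)
      N+D : N + m * (R ∸ 1) ≡ r * k
      N+D = m∸n+n≡m (≤-trans D≤k (m≤n*m k r))

    -- `has-sieved` is applied to the π(r)³ integers ending at k.
    j-bounded : ∀ j → 2 ≤ R → IsJ k r j → primeCount r ^ 3 * (R ∸ 1) ≤ k → j ≤ primeCount r ^ 3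
    j-bounded j 2≤R (_ , minimal) room with has-sieved r (s≤s 2≤R) (suc k ∸ P)
      where P = primeCount r ^ 3
    ... | y , a≤y , y< , sieved with <-≤-connex (k ∸ y) j
    ...   | inj₂ j≤t = ≤-trans j≤t (≤-trans (∸-monoʳ-≤ k a≤y) (m≤n+o⇒m∸n≤o k (suc k ∸ P) (≤-trans (n≤1+n k) (≤-reflexive (sym (m∸n+n≡m (m≤n⇒m≤1+n P≤k)))))))
      where
      P = primeCount r ^ 3
      P≤k : P ≤ k
      P≤k = ≤-trans (m≤m*n P (R ∸ 1) {{>-nonZero (∸-monoˡ-≤ 1 2≤R)}}) room
    ...   | inj₁ t<j = ⊥-elim (minimal (k ∸ y) t<j (subst (λ x → gcd x (primorial r) ≡ 1) (sym (m∸[m∸n]≡n y≤k)) (sieved-gcd r y sieved)))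
      where
      P = primeCount r ^ 3
      P≤k : P ≤ k
      P≤k = ≤-trans (m≤m*n P (R ∸ 1) {{>-nonZero (∸-monoˡ-≤ 1 2≤R)}}) room
      y≤k : y ≤ k
      y≤k = s≤s⁻¹ (≤-trans y< (≤-reflexive (m∸n+n≡m (m≤n⇒m≤1+n P≤k))))

    -- For r = 2 one of k and k - 1 is odd, so j ≤ 1.
    prime>2 : ∀ j → Prime r → 2 ≤ j → IsJ k r j → 2 ≤ R
    prime>2 j rr 2≤j (_ , minimal) with m≤n⇒m<n∨m≡n 1≤R
    ... | inj₁ 2≤R = 2≤R
    ... | inj₂ refl = ⊥-elim (clash (find-divisor 2 k) (find-divisor 2 K))
      where
      two : ∀ {p} → Prime p → p ≤ 2 → p ≡ 2
      two pp p≤2 = ≤-antisym p≤2 (prime>1 pp)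
      clash : Sieved 2 k ⊎ (∃ λ p → Prime p × p ≤ 2 × p ∣ k) → Sieved 2 K ⊎ (∃ λ p → Prime p × p ≤ 2 × p ∣ K) → ⊥
      clash (inj₁ h) _ = minimal 0 (≤-trans (s≤s z≤n) 2≤j) (sieved-gcd 2 k h)
      clash _ (inj₁ h) = minimal 1 2≤j (sieved-gcd 2 K h)
      clash (inj₂ (p , pp , p≤2 , p∣k)) (inj₂ (p′ , pp′ , p′≤2 , p′∣K)) with two pp p≤2 | two pp′ p′≤2
      ... | refl | refl = prime∤1 pp (∣m+n∣m⇒∣n (subst (2 ∣_) (+-comm 1 K) p∣k) p′∣K)

    room-two : 2 * r ∸ 3 ≤ k → 2 * (R ∸ 1) ≤ k
    room-two = ≤-trans (≤-trans (≤-reflexive (*-distribˡ-∸ 2 R 1)) (≤-trans (∸-monoʳ-≤ (2 * R) (s≤s z≤n)) (≤-reflexive (cong (_∸ 3) (sym (*-suc 2 R))))))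

    room-large : ∀ m j → 2 ≤ R → IsJ k r j → m ≤ j → primeCount r ^ 3 * (R ∸ 1) ≤ k → m * (R ∸ 1) ≤ k
    room-large m j 2≤R isJ m≤j room = ≤-trans (*-monoˡ-≤ (R ∸ 1) (≤-trans m≤j (j-bounded j 2≤R isJ room))) room

    module Composite-r (composite : Composite r) (j : ℕ) (isJ : IsJ k r j) (2≤j : 2 ≤ j) where
      2≤R : 2 ≤ R
      2≤R with m≤n⇒m<n∨m≡n 1≤R
      ... | inj₁ lt = lt
      ... | inj₂ refl = ⊥-elim (prime⇒¬composite prime[2] composite)

      lower : W₂AtLeast k r (r * k ∸ j * (R ∸ 1))
      lower = lower-III j 2≤R (sieved-pred (gcd-sieved r (k ∸ j) (proj₁ isJ))) (inj₁ 2≤j)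

      -- The prime has to be at most R, because a window with p points must fit among R points;
      -- compositeness of r excludes p = r.
      divisor : ∀ t → t < j → ∃ λ p → Prime p × p ≤ R × p ∣ k ∸ t
      divisor t t<j with find-divisor r (k ∸ t)
      ... | inj₁ h = ⊥-elim (proj₂ isJ t t<j (sieved-gcd r (k ∸ t) h))
      ... | inj₂ (p , pp , p≤r , d) with m≤n⇒m<n∨m≡n p≤r
      ...   | inj₁ (s≤s p≤R) = p , pp , p≤R , d
      ...   | inj₂ refl = ⊥-elim (prime⇒¬composite pp composite)

      room : (j ≡ 2 × 2 * r ∸ 3 ≤ k) ⊎ (3 ≤ j × primeCount r ^ 3 * (R ∸ 1) ≤ k) → j * (R ∸ 1) ≤ k
      room (inj₁ (refl , le)) = room-two le
      room (inj₂ (_ , le)) = room-large j j 2≤R isJ ≤-refl le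

      exact : (j ≡ 2 × 2 * r ∸ 3 ≤ k) ⊎ (3 ≤ j × primeCount r ^ 3 * (R ∸ 1) ≤ k) → IsW₂ k r (r * k ∸ j * (R ∸ 1))
      exact cond = upper-III j (room cond) divisor , lower

    module Prime-r (rr : Prime r) (j : ℕ) (isJ : IsJ k r j) (2≤j : 2 ≤ j) (l : ℕ) (isL : IsL k r l) (1≤l : 1 ≤ l) where
      2≤R : 2 ≤ R
      2≤R = prime>2 j rr 2≤j isJ

      lower-j : j ⊓ l ≡ j → W₂AtLeast k r (r * k ∸ (j ⊓ l) * (R ∸ 1))
      lower-j eq rewrite eq = lower-III j 2≤R (sieved-pred (gcd-sieved r (k ∸ j) (proj₁ isJ))) (inj₁ 2≤j)

      lower-l : j ⊓ l ≡ l → W₂AtLeast k r (r * k ∸ (j ⊓ l) * (R ∸ 1))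
      lower-l eq rewrite eq = lower-III l 2≤R (proj₁ h) (kind (m≤n⇒m<n∨m≡n 1≤l))
        where
        h : Sieved R (k ∸ l) × r ∣ k ∸ l
        h = prime-gcd-sieved R (k ∸ l) rr (proj₁ isL)
        kind : 1 < l ⊎ 1 ≡ l → 2 ≤ l ⊎ (l ≡ 1 × r ∣ K)
        kind (inj₁ lt) = inj₁ lt
        kind (inj₂ refl) = inj₂ (refl , proj₂ h)

      lower : W₂AtLeast k r (r * k ∸ (j ⊓ l) * (R ∸ 1))
      lower with ≤-total j l
      ... | inj₁ j≤l = lower-j (m≤n⇒m⊓n≡m j≤l)
      ... | inj₂ l≤j = lower-l (m≥n⇒m⊓n≡n l≤j)

      -- This is where min {j, ℓ} originates: if no prime below r divides k - t, then t ≥ ℓ or t ≥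
      -- j, according as r divides k - t or not.
      divisor : ∀ t → t < j ⊓ l → ∃ λ p → Prime p × p ≤ R × p ∣ k ∸ t
      divisor t t<m with find-divisor R (k ∸ t)
      ... | inj₂ found = found
      ... | inj₁ h with r ∣? (k ∸ t)
      ...   | yes d = ⊥-elim (proj₂ isL t (<-≤-trans t<m (m⊓n≤n j l)) (sieved-prime-gcd R (k ∸ t) rr h d))
      ...   | no ¬d = ⊥-elim (proj₂ isJ t (<-≤-trans t<m (m⊓n≤m j l)) (sieved-gcd r (k ∸ t) (sieved-suc h (λ _ → ¬d))))

      room : (l ≡ 1) ⊎ (j ⊓ l ≡ 2 × 2 * r ∸ 3 ≤ k) ⊎ (3 ≤ j ⊓ l × primeCount r ^ 3 * (R ∸ 1) ≤ k) → (j ⊓ l) * (R ∸ 1) ≤ k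
      room (inj₁ refl) = ≤-trans (*-monoˡ-≤ (R ∸ 1) (m⊓n≤n j 1)) (≤-trans (≤-reflexive (*-identityˡ (R ∸ 1))) (≤-trans (m∸n≤m R 1) R≤k))
      room (inj₂ (inj₁ (eq , le))) = subst (λ m → m * (R ∸ 1) ≤ k) (sym eq) (room-two le)
      room (inj₂ (inj₂ (_ , le))) = room-large (j ⊓ l) j 2≤R isJ (m⊓n≤m j l) le

      exact : (l ≡ 1) ⊎ (j ⊓ l ≡ 2 × 2 * r ∸ 3 ≤ k) ⊎ (3 ≤ j ⊓ l × primeCount r ^ 3 * (R ∸ 1) ≤ k) → IsW₂ k r (r * k ∸ (j ⊓ l) * (R ∸ 1))
      exact cond = upper-III (j ⊓ l) (room cond) divisor , lower

    theorem : (j : ℕ) → IsJ k r j →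
      (j ≡ 0 → IsW₂ k r (r * k))
      × (j ≡ 1 → IsW₂ k r (r * k ∸ r + 1))
      × (Composite r → 2 ≤ j →
          W₂AtLeast k r (r * k ∸ j * (r ∸ 2))
          × ((j ≡ 2 × 2 * r ∸ 3 ≤ k) ⊎ (3 ≤ j × primeCount r ^ 3 * (r ∸ 2) ≤ k) → IsW₂ k r (r * k ∸ j * (r ∸ 2))))
      × (Prime r → (l : ℕ) → IsL k r l →
          (l ≡ 0 → IsW₂ k r (r * k ∸ r + 1))
          × (2 ≤ j → 1 ≤ l →
              W₂AtLeast k r (r * k ∸ (j ⊓ l) * (r ∸ 2))
              × ((l ≡ 1) ⊎ (j ⊓ l ≡ 2 × 2 * r ∸ 3 ≤ k) ⊎ (3 ≤ j ⊓ l × primeCount r ^ 3 * (r ∸ 2) ≤ k) →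
                 IsW₂ k r (r * k ∸ (j ⊓ l) * (r ∸ 2)))))
    theorem j isJ =
      (λ { refl → case-I (gcd-sieved r k (proj₁ isJ)) }) ,
      (λ { refl → case-II (λ h → proj₂ isJ 0 (s≤s z≤n) (sieved-gcd r k h)) (gcd-sieved r K (proj₁ isJ)) }) ,
      (λ composite 2≤j → Composite-r.lower composite j isJ 2≤j , Composite-r.exact composite j isJ 2≤j) ,
      (λ rr l isL →
        (λ { refl → case-II-prime rr (proj₁ (prime-gcd-sieved R k rr (proj₁ isL))) (proj₂ (prime-gcd-sieved R k rr (proj₁ isL))) }) ,
        (λ 2≤j 1≤l → Prime-r.lower rr j isJ 2≤j l isL 1≤l , Prime-r.exact rr j isJ 2≤j l isL 1≤l))

mainTheorem1 : (k r : ℕ) → 2 ≤ r → r < k → (j : ℕ) → IsJ k r j →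
    (j ≡ 0 → IsW₂ k r (r * k))
    × (j ≡ 1 → IsW₂ k r (r * k ∸ r + 1))
    × (Composite r → 2 ≤ j →
    W₂AtLeast k r (r * k ∸ j * (r ∸ 2))
    × ((j ≡ 2 × 2 * r ∸ 3 ≤ k) ⊎ (3 ≤ j × primeCount r ^ 3 * (r ∸ 2) ≤ k) →
    IsW₂ k r (r * k ∸ j * (r ∸ 2))))
    × (Prime r → (l : ℕ) → IsL k r l →
    (l ≡ 0 → IsW₂ k r (r * k ∸ r + 1))
    × (2 ≤ j → 1 ≤ l →
    W₂AtLeast k r (r * k ∸ (j ⊓ l) * (r ∸ 2))
    × ((l ≡ 1) ⊎ (j ⊓ l ≡ 2 × 2 * r ∸ 3 ≤ k)
    ⊎ (3 ≤ j ⊓ l × primeCount r ^ 3 * (r ∸ 2) ≤ k) →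
    IsW₂ k r (r * k ∸ (j ⊓ l) * (r ∸ 2)))))
mainTheorem1 (suc K) (suc R) (s≤s 1≤R) (s≤s r≤K) = Assembly.Cases.theorem R K 1≤R r≤K
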